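{- Let $q$ be a prime power and $V$ an $n$-dimensional vector space over the finite field $\mathbb{F}_q$. Let $n$, $r$, $s$ and $t$ be positive integers, and let $R$, $S$ be subsets of $[n]$ with $t\leq\min (R\cup S)$, $r=\max R$, $s=\max S$ and $r+s-t<n$. If $\mathcal{A}\subseteq{V\brack R}$ and $\mathcal{B}\subseteq{V\brack S}$ are non-empty cross $t$-intersecting, then $$|\mathcal{A}|+|\mathcal{B}|\leq\max\left\{1+\sum_{i\in S}\sum_{j=t}^{i}q^{(r-j)(i-j)}{r\brack j}{n-r\brack i-j},\ 1+\sum_{i\in R}\sum_{j=t}^{i}q^{(s-j)(i-j)}{s\brack j}{n-s\brack i-j}\right\}.\qquad (*)$$ Moreover, the following hold. (1) If $R=S$, then equality holds in $(*)$ if and only if one of the following holds: (i) $\mathcal{A}=\{A\}$ and $\mathcal{B}=\{B\in{V\brack S}:\dim(B\cap A)\geq t\}$ for some $A\in{V\brack r}$; (ii) $\mathcal{B}=\{B\}$ and $\mathcal{A}=\{A\in{V\brack R}:\dim(A\cap B)\geq t\}$ for some $B\in{V\brack s}$. (2) If $R\neq S$ and $s^2+r^2+sr\leq n$, then equality holds in $(*)$ if and only if one of the following holds: (i) $\max (R\bigtriangleup S)\in S$, and $\mathcal{A}=\{A\}$ and $\mathcal{B}=\{B\in{V\brack S}:\dim(B\cap A)\geq t\}$ for some $A\in{V\brack r}$; (ii) $\max (R\bigtriangleup S)\in R$, and $\mathcal{B}=\{B\}$ and $\mathcal{A}=\{A\in{V\brack R}:\dim(A\cap B)\geq t\}$ for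 some $B\in{V\brack s}$.
   Context: $[n]=\{1,2,\ldots,n\}$. ${V\brack k}$ is the family of all $k$-dimensional subspaces of $V$; for $M\subseteq[n]$, ${V\brack M}=\bigcup_{m\in M}{V\brack m}$. For non-negative integers $m,k$, ${m\brack k}=\prod_{i=0}^{k-1}\frac{q^{m-i}-1}{q^{k-i}-1}$ is the Gaussian binomial coefficient (equal to $1$ if $k=0$ and to $0$ if $k>m$). Two families $\mathcal{A}\subseteq{V\brack R}$ and $\mathcal{B}\subseteq{V\brack S}$ are non-empty cross $t$-intersecting if both are non-empty and $\dim(A\cap B)\geq t$ for all $A\in\mathcal{A}$ and $B\in\mathcal{B}$. $R\bigtriangleup S$ denotes the symmetric difference. Since $r=\max R$ and $s=\max S$, the sets $R,S$ are non-empty. -}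

module Defs where

open import Algebra.Apartness.Bundles using (HeytingField; HeytingCommutativeRing)
open import Algebra.Bundles using (CommutativeRing)
open import Algebra.Module.Bundles using (Module)
import Algebra.Properties.CommutativeMonoid.Sum as CommutativeMonoidSum
open import Data.Fin.Base using (Fin; toℕ)
open import Data.Fin.Subset using (Subset; _∪_; _─_) renaming (_∈_ to _∈ᶠ_)
open import Data.Fin.Subset.Properties using (_∈?_)
open import Data.List.Base using (map; filter; allFin; applyUpTo)
import Data.List.Relation.Unary.All.Properties as All
open import Data.Nat.Base renaming (_⊔_ to _⊔ℕ_)
open import Data.Nat.Divisibility
open import Data.Nat.DivMod using (_/_; m/n*n≡m)
open import Data.Nat.ListAction using (sum; product)
open import Data.Nat.ListAction.Properties using (product≢0)
open import Data.Nat.Primality using (Prime; prime⇒nonTrivial)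
open import Data.Nat.Properties
open import Data.Product.Base using (∃; _×_; _,_; proj₁)
open import Data.Vec.Functional using (Vector)
open import Function.Base using (_∘_)
open import Function.Bundles using (Inverse)
open import Level using (Level; _⊔_) renaming (suc to lsuc)
open import Relation.Binary.Bundles using (Setoid)
import Relation.Binary.Construct.On as On
open import Relation.Binary.PropositionalEquality
  using (_≡_; refl; sym; trans; cong; subst; module ≡-Reasoning)
import Relation.Binary.PropositionalEquality.Properties as ≡
open import Relation.Nullary using (yes; no)
open import Relation.Unary using (Pred; _∈_; _∩_; _≐_)
open import Relation.Unary.Relation.Binary.Equality using (≐-setoid)
open import Relation.Binary.Definitions using (_Respects_)

_HasCardinality_ : ∀ {a ℓ} → Setoid a ℓ → ℕ → Set (a ⊔ ℓ)
S HasCardinality k = Inverse S (≡.setoid (Fin k))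

------------------------------------------------------------------------
-- Prime powers and Gaussian binomial coefficients

record PrimePower (q : ℕ) : Set where
  field
    base exponent  : ℕ
    base-prime     : Prime base
    exponent-pos   : 1 ≤ exponent
    q≡base^exponent : q ≡ base ^ exponent

primePower⇒nonTrivial : ∀ {q} → PrimePower q → NonTrivial q
primePower⇒nonTrivial {q} pp = n>1⇒nonTrivial (begin-strict
  1                <⟨ nonTrivial⇒n>1 base ⟩
  base             ≡⟨ sym (^-identityʳ base) ⟩
  base ^ 1         ≤⟨ ^-monoʳ-≤ base exponent-pos ⟩
  base ^ exponent  ≡⟨ sym q≡base^exponent ⟩
  q                ∎)
  where
  open PrimePower pp
  open ≤-Reasoning
  instance
    base-nonTrivial : NonTrivial base
    base-nonTrivial = prime⇒nonTrivial base-prime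
    base-nonZero : NonZero base
    base-nonZero = nonTrivial⇒nonZero base

module Gaussian (q : ℕ) .{{_ : NonTrivial q}} where

  -- ∏_{i=0}^{k-1} (q^(m-i) - 1).  If k > m then the factor i = m vanishes,
  -- so the truncation of m ∸ i for i > m is harmless.
  fallingProduct : ℕ → ℕ → ℕ
  fallingProduct m k = product (applyUpTo (λ i → q ^ (m ∸ i) ∸ 1) k)

  private
    1<q^ : ∀ {e} → 0 < e → 1 < q ^ e
    1<q^ {e} 0<e = begin-strict
      1      <⟨ nonTrivial⇒n>1 q ⟩
      q      ≡⟨ sym (^-identityʳ q) ⟩
      q ^ 1  ≤⟨ ^-monoʳ-≤ q {{nonTrivial⇒nonZero q}} 0<e ⟩
      q ^ e  ∎
      where open ≤-Reasoning

  fallingProduct-nonZero : ∀ k → NonZero (fallingProduct k k)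
  fallingProduct-nonZero k = product≢0 (All.applyUpTo⁺₁ _ k
    (λ i<k → >-nonZero (m<n⇒0<n∸m (1<q^ (m<n⇒0<n∸m i<k)))))

  -- The division has no remainder, by gauss-exact below.
  gauss : ℕ → ℕ → ℕ
  gauss m k = (fallingProduct m k / fallingProduct k k)
                {{fallingProduct-nonZero k}}

  private
    fallingProduct-last : ∀ m k →
      fallingProduct m (suc k) ≡ fallingProduct m k * (q ^ (m ∸ k) ∸ 1)
    fallingProduct-last m       zero    = *-comm (q ^ m ∸ 1) 1
    fallingProduct-last zero    (suc k) = refl
    fallingProduct-last (suc m) (suc k) = trans
      (cong ((q ^ suc m ∸ 1) *_) (fallingProduct-last m k))
      (sym (*-assoc (q ^ suc m ∸ 1) (fallingProduct m k) _))

    fallingProduct-zero : ∀ m k → m < k → fallingProduct m k ≡ 0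
    fallingProduct-zero zero    (suc k) _         = refl
    fallingProduct-zero (suc m) (suc k) (s≤s m<k) = trans
      (cong ((q ^ suc m ∸ 1) *_) (fallingProduct-zero m k m<k))
      (*-zeroʳ (q ^ suc m ∸ 1))

    instance
      q-nonZero : NonZero q
      q-nonZero = nonTrivial⇒nonZero q

    split : ∀ {m k} → k ≤ m →
      q ^ suc m ∸ 1 ≡ q ^ suc k * (q ^ (m ∸ k) ∸ 1) + (q ^ suc k ∸ 1)
    split {m} {k} k≤m = begin
      q ^ suc m ∸ 1
        ≡⟨ cong (λ e → q ^ e ∸ 1) (sym (m+[n∸m]≡n (s≤s k≤m))) ⟩
      q ^ (suc k + (m ∸ k)) ∸ 1
        ≡⟨ cong (_∸ 1) (^-distribˡ-+-* q (suc k) (m ∸ k)) ⟩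
      x * y ∸ 1
        ≡⟨ cong (λ z → x * z ∸ 1) (sym (m∸n+n≡m y≥1)) ⟩
      x * (y ∸ 1 + 1) ∸ 1
        ≡⟨ cong (_∸ 1) (*-distribˡ-+ x (y ∸ 1) 1) ⟩
      x * (y ∸ 1) + x * 1 ∸ 1
        ≡⟨ cong (λ z → x * (y ∸ 1) + z ∸ 1) (*-identityʳ x) ⟩
      x * (y ∸ 1) + x ∸ 1
        ≡⟨ +-∸-assoc (x * (y ∸ 1)) x≥1 ⟩
      x * (y ∸ 1) + (x ∸ 1) ∎
      where
      open ≡-Reasoning
      x = q ^ suc k
      y = q ^ (m ∸ k)
      x≥1 : 1 ≤ x
      x≥1 = m^n>0 q (suc k)
      y≥1 : 1 ≤ y
      y≥1 = m^n>0 q (m ∸ k)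

    fallingProduct-∣ : ∀ m k → fallingProduct k k ∣ fallingProduct m k
    fallingProduct-∣ m       zero    = ∣-refl
    fallingProduct-∣ zero    (suc k) = _ ∣0
    fallingProduct-∣ (suc m) (suc k) with k ≤? m
    ... | no k≰m = subst (fallingProduct (suc k) (suc k) ∣_)
            (sym (fallingProduct-zero (suc m) (suc k) (s≤s (≰⇒> k≰m)))) (_ ∣0)
    ... | yes k≤m = subst (fallingProduct (suc k) (suc k) ∣_) (sym step)
            (∣m∣n⇒∣m+n
              (∣n⇒∣m*n (q ^ suc k) (fallingProduct-∣ m (suc k)))
              (*-monoʳ-∣ b (fallingProduct-∣ m k)))
      where
      open ≡-Reasoning
      a = q ^ (m ∸ k) ∸ 1
      b = q ^ suc k ∸ 1
      f = fallingProduct m k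
      step : fallingProduct (suc m) (suc k) ≡
             q ^ suc k * fallingProduct m (suc k) + b * f
      step = begin
        (q ^ suc m ∸ 1) * f
          ≡⟨ cong (_* f) (split k≤m) ⟩
        (q ^ suc k * a + b) * f
          ≡⟨ *-distribʳ-+ f (q ^ suc k * a) b ⟩
        q ^ suc k * a * f + b * f
          ≡⟨ cong (_+ b * f) (*-assoc (q ^ suc k) a f) ⟩
        q ^ suc k * (a * f) + b * f
          ≡⟨ cong (λ z → q ^ suc k * z + b * f) (*-comm a f) ⟩
        q ^ suc k * (f * a) + b * f
          ≡⟨ cong (λ z → q ^ suc k * z + b * f) (sym (fallingProduct-last m k)) ⟩
        q ^ suc k * fallingProduct m (suc k) + b * f ∎

  gauss-exact : ∀ m k → gauss m k * fallingProduct k k ≡ fallingProduct m k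
  gauss-exact m k =
    m/n*n≡m {{fallingProduct-nonZero k}} (fallingProduct-∣ m k)

------------------------------------------------------------------------
-- Subsets of [n] = {1, …, n}

infix 4 _∈ₙ_
infixl 5 _△_

-- Subset n consists of subsets of Fin n; the index i stands for 1 + toℕ i.
value : ∀ {n} → Fin n → ℕ
value i = suc (toℕ i)

_∈ₙ_ : ∀ {n} → ℕ → Subset n → Set
k ∈ₙ M = ∃ λ i → i ∈ᶠ M × value i ≡ k

IsMax : ∀ {n} → Subset n → ℕ → Set
IsMax M m = m ∈ₙ M × (∀ k → k ∈ₙ M → k ≤ m)

IsMin : ∀ {n} → Subset n → ℕ → Set
IsMin M m = m ∈ₙ M × (∀ k → k ∈ₙ M → m ≤ k)

_△_ : ∀ {n} → Subset n → Subset n → Subset n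
R △ S = (R ─ S) ∪ (S ─ R)

sumOver : ∀ {n} → Subset n → (ℕ → ℕ) → ℕ
sumOver {n} M f = sum (map (f ∘ value) (filter (_∈? M) (allFin n)))

-- f t + f (t + 1) + … + f u, which is 0 if u < t
sumFromTo : ℕ → ℕ → (ℕ → ℕ) → ℕ
sumFromTo t u f = sum (applyUpTo (λ k → f (t + k)) (suc u ∸ t))

module Bound (q : ℕ) .{{_ : NonTrivial q}} where
  open Gaussian q

  -- A term with j > r is 0 because gauss r j is, whatever the exponent.
  branch : ∀ {n} → ℕ → ℕ → Subset n → ℕ
  branch {n} t r M = 1 + sumOver M λ i → sumFromTo t i λ j →
    q ^ ((r ∸ j) * (i ∸ j)) * gauss r j * gauss (n ∸ r) (i ∸ j)

  bound : ∀ {n} → ℕ → ℕ → ℕ → Subset n → Subset n → ℕ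
  bound t r s R S = branch t r S ⊔ℕ branch t s R

------------------------------------------------------------------------
-- Vector spaces

-- A HeytingField with finitely many elements is an ordinary finite field:
-- its equality is decidable and the apartness x # y amounts to ¬ x ≈ y.
fieldRing : ∀ {c ℓ₁ ℓ₂} → HeytingField c ℓ₁ ℓ₂ → CommutativeRing c ℓ₁
fieldRing F = HeytingCommutativeRing.commutativeRing
                (HeytingField.heytingCommutativeRing F)

module VectorSpace {c ℓ₁ ℓ₂ m ℓm : Level} (F : HeytingField c ℓ₁ ℓ₂)
                   (V : Module (fieldRing F) m ℓm) where

  open HeytingField F using (Carrier; _≈_; 0#)
  open Module V
  open CommutativeMonoidSum +ᴹ-commutativeMonoid renaming (sum to sumᴹ)

  lincomb : ∀ {k} → Vector Carrier k → Vector Carrierᴹ k → Carrierᴹ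
  lincomb a v = sumᴹ (λ i → a i *ₗ v i)

  LinearlyIndependent : ∀ {k} → Vector Carrierᴹ k → Set (c ⊔ ℓ₁ ⊔ ℓm)
  LinearlyIndependent v = ∀ a → lincomb a v ≈ᴹ 0ᴹ → ∀ i → a i ≈ 0#

  record HasDim {p} (W : Pred Carrierᴹ p) (k : ℕ)
                : Set (c ⊔ ℓ₁ ⊔ m ⊔ ℓm ⊔ p) where
    field
      basis       : Vector Carrierᴹ k
      basis∈W     : ∀ i → basis i ∈ W
      independent : LinearlyIndependent basis
      spanning    : ∀ x → x ∈ W → ∃ λ a → x ≈ᴹ lincomb a basis

  record Subspace p : Set (c ⊔ m ⊔ ℓm ⊔ lsuc p) where
    field
      ⟦_⟧       : Pred Carrierᴹ p
      resp-≈ᴹ   : ⟦_⟧ Respects _≈ᴹ_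
      0ᴹ-closed : 0ᴹ ∈ ⟦_⟧
      +ᴹ-closed : ∀ {x y} → x ∈ ⟦_⟧ → y ∈ ⟦_⟧ → x +ᴹ y ∈ ⟦_⟧
      *ₗ-closed : ∀ a {x} → x ∈ ⟦_⟧ → a *ₗ x ∈ ⟦_⟧

  open Subspace public using (⟦_⟧)

  -- Equality of subspaces is equality of their sets of vectors.
  subspaceSetoid : ∀ p → Setoid (c ⊔ m ⊔ ℓm ⊔ lsuc p) (m ⊔ p)
  subspaceSetoid p = On.setoid (≐-setoid Carrierᴹ p) ⟦_⟧

  infix 4 _≈ₛ_
  _≈ₛ_ : ∀ {p} → Subspace p → Subspace p → Set (m ⊔ p)
  _≈ₛ_ {p} = Setoid._≈_ (subspaceSetoid p)

  module _ {p : Level} where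

    Grass : ℕ → Pred (Subspace p) (c ⊔ ℓ₁ ⊔ m ⊔ ℓm ⊔ p)
    Grass k W = HasDim ⟦ W ⟧ k

    GrassOf : ∀ {n} → Subset n → Pred (Subspace p) (c ⊔ ℓ₁ ⊔ m ⊔ ℓm ⊔ p)
    GrassOf M W = ∃ λ k → k ∈ₙ M × W ∈ Grass k

    dim[_∩_]≥_ : Subspace p → Subspace p → ℕ → Set (c ⊔ ℓ₁ ⊔ m ⊔ ℓm ⊔ p)
    dim[ A ∩ B ]≥ t = ∃ λ d → HasDim (⟦ A ⟧ ∩ ⟦ B ⟧) d × t ≤ d

  -- As subspaces are compared by ≈ₛ, a set of subspaces is a predicate that
  -- respects ≈ₛ, and its cardinality counts its members up to ≈ₛ.
  record Family p f : Set (c ⊔ m ⊔ ℓm ⊔ lsuc (p ⊔ f)) where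
    field
      members : Pred (Subspace p) f
      resp-≈ₛ : members Respects _≈ₛ_

    setoid : Setoid (c ⊔ m ⊔ ℓm ⊔ lsuc p ⊔ f) (m ⊔ p)
    setoid = On.setoid {B = ∃ members} (subspaceSetoid p) proj₁

  module _ {p f g : Level} where

    CrossIntersecting : ℕ → Pred (Subspace p) f → Pred (Subspace p) g →
                        Set (c ⊔ ℓ₁ ⊔ m ⊔ ℓm ⊔ lsuc p ⊔ f ⊔ g)
    CrossIntersecting t 𝒜 ℬ = ∀ A B → A ∈ 𝒜 → B ∈ ℬ → dim[ A ∩ B ]≥ t

    -- 𝒳 = {X} and 𝒴 = {Y of dimension in M : dim (Y ∩ X) ≥ t}
    -- for some X of dimension k
    SingletonAndMeeting : ∀ {n} → ℕ → ℕ → Subset n →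
                          Pred (Subspace p) f → Pred (Subspace p) g →
                          Set (c ⊔ ℓ₁ ⊔ m ⊔ ℓm ⊔ lsuc p ⊔ f ⊔ g)
    SingletonAndMeeting t k M 𝒳 𝒴 = ∃ λ X →
      X ∈ Grass k ×
      𝒳 ≐ (λ Y → Y ≈ₛ X) ×
      𝒴 ≐ (λ Y → Y ∈ GrassOf M × dim[ Y ∩ X ]≥ t)

{-# OPTIONS --safe #-}
module Submission where

-- Take a cross t-intersecting pair (𝒜, ℬ) with |𝒜| + |ℬ| maximal and |𝒜| ≤ |ℬ|.
-- For every linear automorphism g with 𝒜 ∩ g𝒜 ≠ ∅ the pairs (𝒜 ∩ g𝒜, ℬ ∪ gℬ) and
-- (𝒜 ∪ g𝒜, ℬ ∩ gℬ) are maximal, too: their sizes add up to 2(|𝒜| + |ℬ|), and ℬ ∩ gℬ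
-- is not empty because |𝒜| ≤ |ℬ|.  In a counterexample with 2 ≤ |𝒜| minimal, 𝒜 ∩ g𝒜 is
-- therefore 𝒜 or a singleton for such g.  For a transvection g = 1 + φ(·)u the singleton
-- must be (A ∩ ker φ) + ⟨u⟩ for every A ∈ 𝒜 not fixed by g, since a maximal family
-- contains this subspace of the pencil of A and gA.  So 𝒜 is closed under all other
-- transvections that fix a member of 𝒜, and with these the intersection of some A ∈ 𝒜
-- with a fixed B ∈ ℬ can be made smaller until its dimension drops below t.  Hence 𝒜 is a
-- singleton {A}, and by maximality A has dimension r and ℬ consists of all B that meet A
-- in dimension at least t.

open import Algebra.Apartness.Bundles using (HeytingField)
open import Algebra.Bundles using (CommutativeRing)
open import Algebra.Module.Bundles using (Module)
import Algebra.Morphism.RingMonomorphism as RingMonomorphism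
import Algebra.Properties.CommutativeMonoid.Sum as CommutativeMonoidSum
import Algebra.Properties.Ring as RingProperties
import Algebra.Properties.Semiring.Mult.TCOptimised as Mult
import Algebra.Solver.Ring as RingSolver
open import Algebra.Structures using (IsCommutativeRing)
open import Data.Bool.Base using (Bool; _∧_; _∨_; false; not; true)
import Data.Bool.Properties as Bool
open import Data.Empty using (⊥)
import Data.Fin.Base as Fin
open import Data.Fin.Base using (Fin; combine; remQuot)
import Data.Fin.Properties as Fin
import Data.Fin.Subset as Subset
open import Data.Fin.Subset using (Subset) renaming (_∈_ to _∈ˢ_; _∉_ to _∉ˢ_)
import Data.Fin.Subset.Properties as Subset
import Data.Integer.Base as ℤ
import Data.Integer.Properties as ℤ
import Data.List.Base as List
open import Data.List.Membership.Propositional using (lose) renaming (_∈_ to _∈ₗ_)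
open import Data.List.Membership.Propositional.Properties
  using (∈-++⁺ʳ; ∈-++⁺ˡ; ∈-++⁻; ∈-allFin; ∈-applyUpTo⁺; ∈-applyUpTo⁻; ∈-concatMap⁺; ∈-filter⁺;
    ∈-filter⁻; ∈-map⁺; ∈-map⁻)
import Data.List.Properties as List
import Data.List.Relation.Unary.All as All
open import Data.List.Relation.Unary.Any using (here; there)
open import Data.List.Relation.Unary.Unique.Propositional using (Unique)
import Data.List.Relation.Unary.Unique.Propositional.Properties as Unique
open import Data.Maybe.Base using (Maybe; just; nothing)
import Data.Nat.Base as ℕ
open import Data.Nat.Base using (ℕ; NonTrivial)
import Data.Nat.Properties as ℕ
open import Data.Nat.Solver using (module +-*-Solver)
open import Data.Product.Base using (_,_; _×_; proj₁; proj₂; ∃)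
open import Data.Sum.Base using ([_,_]′; _⊎_; inj₁; inj₂)
open import Data.Unit.Base using (tt)
import Data.Vec.Properties as Vec
open import Defs
open import Function.Base using (_∘_; const; id)
open import Function.Bundles using (Inverse; _⇔_; mk⇔)
open import Level using (Level)
open import Relation.Binary.Definitions using (DecidableEquality; _Respects_)
open import Relation.Binary.PropositionalEquality
import Relation.Binary.Reasoning.Setoid as SetoidReasoning
open import Relation.Nullary using (Dec; contradiction; does; no; yes; ¬_)
open import Relation.Nullary.Decidable
  using (_×-dec_; dec-false; dec-true; decidable-stable; map′; ¬?)
open import Relation.Unary using (Decidable; Pred; U)

-- The hypothesis r + s - t < n enters in one place: it makes A + B a proper subspace for all A ∈ 𝒜
-- and B ∈ ℬ, so that a transvection can have its centre u outside A + B. Then gA ∩ B lies in A ∩ B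
-- ∩ ker φ, which is smaller than A ∩ B if φ does not vanish on A ∩ B. The obstacle is that the same
-- g must fix some member of 𝒜; so two distinct members are carried through the descent. The bound
-- and both equality cases come from one classification of maximal pairs: a pair larger than both
-- stars could be enlarged for ever, and a pair that attains the bound is maximal. For R ≠ S it
-- remains to see which star is larger. For large n the number of i-dimensional members of a star at
-- least doubles with i, so the largest dimension at which R and S differ outweighs all smaller
-- ones. Subspaces given as predicates on V have no decidable equality. The combinatorics therefore
-- runs on reduced row echelon forms over a field with carrier `Fin q`, where equal subspaces are
-- equal terms; coordinates with respect to a basis of V carry the result back.

-- Finite fields on `Fin q` and a ring solver for them.

module FiniteFields where
  open import Algebra.Solver.Ring.AlmostCommutativeRing
    using (AlmostCommutativeRing; fromCommutativeRing; _-Raw-AlmostCommutative⟶_)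
  open import Data.Integer.Base using (ℤ; +_; -[1+_]; +0; +[1+_])
  open import Data.Nat.Base using (zero; suc)

  -- The carrier is `Fin q` itself, so that equality is propositional and decidable and every search
  -- over scalars is finite.
  record FiniteField (q : ℕ) : Set where
    infixl 6 _+_
    infixl 7 _*_
    infix  8 -_
    field
      _+_ _*_           : Fin q → Fin q → Fin q
      -_                : Fin q → Fin q
      0# 1#             : Fin q
      isCommutativeRing : IsCommutativeRing _≡_ _+_ _*_ -_ 0# 1#
      inverse           : ∀ x → x ≢ 0# → ∃ λ y → y * x ≡ 1#
      1<q               : 1 ℕ.< q

  -- Integer coefficients let the solver cancel constants such as 1 - 1 in any characteristic. The
  -- multiples of 1 are the variant in which `1 ⋆ x` computes to `x`, so `con 1ℤ` stands for `1#`
  -- itself.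
  module IntegerRingSolver {c} {A : Set c} {_+_ _*_ : A → A → A} { -_ : A → A} {0# 1# : A}
      (isCommutativeRing : IsCommutativeRing _≡_ _+_ _*_ -_ 0# 1#) where

    private
      R : CommutativeRing _ _
      R = record { isCommutativeRing = isCommutativeRing }
      module R = CommutativeRing R
      open RingProperties R.ring using (-‿involutive; -‿+-comm; -‿distribˡ-*; -‿distribʳ-*; -0#≈0#)
      open Mult R.semiring using (×-homo-+; ×1-homo-*; 1+×) renaming (_×_ to _⋆_)

      fromℤ : ℤ → A
      fromℤ (+ n)    = n ⋆ 1#
      fromℤ -[1+ n ] = - (suc n ⋆ 1#)

      fromℤ-neg : ∀ i → fromℤ (ℤ.- i) ≡ - fromℤ i
      fromℤ-neg +0       = sym -0#≈0#
      fromℤ-neg +[1+ n ] = refl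
      fromℤ-neg -[1+ n ] = sym (-‿involutive _)

      fromℤ-⊖ : ∀ m n → fromℤ (m ℤ.⊖ n) ≡ (m ⋆ 1#) + (- (n ⋆ 1#))
      fromℤ-⊖ m       zero    = sym (trans (cong (λ z → (m ⋆ 1#) + z) -0#≈0#) (R.+-identityʳ _))
      fromℤ-⊖ zero    (suc n) = sym (R.+-identityˡ _)
      fromℤ-⊖ (suc m) (suc n) = begin
        fromℤ (suc m ℤ.⊖ suc n)                    ≡⟨ cong fromℤ (ℤ.[1+m]⊖[1+n]≡m⊖n m n) ⟩
        fromℤ (m ℤ.⊖ n)                            ≡⟨ fromℤ-⊖ m n ⟩
        a + (- b)                                  ≡⟨ cong (λ z → z + (- b)) (sym (R.+-identityˡ a)) ⟩
        (0# + a) + (- b)                           ≡⟨ cong (λ z → (z + a) + (- b)) (sym (R.-‿inverseʳ 1#)) ⟩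
        ((1# + (- 1#)) + a) + (- b)                ≡⟨ cong (λ z → z + (- b)) (trans (R.+-assoc _ _ _)
                                                        (trans (cong (λ z → 1# + z) (R.+-comm _ _)) (sym (R.+-assoc _ _ _)))) ⟩
        ((1# + a) + (- 1#)) + (- b)                ≡⟨ R.+-assoc _ _ _ ⟩
        (1# + a) + ((- 1#) + (- b))                ≡⟨ cong (λ z → (1# + a) + z) (-‿+-comm 1# b) ⟩
        (1# + a) + (- (1# + b))                    ≡⟨ cong₂ (λ y z → y + (- z)) (sym (1+× m 1#)) (sym (1+× n 1#)) ⟩
        (suc m ⋆ 1#) + (- (suc n ⋆ 1#))            ∎
        where
        open ≡-Reasoning
        a = m ⋆ 1#
        b = n ⋆ 1#

      fromℤ-+ : ∀ i j → fromℤ (i ℤ.+ j) ≡ fromℤ i + fromℤ j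
      fromℤ-+ (+ m)    (+ n)    = ×-homo-+ 1# m n
      fromℤ-+ (+ m)    -[1+ n ] = fromℤ-⊖ m (suc n)
      fromℤ-+ -[1+ m ] (+ n)    = trans (fromℤ-⊖ n (suc m)) (R.+-comm _ _)
      fromℤ-+ -[1+ m ] -[1+ n ] = sym (trans (-‿+-comm _ _)
        (cong -_ (trans (sym (×-homo-+ 1# (suc m) (suc n)))
          (cong (λ k → suc k ⋆ 1#) (ℕ.+-suc m n)))))

      fromℤ-* : ∀ i j → fromℤ (i ℤ.* j) ≡ fromℤ i * fromℤ j
      fromℤ-*⁺ : ∀ m j → fromℤ (+ m ℤ.* j) ≡ fromℤ (+ m) * fromℤ j
      fromℤ-*⁺ m (+ n)    = trans (cong fromℤ (sym (ℤ.pos-* m n))) (×1-homo-* m n)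
      fromℤ-*⁺ m -[1+ n ] = trans (cong fromℤ (sym (ℤ.neg-distribʳ-* (+ m) +[1+ n ])))
        (trans (fromℤ-neg (+ m ℤ.* +[1+ n ]))
          (trans (cong -_ (fromℤ-*⁺ m +[1+ n ])) (-‿distribʳ-* _ _)))
      fromℤ-* (+ m)    j = fromℤ-*⁺ m j
      fromℤ-* -[1+ m ] j = trans (cong fromℤ (sym (ℤ.neg-distribˡ-* +[1+ m ] j)))
        (trans (fromℤ-neg (+[1+ m ] ℤ.* j))
          (trans (cong -_ (fromℤ-*⁺ (suc m) j)) (-‿distribˡ-* _ _)))

      almostCommutativeRing : AlmostCommutativeRing _ _
      almostCommutativeRing = fromCommutativeRing R

      morphism : CommutativeRing.rawRing ℤ.+-*-commutativeRing -Raw-AlmostCommutative⟶ almostCommutativeRing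
      morphism = record
        { ⟦_⟧    = fromℤ
        ; +-homo = fromℤ-+
        ; *-homo = fromℤ-*
        ; -‿homo = fromℤ-neg
        ; 0-homo = refl
        ; 1-homo = refl
        }

      coeff≟ : ∀ i j → Maybe (fromℤ i ≡ fromℤ j)
      coeff≟ i j with i ℤ.≟ j
      ... | yes refl = just refl
      ... | no  _    = nothing

    open RingSolver _ almostCommutativeRing morphism coeff≟ public
      using (solve; _:+_; _:*_; :-_; _:=_; con)

open FiniteFields using (FiniteField)

-- Coordinate vectors and subspaces of K^n in reduced row echelon form.

module Subspaces {q : ℕ} (𝔽 : FiniteField q) where
  open import Data.Integer.Base using (0ℤ)
  open import Data.Nat.Base using (zero; suc)
  open import Data.Vec.Base using (Vec; []; _∷_; zipWith; map; replicate)
  open FiniteFields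
  open FiniteField 𝔽 public
  open IntegerRingSolver isCommutativeRing public
  open IsCommutativeRing isCommutativeRing public
    using (+-identityˡ; +-identityʳ; *-identityˡ; *-identityʳ; zeroˡ; zeroʳ; -‿inverseʳ; -‿inverseˡ; +-comm; *-comm; *-assoc)

  K : Set
  K = Fin q

  infixl 6 _+ᵛ_
  infixr 7 _*ᵛ_

  _+ᵛ_ : ∀ {n} → Vec K n → Vec K n → Vec K n
  _+ᵛ_ = zipWith _+_

  _*ᵛ_ : ∀ {n} → K → Vec K n → Vec K n
  c *ᵛ x = map (c *_) x

  0ᵛ : ∀ {n} → Vec K n
  0ᵛ = replicate _ 0#

  _≟ᵛ_ : ∀ {n} (x y : Vec K n) → Dec (x ≡ y)
  _≟ᵛ_ = Vec.≡-dec Fin._≟_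

  +ᵛ-identityˡ : ∀ {n} (x : Vec K n) → 0ᵛ +ᵛ x ≡ x
  +ᵛ-identityˡ = Vec.zipWith-identityˡ +-identityˡ

  +ᵛ-identityʳ : ∀ {n} (x : Vec K n) → x +ᵛ 0ᵛ ≡ x
  +ᵛ-identityʳ = Vec.zipWith-identityʳ +-identityʳ

  0*ᵛ : ∀ {n} (x : Vec K n) → 0# *ᵛ x ≡ 0ᵛ
  0*ᵛ []       = refl
  0*ᵛ (x ∷ xs) = cong₂ _∷_ (zeroˡ x) (0*ᵛ xs)

  1*ᵛ : ∀ {n} (x : Vec K n) → 1# *ᵛ x ≡ x
  1*ᵛ []       = refl
  1*ᵛ (x ∷ xs) = cong₂ _∷_ (*-identityˡ x) (1*ᵛ xs)

  *ᵛ0ᵛ : ∀ n c → c *ᵛ 0ᵛ {n} ≡ 0ᵛ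
  *ᵛ0ᵛ zero    c = refl
  *ᵛ0ᵛ (suc n) c = cong₂ _∷_ (zeroʳ c) (*ᵛ0ᵛ n c)

  *ᵛ-assoc : ∀ {n} a b (x : Vec K n) → a *ᵛ b *ᵛ x ≡ (a * b) *ᵛ x
  *ᵛ-assoc a b []       = refl
  *ᵛ-assoc a b (x ∷ xs) = cong₂ _∷_ (sym (*-assoc a b x)) (*ᵛ-assoc a b xs)

  +ᵛ-cancel : ∀ {n} c (x u : Vec K n) → x +ᵛ c *ᵛ u +ᵛ (- c) *ᵛ u ≡ x
  +ᵛ-cancel c []       []       = refl
  +ᵛ-cancel c (x ∷ xs) (u ∷ us) = cong₂ _∷_
    (solve 3 (λ c x u → x :+ c :* u :+ (:- c) :* u := x) refl c x u) (+ᵛ-cancel c xs us)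

  +ᵛ-cancel′ : ∀ {n} c (x u : Vec K n) → x +ᵛ (- c) *ᵛ u +ᵛ c *ᵛ u ≡ x
  +ᵛ-cancel′ c []       []       = refl
  +ᵛ-cancel′ c (x ∷ xs) (u ∷ us) = cong₂ _∷_
    (solve 3 (λ c x u → x :+ (:- c) :* u :+ c :* u := x) refl c x u) (+ᵛ-cancel′ c xs us)

  +ᵛ-interchange : ∀ {n} (a b c d : Vec K n) → (a +ᵛ b) +ᵛ (c +ᵛ d) ≡ (a +ᵛ c) +ᵛ (b +ᵛ d)
  +ᵛ-interchange [] [] [] [] = refl
  +ᵛ-interchange (a ∷ as) (b ∷ bs) (c ∷ cs) (d ∷ ds) = cong₂ _∷_
    (solve 4 (λ a b c d → (a :+ b) :+ (c :+ d) := (a :+ c) :+ (b :+ d)) refl a b c d)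
    (+ᵛ-interchange as bs cs ds)

  *ᵛ-distribʳ : ∀ {n} a b (x : Vec K n) → (a + b) *ᵛ x ≡ a *ᵛ x +ᵛ b *ᵛ x
  *ᵛ-distribʳ a b []       = refl
  *ᵛ-distribʳ a b (x ∷ xs) = cong₂ _∷_
    (solve 3 (λ a b x → (a :+ b) :* x := a :* x :+ b :* x) refl a b x) (*ᵛ-distribʳ a b xs)

  *ᵛ-distribˡ : ∀ {n} a (x y : Vec K n) → a *ᵛ (x +ᵛ y) ≡ a *ᵛ x +ᵛ a *ᵛ y
  *ᵛ-distribˡ a []       []       = refl
  *ᵛ-distribˡ a (x ∷ xs) (y ∷ ys) = cong₂ _∷_
    (solve 3 (λ a x y → a :* (x :+ y) := a :* x :+ a :* y) refl a x y) (*ᵛ-distribˡ a xs ys)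

  *ᵛ-comm : ∀ {n} a b (x : Vec K n) → a *ᵛ b *ᵛ x ≡ b *ᵛ a *ᵛ x
  *ᵛ-comm a b x = trans (*ᵛ-assoc a b x) (trans (cong (_*ᵛ x) (*-comm a b)) (sym (*ᵛ-assoc b a x)))

  -- Subspaces of K^n in reduced row echelon form: skip W = 0 × W, and lead W w
  -- is spanned by 0 × W and a vector 1 ∷ x with x ∈ w ∈ K^(n-1) / W.
  data Sub : ℕ → Set
  codim : ∀ {n} → Sub n → ℕ

  data Sub where
    nil  : Sub 0
    skip : ∀ {n} → Sub n → Sub (suc n)
    lead : ∀ {n} (W : Sub n) → Vec K (codim W) → Sub (suc n)

  codim nil        = 0
  codim (skip W)   = suc (codim W)
  codim (lead W _) = codim W

  dim : ∀ {n} → Sub n → ℕ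
  dim nil        = 0
  dim (skip W)   = dim W
  dim (lead W _) = suc (dim W)

  codim+dim : ∀ {n} (W : Sub n) → codim W ℕ.+ dim W ≡ n
  codim+dim nil        = refl
  codim+dim (skip W)   = cong suc (codim+dim W)
  codim+dim (lead W _) = trans (ℕ.+-suc (codim W) (dim W)) (cong suc (codim+dim W))

  record Linear {m n} (f : Vec K m → Vec K n) : Set where
    field
      +-homo : ∀ x y → f (x +ᵛ y) ≡ f x +ᵛ f y
      *-homo : ∀ c x → f (c *ᵛ x) ≡ c *ᵛ f x

    0-homo : f 0ᵛ ≡ 0ᵛ
    0-homo = trans (cong f (sym (0*ᵛ 0ᵛ))) (trans (*-homo 0# 0ᵛ) (0*ᵛ (f 0ᵛ)))

    +*-homo : ∀ x c y → f (x +ᵛ c *ᵛ y) ≡ f x +ᵛ c *ᵛ f y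
    +*-homo x c y = trans (+-homo x (c *ᵛ y)) (cong (f x +ᵛ_) (*-homo c y))

  open Linear

  -- quo W : K^n → K^n / W in coordinates, with section sec W; par W parametrises W,
  -- and free W reads the parameters off.
  quo : ∀ {n} (W : Sub n) → Vec K n → Vec K (codim W)
  quo nil        []       = []
  quo (skip W)   (x ∷ xs) = x ∷ quo W xs
  quo (lead W w) (x ∷ xs) = quo W xs +ᵛ (- x) *ᵛ w

  sec : ∀ {n} (W : Sub n) → Vec K (codim W) → Vec K n
  sec nil        []       = []
  sec (skip W)   (y ∷ ys) = y ∷ sec W ys
  sec (lead W w) ys       = 0# ∷ sec W ys

  par : ∀ {n} (W : Sub n) → Vec K (dim W) → Vec K n
  par nil        []       = []
  par (skip W)   as       = 0# ∷ par W as
  par (lead W w) (a ∷ as) = a ∷ (par W as +ᵛ sec W (a *ᵛ w))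

  free : ∀ {n} (W : Sub n) → Vec K n → Vec K (dim W)
  free nil        []       = []
  free (skip W)   (x ∷ xs) = free W xs
  free (lead W w) (x ∷ xs) = x ∷ free W xs

  -- For `quo (lead W w)`, which subtracts x w from the residue of the tail; `adjoin` uses it again.
  shear-+ : ∀ {n} (a b w : Vec K n) x y →
    (a +ᵛ b) +ᵛ (- (x + y)) *ᵛ w ≡ (a +ᵛ (- x) *ᵛ w) +ᵛ (b +ᵛ (- y) *ᵛ w)
  shear-+ [] [] [] x y = refl
  shear-+ (a ∷ as) (b ∷ bs) (w ∷ ws) x y = cong₂ _∷_
    (solve 5 (λ a b w x y → (a :+ b) :+ (:- (x :+ y)) :* w
                         := (a :+ (:- x) :* w) :+ (b :+ (:- y) :* w)) refl a b w x y)
    (shear-+ as bs ws x y)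

  shear-* : ∀ {n} c (a w : Vec K n) x →
    c *ᵛ a +ᵛ (- (c * x)) *ᵛ w ≡ c *ᵛ (a +ᵛ (- x) *ᵛ w)
  shear-* c [] [] x = refl
  shear-* c (a ∷ as) (w ∷ ws) x = cong₂ _∷_
    (solve 4 (λ c a w x → c :* a :+ (:- (c :* x)) :* w := c :* (a :+ (:- x) :* w)) refl c a w x)
    (shear-* c as ws x)

  private
    cancel-section : ∀ {n} (y w : Vec K n) → y +ᵛ (- 0#) *ᵛ w ≡ y
    cancel-section [] [] = refl
    cancel-section (y ∷ ys) (w ∷ ws) = cong₂ _∷_
      (solve 2 (λ y w → y :+ (:- con 0ℤ) :* w := y) refl y w) (cancel-section ys ws)

  quo-linear : ∀ {n} (W : Sub n) → Linear (quo W)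
  quo-linear nil .+-homo [] [] = refl
  quo-linear nil .*-homo c [] = refl
  quo-linear (skip W) .+-homo (x ∷ xs) (y ∷ ys) = cong (_ ∷_) (quo-linear W .+-homo xs ys)
  quo-linear (skip W) .*-homo c (x ∷ xs) = cong (_ ∷_) (quo-linear W .*-homo c xs)
  quo-linear (lead W w) .+-homo (x ∷ xs) (y ∷ ys) = trans
    (cong (_+ᵛ (- (x + y)) *ᵛ w) (quo-linear W .+-homo xs ys))
    (shear-+ (quo W xs) (quo W ys) w x y)
  quo-linear (lead W w) .*-homo c (x ∷ xs) = trans
    (cong (_+ᵛ (- (c * x)) *ᵛ w) (quo-linear W .*-homo c xs))
    (shear-* c (quo W xs) w x)

  sec-linear : ∀ {n} (W : Sub n) → Linear (sec W)
  sec-linear nil .+-homo [] [] = refl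
  sec-linear nil .*-homo c [] = refl
  sec-linear (skip W) .+-homo (x ∷ xs) (y ∷ ys) = cong (_ ∷_) (sec-linear W .+-homo xs ys)
  sec-linear (skip W) .*-homo c (x ∷ xs) = cong (_ ∷_) (sec-linear W .*-homo c xs)
  sec-linear (lead W w) .+-homo x y = cong₂ _∷_ (sym (+-identityˡ 0#)) (sec-linear W .+-homo x y)
  sec-linear (lead W w) .*-homo c x = cong₂ _∷_ (sym (zeroʳ c)) (sec-linear W .*-homo c x)

  free-linear : ∀ {n} (W : Sub n) → Linear (free W)
  free-linear nil .+-homo [] [] = refl
  free-linear nil .*-homo c [] = refl
  free-linear (skip W) .+-homo (x ∷ xs) (y ∷ ys) = free-linear W .+-homo xs ys
  free-linear (skip W) .*-homo c (x ∷ xs) = free-linear W .*-homo c xs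
  free-linear (lead W w) .+-homo (x ∷ xs) (y ∷ ys) = cong (_ ∷_) (free-linear W .+-homo xs ys)
  free-linear (lead W w) .*-homo c (x ∷ xs) = cong (_ ∷_) (free-linear W .*-homo c xs)

  par-linear : ∀ {n} (W : Sub n) → Linear (par W)
  par-linear nil .+-homo [] [] = refl
  par-linear nil .*-homo c [] = refl
  par-linear (skip W) .+-homo x y = cong₂ _∷_ (sym (+-identityˡ 0#)) (par-linear W .+-homo x y)
  par-linear (skip W) .*-homo c x = cong₂ _∷_ (sym (zeroʳ c)) (par-linear W .*-homo c x)
  par-linear (lead W w) .+-homo (a ∷ as) (b ∷ bs) = cong (_ ∷_) (trans
    (cong₂ _+ᵛ_ (par-linear W .+-homo as bs)
      (trans (cong (sec W) (*ᵛ-distribʳ a b w)) (sec-linear W .+-homo _ _)))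
    (+ᵛ-interchange _ _ _ _))
  par-linear (lead W w) .*-homo c (a ∷ as) = cong (_ ∷_) (trans
    (cong₂ _+ᵛ_ (par-linear W .*-homo c as)
      (trans (cong (sec W) (sym (*ᵛ-assoc c a w))) (sec-linear W .*-homo c _)))
    (sym (*ᵛ-distribˡ c _ _)))

  quo-sec : ∀ {n} (W : Sub n) y → quo W (sec W y) ≡ y
  quo-sec nil        []       = refl
  quo-sec (skip W)   (y ∷ ys) = cong (y ∷_) (quo-sec W ys)
  quo-sec (lead W w) ys       = trans (cong (_+ᵛ (- 0#) *ᵛ w) (quo-sec W ys)) (cancel-section ys w)

  -- `sec` picks the representative that vanishes at the pivot coordinates, and `free` reads exactly
  -- those.
  free-sec : ∀ {n} (W : Sub n) y → free W (sec W y) ≡ 0ᵛ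
  free-sec nil        []       = refl
  free-sec (skip W)   (y ∷ ys) = free-sec W ys
  free-sec (lead W w) ys       = cong (0# ∷_) (free-sec W ys)

  quo-par : ∀ {n} (W : Sub n) a → quo W (par W a) ≡ 0ᵛ
  quo-par nil        []       = refl
  quo-par (skip W)   as       = cong (0# ∷_) (quo-par W as)
  quo-par (lead W w) (a ∷ as) = trans
    (cong (_+ᵛ (- a) *ᵛ w) (trans (quo-linear W .+-homo _ _)
      (cong₂ _+ᵛ_ (quo-par W as) (quo-sec W (a *ᵛ w)))))
    (+ᵛ-cancel a 0ᵛ w)

  free-par : ∀ {n} (W : Sub n) a → free W (par W a) ≡ a
  free-par nil        []       = refl
  free-par (skip W)   as       = free-par W as
  free-par (lead W w) (a ∷ as) = cong (a ∷_) (trans (free-linear W .+-homo _ _)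
    (trans (cong₂ _+ᵛ_ (free-par W as) (free-sec W (a *ᵛ w))) (+ᵛ-identityʳ as)))

  -- K^n is the direct sum of W and the vectors that vanish at the pivots. In the `lead` case the
  -- multiple of w that `quo` subtracts is the one that `par` puts back.
  sec+par : ∀ {n} (W : Sub n) x → sec W (quo W x) +ᵛ par W (free W x) ≡ x
  sec+par nil        []       = refl
  sec+par (skip W)   (x ∷ xs) = cong₂ _∷_ (+-identityʳ x) (sec+par W xs)
  sec+par (lead W w) (x ∷ xs) = cong₂ _∷_ (+-identityˡ x) (begin
    sec W (quo W xs +ᵛ (- x) *ᵛ w) +ᵛ (par W (free W xs) +ᵛ sec W (x *ᵛ w))
      ≡⟨ cong (_+ᵛ (p +ᵛ sec W (x *ᵛ w))) (+*-homo (sec-linear W) _ _ _) ⟩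
    (sec W (quo W xs) +ᵛ (- x) *ᵛ sec W w) +ᵛ (p +ᵛ sec W (x *ᵛ w))
      ≡⟨ +ᵛ-interchange _ _ _ _ ⟩
    (sec W (quo W xs) +ᵛ p) +ᵛ ((- x) *ᵛ sec W w +ᵛ sec W (x *ᵛ w))
      ≡⟨ cong₂ _+ᵛ_ (sec+par W xs) (cong ((- x) *ᵛ sec W w +ᵛ_) (sec-linear W .*-homo x w)) ⟩
    xs +ᵛ ((- x) *ᵛ sec W w +ᵛ x *ᵛ sec W w)
      ≡⟨ cong (λ z → xs +ᵛ (z +ᵛ x *ᵛ sec W w)) (sym (+ᵛ-identityˡ _)) ⟩
    xs +ᵛ (0ᵛ +ᵛ (- x) *ᵛ sec W w +ᵛ x *ᵛ sec W w)
      ≡⟨ cong (xs +ᵛ_) (+ᵛ-cancel′ x 0ᵛ (sec W w)) ⟩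
    xs +ᵛ 0ᵛ
      ≡⟨ +ᵛ-identityʳ xs ⟩
    xs ∎)
    where
    open ≡-Reasoning
    p = par W (free W xs)

  infix 4 _∈_ _∉_ _∈?_

  -- A vanishing residue is decidable by comparison of vectors, and the closure properties follow
  -- from the linearity of `quo W`.
  _∈_ _∉_ : ∀ {n} → Vec K n → Sub n → Set
  x ∈ W = quo W x ≡ 0ᵛ
  x ∉ W = ¬ x ∈ W

  _∈?_ : ∀ {n} (x : Vec K n) W → Dec (x ∈ W)
  x ∈? W = quo W x ≟ᵛ 0ᵛ

  par∈ : ∀ {n} (W : Sub n) a → par W a ∈ W
  par∈ = quo-par

  ∈⇒par : ∀ {n} {W : Sub n} {x} → x ∈ W → par W (free W x) ≡ x
  ∈⇒par {W = W} {x} x∈W = trans (sym (+ᵛ-identityˡ _)) (trans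
    (cong (_+ᵛ par W (free W x)) (sym (trans (cong (sec W) x∈W) (0-homo (sec-linear W)))))
    (sec+par W x))

  0∈ : ∀ {n} (W : Sub n) → 0ᵛ ∈ W
  0∈ W = 0-homo (quo-linear W)

  +∈ : ∀ {n} {W : Sub n} {x y} → x ∈ W → y ∈ W → x +ᵛ y ∈ W
  +∈ {W = W} {x} {y} p r = trans (quo-linear W .+-homo x y) (trans (cong₂ _+ᵛ_ p r) (+ᵛ-identityˡ 0ᵛ))

  *∈ : ∀ {n} {W : Sub n} c {x} → x ∈ W → c *ᵛ x ∈ W
  *∈ {W = W} c {x} p = trans (quo-linear W .*-homo c x) (trans (cong (c *ᵛ_) p) (*ᵛ0ᵛ _ c))

  +*∈ : ∀ {n} {W : Sub n} {x} c {y} → x ∈ W → y ∈ W → x +ᵛ c *ᵛ y ∈ W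
  +*∈ {W = W} c {y} p r = +∈ {W = W} p (*∈ {W = W} c {y} r)

  par-injective : ∀ {n} (W : Sub n) {a b} → par W a ≡ par W b → a ≡ b
  par-injective W {a} {b} eq = trans (sym (free-par W a)) (trans (cong (free W) eq) (free-par W b))

-- Dimension by counting, and canonical forms of decidable subspaces.

module Dimension {q : ℕ} (𝔽 : FiniteField q) where
  open import Data.Integer.Base using (0ℤ; 1ℤ)
  open import Data.Nat.Base using (zero; suc; _^_; _≤_; _<_; s≤s; z≤n)
  open import Data.Vec.Base using (Vec; []; _∷_)
  open Subspaces 𝔽
  open Linear

  -- If 1 = 0, then every element is 0, and the indices 0 and 1, both below q, would coincide.
  1≢0 : 1# ≢ 0#
  1≢0 1≡0 = contradiction (Fin.fromℕ<-injective 0 1 (ℕ.<-trans (s≤s z≤n) 1<q) 1<q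
    (trans (all-zero _) (sym (all-zero _)))) λ ()
    where
    all-zero : ∀ x → x ≡ 0#
    all-zero x = trans (sym (*-identityˡ x)) (trans (cong (_* x) 1≡0) (zeroˡ x))

  -1*ᵛ-cancel : ∀ {n} {x y : Vec K n} → x +ᵛ (- 1#) *ᵛ y ≡ 0ᵛ → x ≡ y
  -1*ᵛ-cancel {x = x} {y} eq = trans (sym (+ᵛ-cancel′ 1# x y))
    (trans (cong (_+ᵛ 1# *ᵛ y) eq) (trans (+ᵛ-identityˡ _) (1*ᵛ y)))

  abstract
    unscale : ∀ {n} {c} → c ≢ 0# → (x : Vec K n) → ∃ λ d → d *ᵛ c *ᵛ x ≡ x
    unscale {c = c} c≢0 x with inverse c c≢0
    ... | d , dc≡1 = d , trans (*ᵛ-assoc d c x) (trans (cong (_*ᵛ x) dc≡1) (1*ᵛ x))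

    unscale∈ : ∀ {n} (W : Sub n) {c} → c ≢ 0# → ∀ x → c *ᵛ x ∈ W → x ∈ W
    unscale∈ W c≢0 x cx∈W with unscale c≢0 x
    ... | d , eq = subst (_∈ W) eq (*∈ {W = W} d cx∈W)

  encode : ∀ {n} → Vec K n → Fin (q ^ n)
  encode []       = Fin.zero
  encode (x ∷ xs) = combine x (encode xs)

  decode : ∀ n → Fin (q ^ n) → Vec K n
  decode zero    _ = []
  decode (suc n) i = proj₁ (remQuot (q ^ n) i) ∷ decode n (proj₂ (remQuot {q} (q ^ n) i))

  encode-decode : ∀ n i → encode (decode n i) ≡ i
  encode-decode zero    Fin.zero = refl
  encode-decode (suc n) i = trans
    (cong (combine (proj₁ (remQuot {q} (q ^ n) i))) (encode-decode n (proj₂ (remQuot {q} (q ^ n) i))))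
    (Fin.combine-remQuot {q} (q ^ n) i)

  encode-injective : ∀ {n} {x y : Vec K n} → encode x ≡ encode y → x ≡ y
  encode-injective {x = []}     {[]}     _ = refl
  encode-injective {x = x ∷ xs} {y ∷ ys} eq with Fin.combine-injective x _ y _ eq
  ... | refl , eq′ = cong (x ∷_) (encode-injective eq′)

  abstract
    -- Pigeonhole: K^m has q^m elements, and 1 < q. The comparisons of dimension below rest on this.
    -- The injection may be any function, so it can involve choices found by search.
    injective⇒≤ : ∀ {m n} (f : Vec K m → Vec K n) → (∀ {x y} → f x ≡ f y → x ≡ y) → m ≤ n
    injective⇒≤ {m} {n} f f-injective = ℕ.≮⇒≥ λ n<m → ℕ.<⇒≱ (ℕ.^-monoʳ-< q 1<q n<m)
      (Fin.injective⇒≤ {f = encode ∘ f ∘ decode m} λ {i} {j} eq →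
        trans (sym (encode-decode m i))
          (trans (cong encode (f-injective (encode-injective eq))) (encode-decode m j)))

    search : ∀ {ℓ} n {P : Vec K n → Set ℓ} → Decidable P → Dec (∃ P)
    search zero    P? = map′ ([] ,_) (λ { ([] , p) → p }) (P? [])
    search (suc n) P? = map′ (λ { (x , xs , p) → x ∷ xs , p }) (λ { (x ∷ xs , p) → x , xs , p })
      (Fin.any? λ x → search n (P? ∘ (x ∷_)))

  infix 4 _⊆_
  _⊆_ : ∀ {n} → Sub n → Sub n → Set
  A ⊆ B = ∀ x → x ∈ A → x ∈ B

  record IsSubspace {n} (P : Vec K n → Set) : Set where
    field
      dec      : Decidable P
      0-closed : P 0ᵛ
      +-closed : ∀ {x y} → P x → P y → P (x +ᵛ y)
      *-closed : ∀ c {x} → P x → P (c *ᵛ x)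

  record Code {n} (P : Vec K n → Set) : Set where
    field
      sub  : Sub n
      sound    : ∀ x → x ∈ sub → P x
      complete : ∀ x → P x → x ∈ sub
  open Code

  0∷∈lead : ∀ {n} (W : Sub n) w x → (0# ∷ x) ∈ lead W w → x ∈ W
  0∷∈lead W w x = trans (sym (trans (cong (λ z → quo W x +ᵛ z *ᵛ w)
    (solve 0 (:- con 0ℤ := con 0ℤ) refl)) (trans (cong (quo W x +ᵛ_) (0*ᵛ w)) (+ᵛ-identityʳ _))))

  ∈⇒0∷∈lead : ∀ {n} (W : Sub n) w x → x ∈ W → (0# ∷ x) ∈ lead W w
  ∈⇒0∷∈lead W w x = trans (trans (cong (λ z → quo W x +ᵛ z *ᵛ w)
    (solve 0 (:- con 0ℤ := con 0ℤ) refl)) (trans (cong (quo W x +ᵛ_) (0*ᵛ w)) (+ᵛ-identityʳ _)))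

  private
    1∷sec∈lead : ∀ {n} (W : Sub n) w → (1# ∷ sec W w) ∈ lead W w
    1∷sec∈lead W w = trans (cong (_+ᵛ (- 1#) *ᵛ w) (trans (quo-sec W w)
      (trans (sym (1*ᵛ w)) (sym (+ᵛ-identityˡ _))))) (+ᵛ-cancel 1# 0ᵛ w)

  -- Row reduction by search. The vectors 0 ∷ xs of P give the tail by recursion. If some 1 ∷ v is
  -- in P, it becomes the leading row, and x ∷ xs is reduced to 0 ∷ (xs - x v). If none is, every
  -- head is 0, since a nonzero head could be scaled to 1.
  canon : ∀ {n} {P : Vec K n → Set} → IsSubspace P → Code P
  canon {zero} isSub = record
    { sub      = nil
    ; sound    = λ { [] _ → IsSubspace.0-closed isSub }
    ; complete = λ { [] _ → refl }
    }
  canon {suc n} {P} isSub with search n (λ xs → IsSubspace.dec isSub (1# ∷ xs))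
    | canon {n} {λ xs → P (0# ∷ xs)} (record
      { dec      = λ xs → dec (0# ∷ xs)
      ; 0-closed = 0-closed
      ; +-closed = λ {xs} {ys} p r → subst (λ z → P (z ∷ (xs +ᵛ ys))) (+-identityˡ 0#) (+-closed p r)
      ; *-closed = λ c {xs} p → subst (λ z → P (z ∷ (c *ᵛ xs))) (zeroʳ c) (*-closed c p)
      })
    where open IsSubspace isSub
  ... | yes (v , p1v) | W = record
    { sub      = lead (sub W) (quo (sub W) v)
    ; sound    = λ { (x ∷ xs) h → subst P
        (cong₂ _∷_ (solve 1 (λ x → con 0ℤ :+ x :* con 1ℤ := x) refl x) (+ᵛ-cancel′ x xs v))
        (+-closed (sound W (xs +ᵛ (- x) *ᵛ v) (trans (+*-homo (quo-linear (sub W)) xs (- x) v) h))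
                  (*-closed x p1v)) }
    ; complete = λ { (x ∷ xs) h → trans (sym (+*-homo (quo-linear (sub W)) xs (- x) v))
        (complete W (xs +ᵛ (- x) *ᵛ v) (subst (λ z → P (z ∷ (xs +ᵛ (- x) *ᵛ v)))
          (solve 1 (λ x → x :+ (:- x) :* con 1ℤ := con 0ℤ) refl x)
          (+-closed h (*-closed (- x) p1v)))) }
    }
    where open IsSubspace isSub
  ... | no ¬p | W = record
    { sub      = skip (sub W)
    ; sound    = λ { (x ∷ xs) h → subst (λ z → P (z ∷ xs)) (sym (Vec.∷-injectiveˡ h))
        (sound W xs (Vec.∷-injectiveʳ h)) }
    ; complete = λ { (x ∷ xs) h → complete-skip x xs h }
    }
    where
    open IsSubspace isSub
    complete-skip : ∀ x xs → P (x ∷ xs) → (x ∷ xs) ∈ skip (sub W)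
    complete-skip x xs h with x Fin.≟ 0#
    ... | yes refl = cong (0# ∷_) (complete W xs h)
    ... | no  x≢0  with inverse x x≢0
    ... | y , yx≡1 = contradiction (y *ᵛ xs , subst (λ z → P (z ∷ (y *ᵛ xs))) yx≡1 (*-closed y h)) ¬p

  abstract
    -- Uniqueness of the reduced echelon form. A leading row has head 1, which no vector of a `skip`
    -- has; over equal tails, v and w are the residues of the two leading rows and must agree. Hence
    -- equality of subspaces is equality of terms, and families can be Boolean functions on `Sub n`.
    ⊆-antisym : ∀ {n} {A B : Sub n} → A ⊆ B → B ⊆ A → A ≡ B
    ⊆-antisym {A = nil} {nil} _ _ = refl
    ⊆-antisym {A = skip A} {skip B} p r = cong skip (⊆-antisym
      (λ x x∈ → Vec.∷-injectiveʳ (p (0# ∷ x) (cong (0# ∷_) x∈)))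
      (λ x x∈ → Vec.∷-injectiveʳ (r (0# ∷ x) (cong (0# ∷_) x∈))))
    ⊆-antisym {A = skip A} {lead B w} p r =
      contradiction (Vec.∷-injectiveˡ (r (1# ∷ sec B w) (1∷sec∈lead B w))) 1≢0
    ⊆-antisym {A = lead A w} {skip B} p r =
      contradiction (Vec.∷-injectiveˡ (p (1# ∷ sec A w) (1∷sec∈lead A w))) 1≢0
    ⊆-antisym {A = lead A v} {lead B w} p r with ⊆-antisym {A = A} {B}
      (λ x x∈ → 0∷∈lead B w x (p (0# ∷ x) (∈⇒0∷∈lead A v x x∈)))
      (λ x x∈ → 0∷∈lead A v x (r (0# ∷ x) (∈⇒0∷∈lead B w x x∈)))
    ... | refl = cong (lead A) (-1*ᵛ-cancel (trans (cong (_+ᵛ (- 1#) *ᵛ w) (sym (quo-sec A v)))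
      (p (1# ∷ sec A v) (1∷sec∈lead A v))))

  _≟ₛ_ : ∀ {n} (A B : Sub n) → Dec (A ≡ B)
  nil      ≟ₛ nil      = yes refl
  skip A   ≟ₛ skip B   = map′ (cong skip) (λ { refl → refl }) (A ≟ₛ B)
  skip A   ≟ₛ lead B w = no λ ()
  lead A v ≟ₛ skip B   = no λ ()
  lead A v ≟ₛ lead B w with A ≟ₛ B
  ... | no  A≢B  = no λ { refl → A≢B refl }
  ... | yes refl = map′ (cong (lead A)) (λ { refl → refl }) (v ≟ᵛ w)

  dim≤ : ∀ {n m} (W : Sub n) (f : ∀ x → x ∈ W → Vec K m) →
         (∀ {x y} p r → f x p ≡ f y r → x ≡ y) → dim W ≤ m
  dim≤ W f f-injective = injective⇒≤ (λ a → f (par W a) (par∈ W a))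
    λ eq → par-injective W (f-injective _ _ eq)

  ≤dim : ∀ {n m} (W : Sub n) (f : Vec K m → Vec K n) → (∀ a → f a ∈ W) →
         (∀ {a b} → f a ≡ f b → a ≡ b) → m ≤ dim W
  ≤dim W f f∈W f-injective = injective⇒≤ (free W ∘ f) λ {a} {b} eq → f-injective
    (trans (sym (∈⇒par {W = W} (f∈W a))) (trans (cong (par W) eq) (∈⇒par {W = W} (f∈W b))))

  injection⇒dim≤ : ∀ {m n} (A : Sub m) (B : Sub n) (f : Vec K m → Vec K n) →
    (∀ x → x ∈ A → f x ∈ B) → (∀ {x y} → x ∈ A → y ∈ A → f x ≡ f y → x ≡ y) → dim A ≤ dim B
  injection⇒dim≤ A B f f∈B f-injective = ≤dim B (f ∘ par A) (λ a → f∈B _ (par∈ A a))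
    λ eq → par-injective A (f-injective (par∈ A _) (par∈ A _) eq)

  ⊆⇒dim≤ : ∀ {n} {A B : Sub n} → A ⊆ B → dim A ≤ dim B
  ⊆⇒dim≤ {A = A} {B} A⊆B = injection⇒dim≤ A B (λ x → x) A⊆B (λ _ _ eq → eq)

  -- Modulo A both sides become multiples of x, so (c - d) x ∈ A, which forces c = d because x ∉ A.
  par+multiple-injective : ∀ {n} (A : Sub n) {x} → x ∉ A → ∀ {a b c d} →
    par A a +ᵛ c *ᵛ x ≡ par A b +ᵛ d *ᵛ x → c ≡ d × a ≡ b
  par+multiple-injective A {x} x∉A {a} {b} {c} {d} eq = c≡d , par-injective A (begin
    par A a                            ≡⟨ +ᵛ-cancel c (par A a) x ⟨
    par A a +ᵛ c *ᵛ x +ᵛ (- c) *ᵛ x    ≡⟨ cong₂ (λ y z → y +ᵛ (- z) *ᵛ x) eq c≡d ⟩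
    par A b +ᵛ d *ᵛ x +ᵛ (- d) *ᵛ x    ≡⟨ +ᵛ-cancel d (par A b) x ⟩
    par A b                            ∎)
    where
    open ≡-Reasoning
    quo-eq : ∀ a c → quo A (par A a +ᵛ c *ᵛ x) ≡ c *ᵛ quo A x
    quo-eq a c = trans (+*-homo (quo-linear A) _ c x)
      (trans (cong (_+ᵛ c *ᵛ quo A x) (quo-par A a)) (+ᵛ-identityˡ _))
    [c-d]x∈A : (c + - d) *ᵛ x ∈ A
    [c-d]x∈A = begin
      quo A ((c + - d) *ᵛ x)                   ≡⟨ quo-linear A .*-homo _ x ⟩
      (c + - d) *ᵛ quo A x                     ≡⟨ *ᵛ-distribʳ c (- d) _ ⟩
      c *ᵛ quo A x +ᵛ (- d) *ᵛ quo A x         ≡⟨ cong (_+ᵛ (- d) *ᵛ quo A x)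
        (trans (sym (quo-eq a c)) (trans (cong (quo A) eq) (quo-eq b d))) ⟩
      d *ᵛ quo A x +ᵛ (- d) *ᵛ quo A x         ≡⟨ cong (_+ᵛ (- d) *ᵛ quo A x) (sym (+ᵛ-identityˡ _)) ⟩
      0ᵛ +ᵛ d *ᵛ quo A x +ᵛ (- d) *ᵛ quo A x   ≡⟨ +ᵛ-cancel d 0ᵛ (quo A x) ⟩
      0ᵛ                                       ∎
    c≡d : c ≡ d
    c≡d with (c + - d) Fin.≟ 0#
    ... | no  ≢0 = contradiction (unscale∈ A ≢0 x [c-d]x∈A) x∉A
    ... | yes ≡0 = trans (solve 2 (λ c d → c := c :+ :- d :+ d) refl c d)
                     (trans (cong (_+ d) ≡0) (+-identityˡ d))

  abstract
    -- The sums of a vector of A and a multiple of x lie in B and have one free parameter more than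
    -- A.
    ⊂⇒dim< : ∀ {n} {A B : Sub n} {x} → A ⊆ B → x ∈ B → x ∉ A → dim A < dim B
    ⊂⇒dim< {A = A} {B} {x} A⊆B x∈B x∉A = ≤dim B (λ { (c ∷ a) → par A a +ᵛ c *ᵛ x })
      (λ { (c ∷ a) → +*∈ {W = B} c (A⊆B _ (par∈ A a)) x∈B })
      (λ { {c ∷ a} {d ∷ b} eq → let c≡d , a≡b = par+multiple-injective A x∉A eq in cong₂ _∷_ c≡d a≡b })

  ⊆∧dim≤⇒⊇ : ∀ {n} {A B : Sub n} → A ⊆ B → dim B ≤ dim A → B ⊆ A
  ⊆∧dim≤⇒⊇ {A = A} {B} A⊆B B≤A x x∈B with x ∈? A
  ... | yes x∈A = x∈A
  ... | no  x∉A = contradiction (⊂⇒dim< {A = A} {B} A⊆B x∈B x∉A) (ℕ.≤⇒≯ B≤A)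

-- Intersections, sums, linear functionals and their kernels.

module Constructions {q : ℕ} (𝔽 : FiniteField q) where
  open import Data.Integer.Base using (0ℤ; 1ℤ)
  open import Data.Nat.Base using (zero; suc; _≤_; _<_; s≤s; z≤n)
  open import Data.Vec.Base using (Vec; []; _∷_; lookup; _++_; take; drop)
  open Subspaces 𝔽
  open Dimension 𝔽
  open Linear
  open IsSubspace

  abstract
    ⊆-or-witness : ∀ {n} (A B : Sub n) → A ⊆ B ⊎ ∃ λ x → x ∈ A × x ∉ B
    ⊆-or-witness {n} A B with search n (λ x → (x ∈? A) ×-dec ¬? (x ∈? B))
    ... | yes found = inj₂ found
    ... | no  none  = inj₁ λ x x∈A → decidable-stable (x ∈? B) λ x∉B → none (x , x∈A , x∉B)

  negate : ∀ {n} {x : Vec K n} → x +ᵛ (- 1#) *ᵛ x ≡ 0ᵛ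
  negate {x = []}     = refl
  negate {x = x ∷ xs} = cong₂ _∷_ (solve 1 (λ x → x :+ (:- con 1ℤ) :* x := con 0ℤ) refl x) negate

  abstract
    +-cancel∈ : ∀ {n} (W : Sub n) c {x y} → x ∈ W → y +ᵛ c *ᵛ x ∈ W → y ∈ W
    +-cancel∈ W c {x} {y} x∈W h = subst (_∈ W) (+ᵛ-cancel c y x) (+*∈ {W = W} (- c) h x∈W)

    cancel+∈ : ∀ {n} (W : Sub n) {c} → c ≢ 0# → ∀ {x y} → y ∈ W → y +ᵛ c *ᵛ x ∈ W → x ∈ W
    cancel+∈ W {c} c≢0 {x} {y} y∈W h = unscale∈ W c≢0 x (trans (sym (+ᵛ-identityˡ _))
      (trans (cong (_+ᵛ quo W (c *ᵛ x)) (sym y∈W)) (trans (sym (quo-linear W .+-homo y _)) h)))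

    _∩_ : ∀ {n} → Sub n → Sub n → Sub n
    ∩-code : ∀ {n} (A B : Sub n) → Code λ x → x ∈ A × x ∈ B
    ∩-code A B = canon record
      { dec      = λ x → (x ∈? A) ×-dec (x ∈? B)
      ; 0-closed = 0∈ A , 0∈ B
      ; +-closed = λ { (p , p′) (r , r′) → +∈ {W = A} p r , +∈ {W = B} p′ r′ }
      ; *-closed = λ { c (p , p′) → *∈ {W = A} c p , *∈ {W = B} c p′ }
      }
    A ∩ B = Code.sub (∩-code A B)

    ∈∩⁻ : ∀ {n} (A B : Sub n) {x} → x ∈ A ∩ B → x ∈ A × x ∈ B
    ∈∩⁻ A B {x} = Code.sound (∩-code A B) x

    ∈∩⁺ : ∀ {n} (A B : Sub n) {x} → x ∈ A → x ∈ B → x ∈ A ∩ B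
    ∈∩⁺ A B {x} p r = Code.complete (∩-code A B) x (p , r)

    _⊕_ : ∀ {n} → Sub n → Sub n → Sub n
    ⊕-code : ∀ {n} (A B : Sub n) → Code λ z → ∃ λ a → a ∈ A × z +ᵛ (- 1#) *ᵛ a ∈ B
    ⊕-code {n} A B = canon record
      { dec      = λ z → search n λ a → (a ∈? A) ×-dec (_ ∈? B)
      ; 0-closed = 0ᵛ , 0∈ A , subst (_∈ B) (sym (trans (+ᵛ-identityˡ _) (*ᵛ0ᵛ n _))) (0∈ B)
      ; +-closed = λ { {x} {y} (a , p , p′) (b , r , r′) → a +ᵛ b , +∈ {W = A} p r ,
          subst (_∈ B) (trans (+ᵛ-interchange x _ y _)
            (cong (x +ᵛ y +ᵛ_) (sym (*ᵛ-distribˡ (- 1#) a b)))) (+∈ {W = B} p′ r′) }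
      ; *-closed = λ { c {x} (a , p , p′) → c *ᵛ a , *∈ {W = A} c p ,
          subst (_∈ B) (trans (*ᵛ-distribˡ c x _) (cong (c *ᵛ x +ᵛ_) (*ᵛ-comm c (- 1#) a)))
            (*∈ {W = B} c p′) }
      }
    A ⊕ B = Code.sub (⊕-code A B)

    ∈⊕⁻ : ∀ {n} (A B : Sub n) {z} → z ∈ A ⊕ B → ∃ λ a → a ∈ A × z +ᵛ (- 1#) *ᵛ a ∈ B
    ∈⊕⁻ A B {z} = Code.sound (⊕-code A B) z

    ⊆⊕ˡ : ∀ {n} (A B : Sub n) → A ⊆ A ⊕ B
    ⊆⊕ˡ A B z z∈A = Code.complete (⊕-code A B) z (z , z∈A , subst (_∈ B) (sym negate) (0∈ B))

    ⊆⊕ʳ : ∀ {n} (A B : Sub n) → B ⊆ A ⊕ B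
    ⊆⊕ʳ A B z z∈B = Code.complete (⊕-code A B) z
      (0ᵛ , 0∈ A , subst (_∈ B) (sym (trans (cong (z +ᵛ_) (*ᵛ0ᵛ _ _)) (+ᵛ-identityʳ z))) z∈B)

    adjoin : ∀ {n} → Sub n → Vec K n → Sub n
    adjoin-code : ∀ {n} (W : Sub n) u → Code λ z → ∃ λ c → z +ᵛ (- c) *ᵛ u ∈ W
    adjoin-code W u = canon record
      { dec      = λ z → Fin.any? λ c → _ ∈? W
      ; 0-closed = 0# , subst (_∈ W) (trans (sym (+ᵛ-cancel 0# 0ᵛ u))
          (cong (_+ᵛ (- 0#) *ᵛ u) (trans (+ᵛ-identityˡ _) (0*ᵛ u)))) (0∈ W)
      ; +-closed = λ { (c , p) (d , r) → c + d , subst (_∈ W) (sym (shear-+ _ _ u c d)) (+∈ {W = W} p r) }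
      ; *-closed = λ { a (c , p) → a * c , subst (_∈ W) (sym (shear-* a _ u c)) (*∈ {W = W} a p) }
      }
    adjoin W u = Code.sub (adjoin-code W u)

    ∈adjoin⁻ : ∀ {n} (W : Sub n) u {z} → z ∈ adjoin W u → ∃ λ c → z +ᵛ (- c) *ᵛ u ∈ W
    ∈adjoin⁻ W u {z} = Code.sound (adjoin-code W u) z

    ∈adjoin⁺ : ∀ {n} (W : Sub n) u {w} c → w ∈ W → w +ᵛ c *ᵛ u ∈ adjoin W u
    ∈adjoin⁺ W u {w} c w∈W = Code.complete (adjoin-code W u) _
      (c , subst (_∈ W) (sym (+ᵛ-cancel c w u)) w∈W)

  ⊆adjoin : ∀ {n} (W : Sub n) u → W ⊆ adjoin W u
  ⊆adjoin W u x x∈W = subst (_∈ adjoin W u)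
    (trans (cong (x +ᵛ_) (0*ᵛ u)) (+ᵛ-identityʳ x)) (∈adjoin⁺ W u 0# x∈W)

  ∈adjoin : ∀ {n} (W : Sub n) u → u ∈ adjoin W u
  ∈adjoin W u = subst (_∈ adjoin W u) (trans (+ᵛ-identityˡ _) (1*ᵛ u)) (∈adjoin⁺ W u 1# (0∈ W))

  adjoin-⊆ : ∀ {n} (W : Sub n) u {X} → W ⊆ X → u ∈ X → adjoin W u ⊆ X
  adjoin-⊆ W u {X} W⊆X u∈X z z∈ with ∈adjoin⁻ W u z∈
  ... | c , h = +-cancel∈ X (- c) u∈X (W⊆X _ h)

  abstract
    -- The coefficient c that the search finds for z, together with the coordinates of z - c u in W,
    -- determines z. This gives one inequality; u ∉ W gives the other.
    dim-adjoin : ∀ {n} (W : Sub n) u → u ∉ W → dim (adjoin W u) ≡ suc (dim W)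
    dim-adjoin W u u∉W = ℕ.≤-antisym
      (dim≤ (adjoin W u) (λ z z∈ → let c , _ = ∈adjoin⁻ W u z∈ in c ∷ free W (z +ᵛ (- c) *ᵛ u))
        λ {x} {y} p r eq → injective x y (∈adjoin⁻ W u p) (∈adjoin⁻ W u r) eq)
      (⊂⇒dim< {A = W} {adjoin W u} (⊆adjoin W u) (∈adjoin W u) u∉W)
      where
      injective : ∀ x y (p : ∃ λ c → x +ᵛ (- c) *ᵛ u ∈ W) (r : ∃ λ c → y +ᵛ (- c) *ᵛ u ∈ W) →
        proj₁ p ∷ free W (x +ᵛ (- proj₁ p) *ᵛ u) ≡ proj₁ r ∷ free W (y +ᵛ (- proj₁ r) *ᵛ u) → x ≡ y
      injective x y (c , p) (d , r) eq with Vec.∷-injective eq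
      ... | refl , eq′ = trans (sym (+ᵛ-cancel′ c x u)) (trans (cong (_+ᵛ c *ᵛ u)
        (trans (sym (∈⇒par {W = W} p)) (trans (cong (par W) eq′) (∈⇒par {W = W} r)))) (+ᵛ-cancel′ c y u))

    exists∉ : ∀ {n} (W : Sub n) → dim W < n → ∃ λ x → x ∉ W
    exists∉ {n} W dimW<n with search n (λ x → ¬? (x ∈? W))
    ... | yes found = found
    ... | no  none  = contradiction
      (≤dim W id (λ a → decidable-stable (a ∈? W) λ a∉W → none (a , a∉W)) id) (ℕ.<⇒≱ dimW<n)

    -- Vectors outside the current subspace are adjoined one at a time, r - dim A times. This serves
    -- to show that a lone member of 𝒜 has the largest dimension allowed.
    enlarge : ∀ {n} (A : Sub n) {r} → dim A ≤ r → r ≤ n → ∃ λ B → A ⊆ B × dim B ≡ r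
    enlarge {n} A {r} A≤r r≤n = go (r ℕ.∸ dim A) A (ℕ.m+[n∸m]≡n A≤r)
      where
      go : ∀ k (A : Sub n) → dim A ℕ.+ k ≡ r → ∃ λ B → A ⊆ B × dim B ≡ r
      go zero    A eq = A , (λ _ → id) , trans (sym (ℕ.+-identityʳ _)) eq
      go (suc k) A eq with exists∉ A (ℕ.<-≤-trans (subst (dim A <_) eq (ℕ.m<m+n _ (s≤s z≤n))) r≤n)
      ... | x , x∉A with go k (adjoin A x)
        (trans (cong (ℕ._+ k) (dim-adjoin A x x∉A)) (trans (sym (ℕ.+-suc _ k)) eq))
      ... | B , ⊆B , eq′ = B , (λ y y∈A → ⊆B y (⊆adjoin A x y y∈A)) , eq′

  zeroSub : ∀ n → Sub n
  zeroSub zero    = nil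
  zeroSub (suc n) = skip (zeroSub n)

  ∈zeroSub : ∀ n {x} → x ∈ zeroSub n → x ≡ 0ᵛ
  ∈zeroSub zero    {[]}     _  = refl
  ∈zeroSub (suc n) {x ∷ xs} eq = cong₂ _∷_ (Vec.∷-injectiveˡ eq) (∈zeroSub n (Vec.∷-injectiveʳ eq))

  dim-zeroSub : ∀ n → dim (zeroSub n) ≡ 0
  dim-zeroSub zero    = refl
  dim-zeroSub (suc n) = dim-zeroSub n

  abstract
    nonzero∈ : ∀ {n} (W : Sub n) → 1 ≤ dim W → ∃ λ x → x ∈ W × x ≢ 0ᵛ
    nonzero∈ {n} W 1≤ with ⊆-or-witness W (zeroSub n)
    ... | inj₂ (x , x∈W , x∉0) = x , x∈W , λ { refl → x∉0 (0∈ (zeroSub n)) }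
    ... | inj₁ W⊆0 = contradiction (subst (dim W ≤_) (dim-zeroSub n) (⊆⇒dim≤ {A = W} {zeroSub n} W⊆0)) (ℕ.<⇒≱ 1≤)

  -- Otherwise (y , z) ↦ (a y + z , y − a y − z) is an injection from
  -- V × (A ∩ B) to A × B, where a y is the A-part of y.
  abstract
    exists∉⊕ : ∀ {n} (A B : Sub n) → dim A ℕ.+ dim B < n ℕ.+ dim (A ∩ B) → ∃ λ y → y ∉ A ⊕ B
    exists∉⊕ {n} A B lt with search n (λ x → ¬? (x ∈? (A ⊕ B)))
    ... | yes found = found
    ... | no  none  = contradiction (injective⇒≤ f f-injective) (ℕ.<⇒≱ lt)
      where
      split : ∀ y → ∃ λ a → a ∈ A × y +ᵛ (- 1#) *ᵛ a ∈ B
      split y = ∈⊕⁻ A B (decidable-stable (y ∈? (A ⊕ B)) λ y∉ → none (y , y∉))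

      α : Vec K n → Vec K n
      α y = proj₁ (split y)

      d : ℕ
      d = dim (A ∩ B)

      first second : Vec K (n ℕ.+ d) → Vec K n
      first  v = α (take n v) +ᵛ par (A ∩ B) (drop n v)
      second v = (take n v +ᵛ (- 1#) *ᵛ α (take n v)) +ᵛ (- 1#) *ᵛ par (A ∩ B) (drop n v)

      first∈ : ∀ v → first v ∈ A
      first∈ v = +∈ {W = A} (proj₁ (proj₂ (split (take n v)))) (proj₁ (∈∩⁻ A B (par∈ (A ∩ B) _)))

      second∈ : ∀ v → second v ∈ B
      second∈ v = +*∈ {W = B} (- 1#) (proj₂ (proj₂ (split (take n v)))) (proj₂ (∈∩⁻ A B (par∈ (A ∩ B) _)))

      f : Vec K (n ℕ.+ d) → Vec K (dim A ℕ.+ dim B)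
      f v = free A (first v) ++ free B (second v)

      sum-first-second : ∀ {m} (y a z : Vec K m) →
        (a +ᵛ z) +ᵛ ((y +ᵛ (- 1#) *ᵛ a) +ᵛ (- 1#) *ᵛ z) ≡ y
      sum-first-second [] [] [] = refl
      sum-first-second (y ∷ ys) (a ∷ as) (z ∷ zs) = cong₂ _∷_
        (solve 3 (λ y a z → (a :+ z) :+ ((y :+ (:- con 1ℤ) :* a) :+ (:- con 1ℤ) :* z) := y) refl y a z)
        (sum-first-second ys as zs)

      +ᵛ-cancelˡ : ∀ {m} (x : Vec K m) {y z} → x +ᵛ y ≡ x +ᵛ z → y ≡ z
      +ᵛ-cancelˡ x {y} {z} eq = trans (sym (back x y)) (trans (cong (_+ᵛ (- 1#) *ᵛ x) eq) (back x z))
        where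
        back : ∀ {m} (x y : Vec K m) → (x +ᵛ y) +ᵛ (- 1#) *ᵛ x ≡ y
        back [] [] = refl
        back (x ∷ xs) (y ∷ ys) = cong₂ _∷_
          (solve 2 (λ x y → (x :+ y) :+ (:- con 1ℤ) :* x := y) refl x y) (back xs ys)

      f-injective : ∀ {v w} → f v ≡ f w → v ≡ w
      f-injective {v} {w} eq = trans (sym (Vec.take++drop≡id n v))
        (trans (cong₂ _++_ y≡ z≡) (Vec.take++drop≡id n w))
        where
        parts : free A (first v) ≡ free A (first w) × free B (second v) ≡ free B (second w)
        parts = Vec.++-injective (free A (first v)) (free A (first w)) eq
        first≡ : first v ≡ first w
        first≡ = trans (sym (∈⇒par {W = A} (first∈ v)))
          (trans (cong (par A) (proj₁ parts)) (∈⇒par {W = A} (first∈ w)))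
        second≡ : second v ≡ second w
        second≡ = trans (sym (∈⇒par {W = B} (second∈ v)))
          (trans (cong (par B) (proj₂ parts)) (∈⇒par {W = B} (second∈ w)))
        -- The two parts of the image add up to y; once y is known, α y cancels in the first part
        -- and leaves z.
        y≡ : take n v ≡ take n w
        y≡ = trans (sym (sum-first-second (take n v) _ _))
          (trans (cong₂ _+ᵛ_ first≡ second≡) (sum-first-second (take n w) _ _))
        z≡ : drop n v ≡ drop n w
        z≡ = par-injective (A ∩ B) (+ᵛ-cancelˡ (α (take n v))
          (trans first≡ (cong (λ y → α y +ᵛ par (A ∩ B) (drop n w)) (sym y≡))))

  record Functional n : Set where
    field
      fun    : Vec K n → K
      fun-+  : ∀ x y → fun (x +ᵛ y) ≡ fun x + fun y
      fun-*  : ∀ c x → fun (c *ᵛ x) ≡ c * fun x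

    fun-+* : ∀ x c y → fun (x +ᵛ c *ᵛ y) ≡ fun x + c * fun y
    fun-+* x c y = trans (fun-+ x _) (cong (fun x +_) (fun-* c y))

    fun-0 : fun 0ᵛ ≡ 0#
    fun-0 = trans (cong fun (sym (0*ᵛ 0ᵛ))) (trans (fun-* 0# 0ᵛ) (zeroˡ _))

    normalise : ∀ {x} → fun x ≢ 0# → ∃ λ c → fun (c *ᵛ x) ≡ 1#
    normalise {x} ≢0 = let c , eq = inverse (fun x) ≢0 in c , trans (fun-* c x) eq
  open Functional public

  ≢0ᵛ⇒lookup≢0 : ∀ {n} (x : Vec K n) → x ≢ 0ᵛ → ∃ λ i → lookup x i ≢ 0#
  ≢0ᵛ⇒lookup≢0 []       x≢0 = contradiction refl x≢0
  ≢0ᵛ⇒lookup≢0 (x ∷ xs) x≢0 with x Fin.≟ 0#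
  ... | no  ≢0   = Fin.zero , ≢0
  ... | yes refl = let i , ≢0 = ≢0ᵛ⇒lookup≢0 xs (λ eq → x≢0 (cong (0# ∷_) eq)) in Fin.suc i , ≢0

  abstract
    -- Some coordinate of the residue of x modulo W is nonzero. This coordinate of the residue,
    -- scaled to be 1 at x, is the functional.
    separate : ∀ {n} (W : Sub n) x → x ∉ W → ∃ λ φ → (∀ y → y ∈ W → fun φ y ≡ 0#) × fun φ x ≡ 1#
    separate {n} W x x∉W with ≢0ᵛ⇒lookup≢0 (quo W x) x∉W
    ... | i , ≢0 with inverse (lookup (quo W x) i) ≢0
    ... | d , eq = record
        { fun   = λ y → d * lookup (quo W y) i
        ; fun-+ = λ y z → trans (cong (d *_) (trans (cong (λ v → lookup v i) (quo-linear W .+-homo y z))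
            (Vec.lookup-zipWith _+_ i (quo W y) (quo W z)))) (solve 3 (λ d y z → d :* (y :+ z) := d :* y :+ d :* z) refl d _ _)
        ; fun-* = λ c y → trans (cong (d *_) (trans (cong (λ v → lookup v i) (quo-linear W .*-homo c y))
            (Vec.lookup-map i (c *_) (quo W y)))) (solve 3 (λ d c y → d :* (c :* y) := c :* (d :* y)) refl d c _)
        } , (λ y y∈W → trans (cong (d *_) (trans (cong (λ v → lookup v i) y∈W) (Vec.lookup-replicate i 0#))) (zeroʳ d))
      , eq

    ker : ∀ {n} → Functional n → Sub n → Sub n
    ker-code : ∀ {n} (φ : Functional n) W → Code λ x → x ∈ W × fun φ x ≡ 0#
    ker-code φ W = canon record
      { dec      = λ x → (x ∈? W) ×-dec (fun φ x Fin.≟ 0#)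
      ; 0-closed = 0∈ W , fun-0 φ
      ; +-closed = λ { (p , p′) (r , r′) → +∈ {W = W} p r ,
          trans (fun-+ φ _ _) (trans (cong₂ _+_ p′ r′) (+-identityˡ 0#)) }
      ; *-closed = λ { c (p , p′) → *∈ {W = W} c p ,
          trans (fun-* φ c _) (trans (cong (c *_) p′) (zeroʳ c)) }
      }
    ker φ W = Code.sub (ker-code φ W)

    ∈ker⁻ : ∀ {n} (φ : Functional n) W {x} → x ∈ ker φ W → x ∈ W × fun φ x ≡ 0#
    ∈ker⁻ φ W {x} = Code.sound (ker-code φ W) x

    ∈ker⁺ : ∀ {n} (φ : Functional n) W {x} → x ∈ W → fun φ x ≡ 0# → x ∈ ker φ W
    ∈ker⁺ φ W {x} p r = Code.complete (ker-code φ W) x (p , r)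

    -- Since φ x = 1, y - φ(y) x lies in the kernel for every y ∈ W, so W is the kernel with x
    -- adjoined.
    dim-ker : ∀ {n} (φ : Functional n) W {x} → x ∈ W → fun φ x ≡ 1# → dim W ≡ suc (dim (ker φ W))
    dim-ker φ W {x} x∈W φx≡1 = trans
      (cong dim (⊆-antisym {A = W} {adjoin (ker φ W) x}
        (λ y y∈W → subst (_∈ adjoin (ker φ W) x) (+ᵛ-cancel′ (fun φ y) y x)
          (∈adjoin⁺ (ker φ W) x (fun φ y) (∈ker⁺ φ W (+*∈ {W = W} (- fun φ y) y∈W x∈W)
            (trans (fun-+* φ y _ x) (trans (cong (λ z → fun φ y + (- fun φ y) * z) φx≡1)
              (solve 1 (λ y → y :+ (:- y) :* con 1ℤ := con 0ℤ) refl (fun φ y)))))))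
        (adjoin-⊆ (ker φ W) x {W} (λ y y∈ → proj₁ (∈ker⁻ φ W y∈)) x∈W)))
      (dim-adjoin (ker φ W) x λ x∈ker → 1≢0 (trans (sym φx≡1) (proj₂ (∈ker⁻ φ W x∈ker))))

-- Linear automorphisms, transvections and pencils.

module Transvections {q : ℕ} (𝔽 : FiniteField q) where
  open import Data.Integer.Base using (0ℤ; 1ℤ)
  open import Data.Nat.Base using (_≤_; _<_)
  open import Data.Vec.Base using (Vec; []; _∷_)
  open Subspaces 𝔽
  open Dimension 𝔽
  open Constructions 𝔽
  open Linear

  -- Two indices, since `standardise` goes from K^n to K^(codim + dim), and these exponents are
  -- equal only propositionally.
  record Iso m n : Set where
    field
      to          : Vec K m → Vec K n
      from        : Vec K n → Vec K m
      to-from     : ∀ y → to (from y) ≡ y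
      from-to     : ∀ x → from (to x) ≡ x
      to-linear   : Linear to
      from-linear : Linear from
  open Iso

  inv : ∀ {m n} → Iso m n → Iso n m
  inv g = record
    { to = from g; from = to g; to-from = from-to g; from-to = to-from g
    ; to-linear = from-linear g; from-linear = to-linear g }

  abstract
    -- The image of W is taken as its preimage under `from`, which makes membership decidable
    -- without a search.
    act : ∀ {m n} → Iso m n → Sub m → Sub n
    act-code : ∀ {m n} (g : Iso m n) W → Code λ y → from g y ∈ W
    act-code g W = canon record
      { dec      = λ y → _ ∈? W
      ; 0-closed = subst (_∈ W) (sym (0-homo (from-linear g))) (0∈ W)
      ; +-closed = λ p r → subst (_∈ W) (sym (from-linear g .+-homo _ _)) (+∈ {W = W} p r)
      ; *-closed = λ c p → subst (_∈ W) (sym (from-linear g .*-homo c _)) (*∈ {W = W} c p)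
      }
    act g W = Code.sub (act-code g W)

    ∈act⁻ : ∀ {m n} (g : Iso m n) W {y} → y ∈ act g W → from g y ∈ W
    ∈act⁻ g W {y} = Code.sound (act-code g W) y

    ∈act⁺ : ∀ {m n} (g : Iso m n) W {y} → from g y ∈ W → y ∈ act g W
    ∈act⁺ g W {y} = Code.complete (act-code g W) y

  to∈act : ∀ {m n} (g : Iso m n) W {x} → x ∈ W → to g x ∈ act g W
  to∈act g W {x} x∈W = ∈act⁺ g W (subst (_∈ W) (sym (from-to g x)) x∈W)

  act-inv : ∀ {m n} (g : Iso m n) W → act (inv g) (act g W) ≡ W
  act-inv g W = ⊆-antisym {A = act (inv g) (act g W)} {W}
    (λ x h → subst (_∈ W) (from-to g x) (∈act⁻ g W (∈act⁻ (inv g) (act g W) h)))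
    (λ x x∈W → ∈act⁺ (inv g) (act g W) (to∈act g W x∈W))

  act-injective : ∀ {m n} (g : Iso m n) {A B} → act g A ≡ act g B → A ≡ B
  act-injective g {A} {B} eq = trans (sym (act-inv g A)) (trans (cong (act (inv g)) eq) (act-inv g B))

  dim-act : ∀ {m n} (g : Iso m n) W → dim (act g W) ≡ dim W
  dim-act g W = ℕ.≤-antisym
    (injection⇒dim≤ (act g W) W (from g) (λ y → ∈act⁻ g W)
      λ {x} {y} _ _ eq → trans (sym (to-from g x)) (trans (cong (to g) eq) (to-from g y)))
    (injection⇒dim≤ W (act g W) (to g) (λ x → to∈act g W)
      λ {x} {y} _ _ eq → trans (sym (from-to g x)) (trans (cong (from g) eq) (from-to g y)))

  act-∩ : ∀ {m n} (g : Iso m n) A B → act g A ∩ act g B ≡ act g (A ∩ B)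
  act-∩ g A B = ⊆-antisym {A = act g A ∩ act g B} {act g (A ∩ B)}
    (λ x h → let p , r = ∈∩⁻ (act g A) (act g B) h in
      ∈act⁺ g (A ∩ B) (∈∩⁺ A B (∈act⁻ g A p) (∈act⁻ g B r)))
    (λ x h → let p , r = ∈∩⁻ A B (∈act⁻ g (A ∩ B) h) in
      ∈∩⁺ (act g A) (act g B) (∈act⁺ g A p) (∈act⁺ g B r))

  dim-act-∩ : ∀ {m n} (g : Iso m n) A B → dim (act g A ∩ act g B) ≡ dim (A ∩ B)
  dim-act-∩ g A B = trans (cong dim (act-∩ g A B)) (dim-act g (A ∩ B))

  -- The hypothesis gives W ⊆ gW, and both have the same dimension.
  from-closed⇒fixed : ∀ {n} (g : Iso n n) W → (∀ x → x ∈ W → from g x ∈ W) → act g W ≡ W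
  from-closed⇒fixed g W closed = ⊆-antisym {A = act g W} {W}
    (⊆∧dim≤⇒⊇ {A = W} {act g W} W⊆gW (ℕ.≤-reflexive (dim-act g W))) W⊆gW
    where
    W⊆gW : W ⊆ act g W
    W⊆gW x x∈W = ∈act⁺ g W (closed x x∈W)

  shear : ∀ {n} → Functional n → Vec K n → Vec K n → Vec K n
  shear φ u x = x +ᵛ fun φ x *ᵛ u

  shear-linear : ∀ {n} (φ : Functional n) u → Linear (shear φ u)
  shear-linear φ u .+-homo x y = trans (cong (λ c → (x +ᵛ y) +ᵛ c *ᵛ u) (fun-+ φ x y))
    (trans (cong (x +ᵛ y +ᵛ_) (*ᵛ-distribʳ _ _ u)) (+ᵛ-interchange x y _ _))
  shear-linear φ u .*-homo c x = trans (cong (λ d → c *ᵛ x +ᵛ d *ᵛ u) (fun-* φ c x))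
    (trans (cong (c *ᵛ x +ᵛ_) (sym (*ᵛ-assoc c _ u))) (sym (*ᵛ-distribˡ c x _)))

  neg : ∀ {n} → Functional n → Functional n
  neg φ = record
    { fun   = λ x → - fun φ x
    ; fun-+ = λ x y → trans (cong -_ (fun-+ φ x y)) (solve 2 (λ a b → :- (a :+ b) := :- a :+ :- b) refl _ _)
    ; fun-* = λ c x → trans (cong -_ (fun-* φ c x)) (solve 2 (λ a b → :- (a :* b) := a :* (:- b)) refl c _)
    }

  module _ {n} (φ : Functional n) (u : Vec K n) (φu≡0 : fun φ u ≡ 0#) where

    fun-shift : ∀ x c → fun φ (x +ᵛ c *ᵛ u) ≡ fun φ x
    fun-shift x c = trans (fun-+* φ x c u) (trans (cong (λ z → fun φ x + c * z) φu≡0)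
      (solve 2 (λ a c → a :+ c :* con 0ℤ := a) refl (fun φ x) c))

    transvection : Iso n n
    transvection = record
      { to          = shear φ u
      ; from        = shear (neg φ) u
      ; to-from     = λ y → trans (cong (λ c → y +ᵛ (- fun φ y) *ᵛ u +ᵛ c *ᵛ u) (fun-shift y (- fun φ y)))
                              (+ᵛ-cancel′ (fun φ y) y u)
      ; from-to     = λ x → trans (cong (λ c → x +ᵛ fun φ x *ᵛ u +ᵛ (- c) *ᵛ u) (fun-shift x (fun φ x)))
                              (+ᵛ-cancel (fun φ x) x u)
      ; to-linear   = shear-linear φ u
      ; from-linear = shear-linear (neg φ) u
      }

    private g = transvection

    fun-from : ∀ x → fun φ (from g x) ≡ fun φ x
    fun-from x = fun-shift x (- fun φ x)

    from-ker : ∀ {x} → fun φ x ≡ 0# → from g x ≡ x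
    from-ker {x} φx≡0 = trans (cong (λ c → x +ᵛ (- c) *ᵛ u) φx≡0)
      (trans (cong (λ c → x +ᵛ c *ᵛ u) (solve 0 (:- con 0ℤ := con 0ℤ) refl))
        (trans (cong (x +ᵛ_) (0*ᵛ u)) (+ᵛ-identityʳ x)))

    -- A subspace is fixed if it contains the centre u or, as in `axis⊇⇒fixed`, lies in the axis ker
    -- φ. The fixed members in the descent all arise in these two ways.
    center∈⇒fixed : ∀ W → u ∈ W → act g W ≡ W
    center∈⇒fixed W u∈W = from-closed⇒fixed g W λ x x∈W → +*∈ {W = W} _ x∈W u∈W

    axis⊇⇒fixed : ∀ W → (∀ x → x ∈ W → fun φ x ≡ 0#) → act g W ≡ W
    axis⊇⇒fixed W φ≡0 = from-closed⇒fixed g W λ x x∈W → subst (_∈ W) (sym (from-ker (φ≡0 x x∈W))) x∈W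

    -- If u ∉ A and φ is not zero on A, then A and gA share the hyperplane `ker φ A` and both lie in
    -- A + ⟨u⟩. Among the subspaces between these two that have the dimension of A, this is the one
    -- that g fixes.
    pencil : Sub n → Sub n
    pencil A = adjoin (ker φ A) u

    pencil⊆axis : ∀ A x → x ∈ pencil A → fun φ x ≡ 0#
    pencil⊆axis A x x∈ with ∈adjoin⁻ (ker φ A) u x∈
    ... | c , h = trans (sym (fun-shift x (- c))) (proj₂ (∈ker⁻ φ A h))

    center∈pencil : ∀ A → u ∈ pencil A
    center∈pencil A = ∈adjoin (ker φ A) u

    act-pencil : ∀ A → act g (pencil A) ≡ pencil A
    act-pencil A = center∈⇒fixed (pencil A) (center∈pencil A)

    dim-pencil : ∀ A {x} → x ∈ A → fun φ x ≡ 1# → u ∉ A → dim (pencil A) ≡ dim A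
    dim-pencil A x∈A φx≡1 u∉A = trans
      (dim-adjoin (ker φ A) u λ u∈ → u∉A (proj₁ (∈ker⁻ φ A u∈)))
      (sym (dim-ker φ A x∈A φx≡1))

    private
      nonzero? : (W : Sub n) → (∃ λ x → x ∈ W × fun φ x ≡ 1#) ⊎ (∀ x → x ∈ W → fun φ x ≡ 0#)
      nonzero? W with search n (λ x → (x ∈? W) ×-dec ¬? (fun φ x Fin.≟ 0#))
      ... | yes (x , x∈W , φx≢0) = let c , eq = normalise φ φx≢0 in
                                   inj₁ (c *ᵛ x , *∈ {W = W} c x∈W , eq)
      ... | no none = inj₂ λ x x∈W → decidable-stable (fun φ x Fin.≟ 0#) λ φx≢0 → none (x , x∈W , φx≢0)

    -- x ∈ A ∩ B and x′ ∈ gA ∩ B off the axis can be scaled so that φ x = φ x′ = 1;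
    -- then x′ − x lies in B and in pencil A, but not in A.
    pencil-∩ : ∀ {t} A B → u ∉ A → t ≤ dim (A ∩ B) → t ≤ dim (act g A ∩ B) → t ≤ dim (pencil A ∩ B)
    pencil-∩ A B u∉A t≤A t≤gA with nonzero? (A ∩ B) | nonzero? (act g A ∩ B)
    ... | inj₂ φ≡0 | _ = ℕ.≤-trans t≤A (⊆⇒dim≤ {A = A ∩ B} {pencil A ∩ B} λ x h →
      let x∈A , x∈B = ∈∩⁻ A B h in
      ∈∩⁺ (pencil A) B (⊆adjoin (ker φ A) u x (∈ker⁺ φ A x∈A (φ≡0 x h))) x∈B)
    ... | inj₁ _ | inj₂ φ≡0 = ℕ.≤-trans t≤gA (⊆⇒dim≤ {A = act g A ∩ B} {pencil A ∩ B} λ x h →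
      let x∈gA , x∈B = ∈∩⁻ (act g A) B h in
      ∈∩⁺ (pencil A) B (⊆adjoin (ker φ A) u x
        (∈ker⁺ φ A (subst (_∈ A) (from-ker (φ≡0 x h)) (∈act⁻ g A x∈gA)) (φ≡0 x h))) x∈B)
    ... | inj₁ (x , x∈ , φx≡1) | inj₁ (x′ , x′∈ , φx′≡1) = ℕ.≤-trans t≤A
      (ℕ.≤-trans (ℕ.≤-reflexive (dim-ker φ (A ∩ B) x∈ φx≡1))
        (⊂⇒dim< {A = ker φ (A ∩ B)} {pencil A ∩ B} ker⊆
          (∈∩⁺ (pencil A) B v∈pencil v∈B)
          λ v∈ker → v∉A (proj₁ (∈∩⁻ A B (proj₁ (∈ker⁻ φ (A ∩ B) v∈ker))))))
      where
      v w : Vec K n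
      v = x′ +ᵛ (- 1#) *ᵛ x
      w = from g x′ +ᵛ (- 1#) *ᵛ x
      x∈A = proj₁ (∈∩⁻ A B x∈)
      x′-u∈A : from g x′ ∈ A
      x′-u∈A = ∈act⁻ g A (proj₁ (∈∩⁻ (act g A) B x′∈))
      -- Here w = g⁻¹x′ - x lies in A and φ w = 1 - 1 = 0, so the equation places v in the pencil.
      -- It would also give u ∈ A if v were in A.
      v≡w+u : w +ᵛ 1# *ᵛ u ≡ v
      v≡w+u = trans (cong (λ c → x′ +ᵛ (- c) *ᵛ u +ᵛ (- 1#) *ᵛ x +ᵛ 1# *ᵛ u) φx′≡1) (lemma x′ x u)
        where
        lemma : ∀ {m} (a b c : Vec K m) → a +ᵛ (- 1#) *ᵛ c +ᵛ (- 1#) *ᵛ b +ᵛ 1# *ᵛ c ≡ a +ᵛ (- 1#) *ᵛ b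
        lemma [] [] [] = refl
        lemma (a ∷ as) (b ∷ bs) (c ∷ cs) = cong₂ _∷_
          (solve 3 (λ a b c → a :+ (:- con 1ℤ) :* c :+ (:- con 1ℤ) :* b :+ con 1ℤ :* c
                           := a :+ (:- con 1ℤ) :* b) refl a b c)
          (lemma as bs cs)
      φw≡0 : fun φ w ≡ 0#
      φw≡0 = trans (fun-+* φ (from g x′) (- 1#) x)
        (trans (cong₂ (λ a b → a + (- 1#) * b) (trans (fun-from x′) φx′≡1) φx≡1)
          (solve 0 (con 1ℤ :+ (:- con 1ℤ) :* con 1ℤ := con 0ℤ) refl))
      v∈pencil : v ∈ pencil A
      v∈pencil = subst (_∈ pencil A) v≡w+u
        (∈adjoin⁺ (ker φ A) u 1# (∈ker⁺ φ A (+*∈ {W = A} (- 1#) x′-u∈A x∈A) φw≡0))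
      v∈B : v ∈ B
      v∈B = +*∈ {W = B} (- 1#) (proj₂ (∈∩⁻ (act g A) B x′∈)) (proj₂ (∈∩⁻ A B x∈))
      v∉A : v ∉ A
      v∉A v∈A = u∉A (cancel+∈ A 1≢0 (+*∈ {W = A} (- 1#) x′-u∈A x∈A) (subst (_∈ A) (sym v≡w+u) v∈A))
      ker⊆ : ker φ (A ∩ B) ⊆ pencil A ∩ B
      ker⊆ y h with ∈ker⁻ φ (A ∩ B) h
      ... | y∈ , φy≡0 = let y∈A , y∈B = ∈∩⁻ A B y∈ in
        ∈∩⁺ (pencil A) B (⊆adjoin (ker φ A) u y (∈ker⁺ φ A y∈A φy≡0)) y∈B

    -- For y ∈ gA ∩ B the vector g⁻¹y = y - φ(y) u is in A, so φ y ≠ 0 would put u into A ⊕ B. Hence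
    -- gA ∩ B lies in A ∩ B ∩ ker φ, and x is lost.
    dim-∩-shrinks : ∀ A B {x} → u ∉ A ⊕ B → x ∈ A → x ∈ B → fun φ x ≢ 0# →
                    dim (act g A ∩ B) < dim (A ∩ B)
    dim-∩-shrinks A B {x} u∉A⊕B x∈A x∈B φx≢0 = ⊂⇒dim< {A = act g A ∩ B} {A ∩ B}
      (λ y h → let y∈gA , y∈B = ∈∩⁻ (act g A) B h in
        ∈∩⁺ A B (subst (_∈ A) (from-ker (φ≡0 y∈gA y∈B)) (∈act⁻ g A y∈gA)) y∈B)
      (∈∩⁺ A B x∈A x∈B)
      (λ h → φx≢0 (φ≡0 (proj₁ (∈∩⁻ (act g A) B h)) x∈B))
      where
      φ≡0 : ∀ {y} → y ∈ act g A → y ∈ B → fun φ y ≡ 0#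
      φ≡0 {y} y∈gA y∈B with fun φ y Fin.≟ 0#
      ... | yes φy≡0 = φy≡0
      ... | no  φy≢0 = contradiction
        (cancel+∈ (A ⊕ B) -φy≢0 (⊆⊕ʳ A B y y∈B) (⊆⊕ˡ A B _ (∈act⁻ g A y∈gA))) u∉A⊕B
        where
        -φy≢0 : - fun φ y ≢ 0#
        -φy≢0 eq = φy≢0 (trans (solve 1 (λ a → a := :- (:- a)) refl (fun φ y))
          (trans (cong -_ eq) (solve 0 (:- con 0ℤ := con 0ℤ) refl)))

-- Shrinking the intersection with a fixed subspace.

module Descent {q : ℕ} (𝔽 : FiniteField q) where
  open import Data.Integer.Base using (0ℤ; 1ℤ)
  open import Data.Nat.Base using (suc; _≤_; _<_; s≤s)
  open import Data.Vec.Base using (Vec)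
  open Subspaces 𝔽
  open Dimension 𝔽
  open Constructions 𝔽
  open Transvections 𝔽
  open Iso

  -- A₁ witnesses that 𝒜 and g𝒜 meet, while u ∉ A₂ and φ x = 1 say that g moves A₂. The excluded A₁
  -- is the one subspace that 𝒜 ∩ g𝒜 may consist of when it is a singleton.
  TransvectionClosed : ∀ {n} → (Sub n → Set) → Set
  TransvectionClosed {n} 𝒜 = ∀ (φ : Functional n) u (φu≡0 : fun φ u ≡ 0#) {A₁ A₂ x} →
    let g = transvection φ u φu≡0 in
    𝒜 A₁ → 𝒜 A₂ → act g A₁ ≡ A₁ → u ∉ A₂ → x ∈ A₂ → fun φ x ≡ 1# →
    A₁ ≢ pencil φ u φu≡0 A₂ → 𝒜 (act g A₂)

  abstract
    -- No nonzero multiple of u is in W. With `separate` this yields φ with φ u = 0 and φ x = 1; the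
    -- line ⟨u⟩ is u adjoined to the zero space.
    ∉span : ∀ {n} (W : Sub n) {u x} → x ∈ W → x ≢ 0ᵛ → u ∉ W → x ∉ adjoin (zeroSub n) u
    ∉span {n} W {u} {x} x∈W x≢0 u∉W x∈ with ∈adjoin⁻ (zeroSub n) u x∈
    ... | c , h with c Fin.≟ 0# | trans (sym (+ᵛ-cancel′ c x u)) (trans (cong (_+ᵛ c *ᵛ u) (∈zeroSub n h)) (+ᵛ-identityˡ _))
    ... | yes refl | x≡cu = x≢0 (trans x≡cu (0*ᵛ u))
    ... | no  c≢0  | x≡cu = u∉W (unscale∈ W c≢0 u (subst (_∈ W) x≡cu x∈W))

  -- If x = w + c u with c ≠ 0, then u = (x − w) / c would lie in X.
  abstract
    ∉adjoin : ∀ {n} (W X : Sub n) {u x} → W ⊆ X → x ∈ X → x ∉ W → u ∉ X → x ∉ adjoin W u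
    ∉adjoin W X {u} {x} W⊆X x∈X x∉W u∉X x∈ with ∈adjoin⁻ W u x∈
    ... | c , h with (- c) Fin.≟ 0#
    ... | no -c≢0 = u∉X (cancel+∈ X -c≢0 x∈X (W⊆X _ h))
    ... | yes -c≡0 = x∉W (subst (_∈ W)
      (trans (cong (λ z → x +ᵛ z *ᵛ u) -c≡0) (trans (cong (x +ᵛ_) (0*ᵛ u)) (+ᵛ-identityʳ x))) h)

  module _ {n} {𝒜 : Sub n → Set} (closed : TransvectionClosed 𝒜) (B : Sub n)
           (meets : ∀ {A} → 𝒜 A → 1 ≤ dim (A ∩ B))
           (small : ∀ {A} → 𝒜 A → dim A ℕ.+ dim B < n ℕ.+ dim (A ∩ B)) where

    private
      shrink : ∀ {A A₂ x} → 𝒜 A → 𝒜 A₂ → A ≢ A₂ → (φ : Functional n) (u : Vec K n) (φu≡0 : fun φ u ≡ 0#) →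
        act (transvection φ u φu≡0) A₂ ≡ A₂ → u ∉ A ⊕ B → x ∈ A → x ∈ B → fun φ x ≡ 1# →
        A₂ ≢ pencil φ u φu≡0 A →
        ∃ λ A′ → 𝒜 A′ × A′ ≢ A₂ × dim (A′ ∩ B) < dim (A ∩ B)
      shrink {A} {A₂} {x} A∈ A₂∈ A≢A₂ φ u φu≡0 fixed u∉ x∈A x∈B φx≡1 ≢pencil =
        act g A ,
        closed φ u φu≡0 A₂∈ A∈ fixed (u∉ ∘ ⊆⊕ˡ A B u) x∈A φx≡1 ≢pencil ,
        (λ eq → A≢A₂ (act-injective g (trans eq (sym fixed)))) ,
        dim-∩-shrinks φ u φu≡0 A B u∉ x∈A x∈B λ φx≡0 → 1≢0 (trans (sym φx≡1) φx≡0)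
        where g = transvection φ u φu≡0

    -- The second member is carried along as a candidate for the one that g fixes; it may be
    -- replaced on the way.
    Shrunk : Sub n → Sub n → Set
    Shrunk A A₂ = ∃ λ A′ → ∃ λ A₂′ → 𝒜 A′ × 𝒜 A₂′ × A′ ≢ A₂′ × dim (A′ ∩ B) < dim (A ∩ B)

    -- φ is chosen to vanish on A₂, so that g fixes A₂. The centre must avoid A ⊕ B, for the
    -- intersection to shrink, and A₂, for A₂ not to be the pencil. The vector z is put into the
    -- axis to supply a candidate outside A₂; taking it outside A₂ ⊕ B keeps x out of A₂ + ⟨z⟩.
    shrink-A∩B⊈A₂ : ∀ {A A₂ x} → 𝒜 A → 𝒜 A₂ → x ∈ A → x ∈ B → x ∉ A₂ → Shrunk A A₂
    shrink-A∩B⊈A₂ {A} {A₂} {x} A∈ A₂∈ x∈A x∈B x∉A₂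
      with exists∉⊕ A₂ B (small A₂∈) | exists∉⊕ A B (small A∈)
    ... | z , z∉ | y , y∉ with separate (adjoin A₂ z) x
        (∉adjoin A₂ (A₂ ⊕ B) (⊆⊕ˡ A₂ B) (⊆⊕ʳ A₂ B x x∈B) x∉A₂ z∉)
    ... | φ , φ≡0 , φx≡1 = finish center
      where
      -- Subtracting φ(y) x moves y into the axis, and x ∈ A keeps it outside A ⊕ B.
      y′ = y +ᵛ (- fun φ y) *ᵛ x
      φy′≡0 : fun φ y′ ≡ 0#
      φy′≡0 = trans (fun-+* φ y _ x) (trans (cong (λ c → fun φ y + (- fun φ y) * c) φx≡1)
        (solve 1 (λ a → a :+ (:- a) :* con 1ℤ := con 0ℤ) refl (fun φ y)))
      y′∉ : y′ ∉ A ⊕ B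
      y′∉ h = y∉ (+-cancel∈ (A ⊕ B) (- fun φ y) (⊆⊕ˡ A B x x∈A) h)
      φz≡0 = φ≡0 z (∈adjoin A₂ z)
      Center = ∃ λ u → u ∉ A ⊕ B × u ∉ A₂ × fun φ u ≡ 0#
      center : Center
      -- A space is not the union of two proper subspaces: y′ avoids A ⊕ B and z avoids A₂, so one
      -- of y′, z and y′ + z avoids both.
      center with y′ ∈? A₂ | z ∈? (A ⊕ B)
      ... | no  y′∉A₂ | _     = y′ , y′∉ , y′∉A₂ , φy′≡0
      ... | yes _     | no z∉′ = z , z∉′ , z∉ ∘ ⊆⊕ˡ A₂ B z , φz≡0
      ... | yes y′∈A₂ | yes z∈ = y′ +ᵛ 1# *ᵛ z ,
        (λ h → y′∉ (+-cancel∈ (A ⊕ B) 1# z∈ h)) ,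
        (λ h → z∉ (⊆⊕ˡ A₂ B z (cancel+∈ A₂ 1≢0 y′∈A₂ h))) ,
        trans (fun-+* φ y′ 1# z) (trans (cong₂ (λ a b → a + 1# * b) φy′≡0 φz≡0)
          (solve 0 (con 0ℤ :+ con 1ℤ :* con 0ℤ := con 0ℤ) refl))
      finish : Center → Shrunk A A₂
      finish (u , u∉ , u∉A₂ , φu≡0) = let A′ , p , r , s = shrink A∈ A₂∈ (λ { refl → x∉A₂ x∈A }) φ u φu≡0
                                              (axis⊇⇒fixed φ u φu≡0 A₂ λ y y∈A₂ → φ≡0 y (⊆adjoin A₂ z y y∈A₂))
                                              u∉ x∈A x∈B φx≡1
                                              λ eq → u∉A₂ (subst (u ∈_) (sym eq) (center∈pencil φ u φu≡0 A))
                                        in A′ , A₂ , p , A₂∈ , r , s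

    -- With its centre in A₂, g fixes A₂. The pencil lies in the axis, whereas x ∈ A₂ has φ x = 1,
    -- so A₂ is not the pencil.
    shrink-A₂⊈A⊕B : ∀ {A A₂ x u} → 𝒜 A → 𝒜 A₂ → A ≢ A₂ → x ∈ A → x ∈ B → x ∈ A₂ → x ≢ 0ᵛ →
                    u ∈ A₂ → u ∉ A ⊕ B → Shrunk A A₂
    shrink-A₂⊈A⊕B {A} {A₂} {x} {u} A∈ A₂∈ A≢A₂ x∈A x∈B x∈A₂ x≢0 u∈A₂ u∉
      with separate (adjoin (zeroSub n) u) x (∉span (A ⊕ B) (⊆⊕ˡ A B x x∈A) x≢0 u∉)
    ... | φ , φ≡0 , φx≡1 = let A′ , p , r , s = shrink A∈ A₂∈ A≢A₂ φ u φu≡0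
                                   (center∈⇒fixed φ u φu≡0 A₂ u∈A₂) u∉ x∈A x∈B φx≡1
                                   λ eq → 1≢0 (trans (sym φx≡1) (pencil⊆axis φ u φu≡0 A x (subst (x ∈_) eq x∈A₂)))
                           in A′ , A₂ , p , A₂∈ , r , s
      where φu≡0 = φ≡0 u (∈adjoin (zeroSub n) u)

    -- When A₂ is not in general enough position it is first moved by a
    -- transvection that fixes A.
    shrink-∩ : ∀ {A A₂} → 𝒜 A → 𝒜 A₂ → A ≢ A₂ → Shrunk A A₂
    shrink-∩ {A} {A₂} A∈ A₂∈ A≢A₂ with nonzero∈ (A ∩ B) (meets A∈)
    ... | x , x∈ , x≢0 with ∈∩⁻ A B x∈
    ... | x∈A , x∈B with x ∈? A₂
    ... | no x∉A₂ = shrink-A∩B⊈A₂ A∈ A₂∈ x∈A x∈B x∉A₂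
    ... | yes x∈A₂ with ⊆-or-witness A₂ (A ⊕ B)
    ... | inj₂ (u , u∈A₂ , u∉) = shrink-A₂⊈A⊕B A∈ A₂∈ A≢A₂ x∈A x∈B x∈A₂ x≢0 u∈A₂ u∉
    ... | inj₁ A₂⊆A⊕B with ⊆-or-witness A₂ A
    -- A₂ lies in A ⊕ B but not in A. A transvection that fixes A pointwise keeps x in the image of
    -- A₂ and sends y to y + u outside A ⊕ B.
    shrink-∩ {A} {A₂} A∈ A₂∈ A≢A₂ | x , x∈ , x≢0 | x∈A , x∈B | yes x∈A₂ | inj₁ A₂⊆A⊕B | inj₂ (y , y∈A₂ , y∉A)
      with exists∉⊕ A B (small A∈)
    ... | u , u∉ with separate (adjoin A u) y (∉adjoin A (A ⊕ B) (⊆⊕ˡ A B) (A₂⊆A⊕B y y∈A₂) y∉A u∉)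
    ... | φ , φ≡0 , φy≡1 = shrink-A₂⊈A⊕B A∈
        (closed φ u φu≡0 A∈ A₂∈ fixed (u∉ ∘ A₂⊆A⊕B u) y∈A₂ φy≡1
          λ eq → u∉ (⊆⊕ˡ A B u (subst (u ∈_) (sym eq) (center∈pencil φ u φu≡0 A₂))))
        (λ eq → A≢A₂ (act-injective g (trans fixed eq)))
        x∈A x∈B
        (∈act⁺ g A₂ (subst (_∈ A₂) (sym (from-ker φ u φu≡0 (φ≡0 x (⊆adjoin A u x x∈A)))) x∈A₂))
        x≢0 (to∈act g A₂ y∈A₂)
        λ h → u∉ (cancel+∈ (A ⊕ B) 1≢0 (A₂⊆A⊕B y y∈A₂) (subst (λ c → y +ᵛ c *ᵛ u ∈ A ⊕ B) φy≡1 h))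
      where
      φu≡0 = φ≡0 u (∈adjoin A u)
      g = transvection φ u φu≡0
      fixed = axis⊇⇒fixed φ u φu≡0 A λ z z∈A → φ≡0 z (⊆adjoin A u z z∈A)
    -- A₂ is a proper subspace of A. A centre in A outside A₂ leaves A fixed and removes x from the
    -- image of A₂, because x - u ∉ A₂.
    shrink-∩ {A} {A₂} A∈ A₂∈ A≢A₂ | x , x∈ , x≢0 | x∈A , x∈B | yes x∈A₂ | inj₁ A₂⊆A⊕B | inj₁ A₂⊆A
      with ⊆-or-witness A A₂
    ... | inj₁ A⊆A₂ = contradiction (⊆-antisym {A = A} {A₂} A⊆A₂ A₂⊆A) A≢A₂
    ... | inj₂ (u , u∈A , u∉A₂) with separate (adjoin (zeroSub n) u) x (∉span A₂ x∈A₂ x≢0 u∉A₂)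
    ... | φ , φ≡0 , φx≡1 = shrink-A∩B⊈A₂ A∈
        (closed φ u φu≡0 A∈ A₂∈ (center∈⇒fixed φ u φu≡0 A u∈A) u∉A₂ x∈A₂ φx≡1
          λ eq → 1≢0 (trans (sym φx≡1) (pencil⊆axis φ u φu≡0 A₂ x (subst (x ∈_) eq x∈A))))
        x∈A x∈B
        λ h → u∉A₂ (cancel+∈ A₂ -1≢0 x∈A₂ (subst (λ c → x +ᵛ (- c) *ᵛ u ∈ A₂) φx≡1 (∈act⁻ g A₂ h)))
      where
      φu≡0 = φ≡0 u (∈adjoin (zeroSub n) u)
      g = transvection φ u φu≡0
      -1≢0 : - 1# ≢ 0#
      -1≢0 eq = 1≢0 (trans (solve 0 (con 1ℤ := :- (:- con 1ℤ)) refl) (trans (cong -_ eq)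
        (solve 0 (:- con 0ℤ := con 0ℤ) refl)))

    transvectionClosed⇒unique : ∀ {A A₂} → 𝒜 A → 𝒜 A₂ → A ≡ A₂
    transvectionClosed⇒unique {A} {A₂} A∈ A₂∈ =
      decidable-stable (A ≟ₛ A₂) λ A≢A₂ → go (suc (dim (A ∩ B))) A∈ A₂∈ A≢A₂ ℕ.≤-refl
      where
      go : ∀ k {A A₂} → 𝒜 A → 𝒜 A₂ → A ≢ A₂ → dim (A ∩ B) < k → ⊥
      go (suc k) A∈ A₂∈ A≢A₂ (s≤s ≤k) with shrink-∩ A∈ A₂∈ A≢A₂
      ... | _ , _ , A′∈ , A₂′∈ , A′≢A₂′ , lt = go k A′∈ A₂′∈ A′≢A₂′ (ℕ.<-≤-trans lt ≤k)

-- Counting the elements of a list that satisfy a Boolean predicate.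

module Counting where
  open import Data.List.Base using (List; []; _∷_; _++_; map; concatMap; length)
  open import Data.List.Relation.Unary.All using ([]; _∷_)
  open import Data.List.Relation.Unary.AllPairs using ([]; _∷_)
  open import Data.Nat.Base
  open import Data.Nat.ListAction using (sum)
  open import Data.Nat.Properties

  ∧-true : ∀ {a b} → a ∧ b ≡ true → a ≡ true × b ≡ true
  ∧-true {true} {true} refl = refl , refl

  ∨-true : ∀ {a b} → a ∨ b ≡ true → a ≡ true ⊎ b ≡ true
  ∨-true {true}  _ = inj₁ refl
  ∨-true {false} h = inj₂ h

  ∨-trueˡ : ∀ {a b} → a ≡ true → a ∨ b ≡ true
  ∨-trueˡ refl = refl

  ∨-trueʳ : ∀ {a b} → b ≡ true → a ∨ b ≡ true
  ∨-trueʳ {a} refl = Bool.∨-zeroʳ a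

  does⇒ : ∀ {p} {P : Set p} (P? : Dec P) → does P? ≡ true → P
  does⇒ (yes p) _ = p

  iff⇒≡ : ∀ {a b} → (a ≡ true → b ≡ true) → (b ≡ true → a ≡ true) → a ≡ b
  iff⇒≡ {true}  {_}     f g = sym (f refl)
  iff⇒≡ {false} {true}  f g = g refl
  iff⇒≡ {false} {false} f g = refl

  ≤ᵇ-true : ∀ {k l} → k ≤ l → (k ≤ᵇ l) ≡ true
  ≤ᵇ-true = dec-true (_ ≤? _)

  true-≤ᵇ : ∀ {k l} → (k ≤ᵇ l) ≡ true → k ≤ l
  true-≤ᵇ = does⇒ (_ ≤? _)

  indicator : Bool → ℕ
  indicator true  = 1
  indicator false = 0

  module _ {X : Set} where

    count : (X → Bool) → List X → ℕ
    count P []       = 0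
    count P (x ∷ xs) = indicator (P x) + count P xs

    indicator-mono : ∀ {a b} → (a ≡ true → b ≡ true) → indicator a ≤ indicator b
    indicator-mono {false}         _ = z≤n
    indicator-mono {true}  {true}  _ = ≤-refl
    indicator-mono {true}  {false} h = contradiction (h refl) λ ()

    count-mono : ∀ {P Q : X → Bool} xs → (∀ x → P x ≡ true → Q x ≡ true) → count P xs ≤ count Q xs
    count-mono []       h = z≤n
    count-mono (x ∷ xs) h = +-mono-≤ (indicator-mono (h x)) (count-mono xs h)

    count-cong : ∀ {P Q : X → Bool} xs → (∀ x → P x ≡ Q x) → count P xs ≡ count Q xs
    count-cong []       h = refl
    count-cong (x ∷ xs) h = cong₂ _+_ (cong indicator (h x)) (count-cong xs h)

    count≤length : ∀ (P : X → Bool) xs → count P xs ≤ length xs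
    count≤length P []       = z≤n
    count≤length P (x ∷ xs) = +-mono-≤ {y = 1} (indicator-mono {P x} {true} λ _ → refl) (count≤length P xs)

    count-true : ∀ xs → count (const true) xs ≡ length xs
    count-true []       = refl
    count-true (x ∷ xs) = cong suc (count-true xs)

    count-strict : ∀ {P Q : X → Bool} {x} xs → (∀ x → P x ≡ true → Q x ≡ true) →
                   x ∈ₗ xs → P x ≡ false → Q x ≡ true → count P xs < count Q xs
    count-strict (x ∷ xs) h (here refl) Px Qx rewrite Px | Qx = s≤s (count-mono xs h)
    count-strict (y ∷ xs) h (there x∈)  Px Qx =
      +-mono-≤-< (indicator-mono (h y)) (count-strict xs h x∈ Px Qx)

    count>0⇒∃ : ∀ {P : X → Bool} xs → 0 < count P xs → ∃ λ x → P x ≡ true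
    count>0⇒∃ {P} (x ∷ xs) h with P x in eq
    ... | true  = x , eq
    ... | false = count>0⇒∃ xs h

    ∈⇒count>0 : ∀ {P : X → Bool} {x} xs → x ∈ₗ xs → P x ≡ true → 0 < count P xs
    ∈⇒count>0 xs x∈ Px = ≤-<-trans z≤n (count-strict {P = const false} xs (λ _ ()) x∈ refl Px)

    -- Modularity of the count; this is why the sizes of a meet and a join balance.
    count-∧+∨ : ∀ (P Q : X → Bool) xs →
      count (λ x → P x ∧ Q x) xs + count (λ x → P x ∨ Q x) xs ≡ count P xs + count Q xs
    count-∧+∨ P Q []       = refl
    count-∧+∨ P Q (x ∷ xs) = begin
      (i (P x ∧ Q x) + c₁) + (i (P x ∨ Q x) + c₂)   ≡⟨ swap₄ (i (P x ∧ Q x)) c₁ _ c₂ ⟩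
      (i (P x ∧ Q x) + i (P x ∨ Q x)) + (c₁ + c₂)   ≡⟨ cong₂ _+_ (indicator-∧+∨ (P x) (Q x)) (count-∧+∨ P Q xs) ⟩
      (i (P x) + i (Q x)) + (count P xs + count Q xs) ≡⟨ swap₄ (i (P x)) _ _ _ ⟩
      count P (x ∷ xs) + count Q (x ∷ xs)           ∎
      where
      open ≡-Reasoning
      open +-*-Solver
      i = indicator
      c₁ = count (λ x → P x ∧ Q x) xs
      c₂ = count (λ x → P x ∨ Q x) xs
      swap₄ : ∀ a b c d → (a + b) + (c + d) ≡ (a + c) + (b + d)
      swap₄ = solve 4 (λ a b c d → (a :+ b) :+ (c :+ d) := (a :+ c) :+ (b :+ d)) refl
      indicator-∧+∨ : ∀ a b → indicator (a ∧ b) + indicator (a ∨ b) ≡ indicator a + indicator b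
      indicator-∧+∨ true  true  = refl
      indicator-∧+∨ true  false = refl
      indicator-∧+∨ false true  = refl
      indicator-∧+∨ false false = refl

    -- `tag` tells from which block an element comes, so distinct blocks are disjoint.
    unique-concatMap : ∀ {Y : Set} (f : Y → List X) (tag : X → Y) → (∀ y → Unique (f y)) →
      (∀ {x y} → x ∈ₗ f y → tag x ≡ y) → ∀ {ys} → Unique ys → Unique (concatMap f ys)
    unique-concatMap f tag f-unique tagged {[]}     []         = []
    unique-concatMap f tag f-unique tagged {y ∷ ys} (y∉ ∷ u) =
      Unique.++⁺ (f-unique y) (unique-concatMap f tag f-unique tagged u) disjoint
      where
      tag∈ : ∀ zs {x} → x ∈ₗ concatMap f zs → tag x ∈ₗ zs
      tag∈ (z ∷ zs) x∈ with ∈-++⁻ (f z) x∈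
      ... | inj₁ p = here (tagged p)
      ... | inj₂ p = there (tag∈ zs p)
      disjoint : ∀ {x} → ¬ (x ∈ₗ f y × x ∈ₗ concatMap f ys)
      disjoint (p , r) = All.lookup y∉ (tag∈ ys r) (sym (tagged p))

  -- Induction on the list: whenever x is counted, f x is removed from Q. This lowers the count of Q
  -- by at least one, and injectivity keeps the images of the remaining elements.
  count-injective : ∀ {X Y : Set} → DecidableEquality Y → (f : X → Y) (P : X → Bool) (Q : Y → Bool) →
    ∀ {xs} ys → Unique xs → (∀ x → P x ≡ true → Q (f x) ≡ true) → (∀ y → y ∈ₗ ys) →
    (∀ {x x′} → P x ≡ true → P x′ ≡ true → f x ≡ f x′ → x ≡ x′) → count P xs ≤ count Q ys
  count-injective {X} {Y} _≟_ f P Q₀ {xs₀} ys unique₀ P⇒Q₀ complete f-inj = go Q₀ xs₀ unique₀ λ x _ → P⇒Q₀ x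
    where
    go : ∀ (Q : Y → Bool) xs → Unique xs → (∀ x → x ∈ₗ xs → P x ≡ true → Q (f x) ≡ true) → count P xs ≤ count Q ys
    go Q []       _          _   = z≤n
    go Q (x ∷ xs) (x∉ ∷ u) P⇒Q with P x in Px
    ... | false = go Q xs u λ z z∈ → P⇒Q z (there z∈)
    ... | true  = ≤-<-trans (go Q′ xs u P⇒Q′)
      (count-strict {P = Q′} {Q} ys (λ y h → proj₁ (∧-true h)) (complete (f x))
        (trans (cong (λ b → Q (f x) ∧ not b) (dec-true (f x ≟ f x) refl)) (Bool.∧-zeroʳ _))
        (P⇒Q x (here refl) Px))
      where
      Q′ : Y → Bool
      Q′ y = Q y ∧ not (does (y ≟ f x))
      P⇒Q′ : ∀ z → z ∈ₗ xs → P z ≡ true → Q′ (f z) ≡ true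
      P⇒Q′ z z∈ Pz = cong₂ _∧_ (P⇒Q z (there z∈) Pz)
        (cong not (dec-false (f z ≟ f x) λ eq → All.lookup x∉ z∈ (f-inj Px Pz (sym eq))))

  module _ {X : Set} (P : X → Bool) {xs : List X} (unique : Unique xs) where

    subsingleton⇒count≤1 : (∀ {x y} → P x ≡ true → P y ≡ true → x ≡ y) → count P xs ≤ 1
    subsingleton⇒count≤1 eq = count-injective (λ _ _ → yes refl) (const tt) P (const true) (tt ∷ []) unique
      (λ _ _ → refl) (λ _ → here refl) λ p r _ → eq p r

  -- If y ≠ x, the predicate of being x has positive count and is strictly contained in P, because
  -- it misses y.
  count≤1⇒≡ : ∀ {X : Set} → DecidableEquality X → (P : X → Bool) → ∀ xs → (∀ x → x ∈ₗ xs) →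
    count P xs ≤ 1 → ∀ {x y} → P x ≡ true → P y ≡ true → x ≡ y
  count≤1⇒≡ _≟_ P xs complete ≤1 {x} {y} Px Py with y ≟ x
  ... | yes y≡x = sym y≡x
  ... | no  y≢x = contradiction
    (≤-<-trans (∈⇒count>0 {P = λ z → does (z ≟ x)} xs (complete x) (dec-true (x ≟ x) refl))
      (count-strict xs (λ z h → subst (λ w → P w ≡ true) (sym (does⇒ (z ≟ x) h)) Px)
        (complete y) (dec-false (y ≟ x) y≢x) Py))
    (≤⇒≯ ≤1)

  elem : ℕ → List ℕ → Bool
  elem k []       = false
  elem k (l ∷ ls) = (k ≡ᵇ l) ∨ elem k ls

  elem⇒∈ : ∀ {k} ls → elem k ls ≡ true → k ∈ₗ ls
  elem⇒∈ {k} (l ∷ ls) h with ∨-true {k ≡ᵇ l} h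
  ... | inj₁ eq = here (does⇒ (k ≟ l) eq)
  ... | inj₂ h′ = there (elem⇒∈ ls h′)

  ∈⇒elem : ∀ {k ls} → k ∈ₗ ls → elem k ls ≡ true
  ∈⇒elem {k} (here {x = l} k≡l) = ∨-trueˡ (dec-true (k ≟ l) k≡l)
  ∈⇒elem {k} (there {x = l} k∈) = ∨-trueʳ {k ≡ᵇ l} (∈⇒elem k∈)

  module _ {X : Set} where

    count-false : ∀ (xs : List X) → count (const false) xs ≡ 0
    count-false []       = refl
    count-false (x ∷ xs) = count-false xs

    count-++ : ∀ (P : X → Bool) xs ys → count P (xs ++ ys) ≡ count P xs + count P ys
    count-++ P []       ys = refl
    count-++ P (x ∷ xs) ys = trans (cong (indicator (P x) +_) (count-++ P xs ys)) (sym (+-assoc (indicator (P x)) _ _))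

    count-map : ∀ {Y : Set} (P : X → Bool) (f : Y → X) ys → count P (map f ys) ≡ count (P ∘ f) ys
    count-map P f []       = refl
    count-map P f (y ∷ ys) = cong (indicator (P (f y)) +_) (count-map P f ys)

    -- The fibre over the head of ks is disjoint from the other fibres because ks has no
    -- repetitions, so modularity splits it off.
    count-fibres : ∀ (κ : X → ℕ) (P : X → Bool) (xs : List X) {ks} → Unique ks →
      count (λ x → elem (κ x) ks ∧ P x) xs ≡ sum (map (λ k → count (λ x → (κ x ≡ᵇ k) ∧ P x) xs) ks)
    count-fibres κ P xs {[]}     []       = count-false xs
    count-fibres κ P xs {k ∷ ks} (k∉ ∷ u) = begin
      count (λ x → ((κ x ≡ᵇ k) ∨ elem (κ x) ks) ∧ P x) xs
        ≡⟨ count-cong xs (λ x → Bool.∧-distribʳ-∨ (P x) (κ x ≡ᵇ k) _) ⟩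
      count (λ x → Q x ∨ R x) xs
        ≡⟨ cong (_+ count (λ x → Q x ∨ R x) xs) (sym (trans (count-cong xs disjoint) (count-false xs))) ⟩
      count (λ x → Q x ∧ R x) xs + count (λ x → Q x ∨ R x) xs
        ≡⟨ count-∧+∨ Q R xs ⟩
      count Q xs + count R xs
        ≡⟨ cong (count Q xs +_) (count-fibres κ P xs u) ⟩
      _ ∎
      where
      open ≡-Reasoning
      Q R : X → Bool
      Q x = (κ x ≡ᵇ k) ∧ P x
      R x = elem (κ x) ks ∧ P x
      disjoint : ∀ x → Q x ∧ R x ≡ false
      disjoint x with κ x ≡ᵇ k in eq | elem (κ x) ks in eq′
      ... | false | _     = refl
      ... | true  | false = Bool.∧-zeroʳ _
      ... | true  | true  = contradiction (sym (does⇒ (κ x ≟ k) eq)) (All.lookup k∉ (elem⇒∈ ks eq′))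

-- Enumeration of all subspaces, and maximal cross-intersecting pairs.

module Families {q : ℕ} (𝔽 : FiniteField q) where
  open import Data.List.Base using (List; []; _∷_; concatMap; length; allFin)
  open import Data.List.Relation.Unary.All using ([]; _∷_)
  open import Data.List.Relation.Unary.AllPairs using ([]; _∷_)
  open import Data.Nat.Base using (zero; suc; _≤_; _<_; s≤s; _≤ᵇ_)
  open import Data.Vec.Base using (Vec; []; _∷_; head)
  open Counting
  open Subspaces 𝔽
  open Dimension 𝔽
  open Constructions 𝔽
  open Transvections 𝔽
  open Descent 𝔽

  allVec : ∀ n → List (Vec K n)
  allVec zero    = [] ∷ []
  allVec (suc n) = concatMap (λ x → List.map (x ∷_) (allVec n)) (allFin q)

  ∈allVec : ∀ {n} (x : Vec K n) → x ∈ₗ allVec n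
  ∈allVec []       = here refl
  ∈allVec (x ∷ xs) = ∈-concatMap⁺ _ (lose (∈-allFin x) (∈-map⁺ (x ∷_) (∈allVec xs)))

  unique-allVec : ∀ n → Unique (allVec n)
  unique-allVec zero    = [] ∷ []
  unique-allVec (suc n) = unique-concatMap _ head
    (λ x → Unique.map⁺ Vec.∷-injectiveʳ (unique-allVec n)) tagged (Unique.allFin⁺ q)
    where
    tagged : ∀ {v : Vec K (suc n)} {x} → v ∈ₗ List.map (x ∷_) (allVec n) → head v ≡ x
    tagged v∈ with ∈-map⁻ _ v∈
    ... | _ , _ , refl = refl

  allSub : ∀ n → List (Sub n)
  leads : ∀ {n} → Sub n → List (Sub (suc n))
  leads W = List.map (lead W) (allVec (codim W))
  allSub zero    = nil ∷ []
  allSub (suc n) = List.map skip (allSub n) List.++ concatMap leads (allSub n)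

  ∈allSub : ∀ {n} (W : Sub n) → W ∈ₗ allSub n
  ∈allSub nil        = here refl
  ∈allSub (skip W)   = ∈-++⁺ˡ (∈-map⁺ skip (∈allSub W))
  ∈allSub (lead W w) = ∈-++⁺ʳ (List.map skip (allSub _))
    (∈-concatMap⁺ leads (lose (∈allSub W) (∈-map⁺ (lead W) (∈allVec w))))

  private
    restriction : ∀ {n} → Sub (suc n) → Sub n
    restriction (skip W)   = W
    restriction (lead W _) = W

  unique-allSub : ∀ n → Unique (allSub n)
  unique-allSub zero    = [] ∷ []
  unique-allSub (suc n) = Unique.++⁺
    (Unique.map⁺ (λ { refl → refl }) (unique-allSub n))
    (unique-concatMap leads restriction (λ W → Unique.map⁺ (λ { refl → refl }) (unique-allVec (codim W)))
      tagged (unique-allSub n))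
    disjoint
    where
    tagged : ∀ {V : Sub (suc n)} {W} → V ∈ₗ leads W → restriction V ≡ W
    tagged V∈ with ∈-map⁻ _ V∈
    ... | _ , _ , refl = refl
    ¬skip∈leads : ∀ {V} Ws → ¬ (skip V ∈ₗ concatMap leads Ws)
    ¬skip∈leads (W ∷ Ws) V∈ with ∈-++⁻ (leads W) V∈
    ... | inj₂ V∈Ws = ¬skip∈leads Ws V∈Ws
    ... | inj₁ V∈W with ∈-map⁻ _ V∈W
    ... | _ , _ , ()
    disjoint : ∀ {V} → ¬ (V ∈ₗ List.map skip (allSub n) × V ∈ₗ concatMap leads (allSub n))
    disjoint (p , r) with ∈-map⁻ skip p
    ... | _ , _ , refl = ¬skip∈leads (allSub n) r

  size : ∀ {n} → (Sub n → Bool) → ℕ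
  size {n} 𝒜 = count 𝒜 (allSub n)

  -- The family g𝒜, since A ∈ g𝒜 means g⁻¹A ∈ 𝒜.
  shift : ∀ {n} → Iso n n → (Sub n → Bool) → Sub n → Bool
  shift g 𝒜 A = 𝒜 (act (inv g) A)

  size-shift : ∀ {n} (g : Iso n n) 𝒜 → size (shift g 𝒜) ≡ size 𝒜
  size-shift {n} g 𝒜 = ℕ.≤-antisym
    (count-injective _≟ₛ_ (act (inv g)) (shift g 𝒜) 𝒜 (allSub n) (unique-allSub n)
      (λ _ h → h) ∈allSub λ _ _ → act-injective (inv g))
    (count-injective _≟ₛ_ (act g) 𝒜 (shift g 𝒜) (allSub n) (unique-allSub n)
      (λ A h → trans (cong 𝒜 (act-inv g A)) h) ∈allSub λ _ _ → act-injective g)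

  ∩-comm : ∀ {n} (A B : Sub n) → A ∩ B ≡ B ∩ A
  ∩-comm A B = ⊆-antisym {A = A ∩ B} {B ∩ A}
    (λ x h → let p , r = ∈∩⁻ A B h in ∈∩⁺ B A r p)
    (λ x h → let p , r = ∈∩⁻ B A h in ∈∩⁺ A B r p)

  module _ {n : ℕ} (t : ℕ) where

    -- ρ and σ are the sets of dimensions allowed in 𝒜 and ℬ.
    record Pair (ρ σ : ℕ → Bool) (𝒜 ℬ : Sub n → Bool) : Set where
      field
        dims-𝒜 : ∀ {A} → 𝒜 A ≡ true → ρ (dim A) ≡ true
        dims-ℬ : ∀ {B} → ℬ B ≡ true → σ (dim B) ≡ true
        cross  : ∀ {A B} → 𝒜 A ≡ true → ℬ B ≡ true → t ≤ dim (A ∩ B)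
        some-𝒜 : ∃ λ A → 𝒜 A ≡ true
        some-ℬ : ∃ λ B → ℬ B ≡ true
    open Pair

    Maximal : (ρ σ : ℕ → Bool) (𝒜 ℬ : Sub n → Bool) → Set
    Maximal ρ σ 𝒜 ℬ = ∀ 𝒜′ ℬ′ → Pair ρ σ 𝒜′ ℬ′ → size 𝒜′ ℕ.+ size ℬ′ ≤ size 𝒜 ℕ.+ size ℬ

    swap : ∀ {ρ σ 𝒜 ℬ} → Pair ρ σ 𝒜 ℬ → Pair σ ρ ℬ 𝒜
    swap P = record
      { dims-𝒜 = dims-ℬ P
      ; dims-ℬ = dims-𝒜 P
      ; cross  = λ {A} {B} p r → subst (t ≤_) (cong dim (∩-comm B A)) (cross P r p)
      ; some-𝒜 = some-ℬ P
      ; some-ℬ = some-𝒜 P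
      }

    swap-maximal : ∀ {ρ σ 𝒜 ℬ} → Maximal ρ σ 𝒜 ℬ → Maximal σ ρ ℬ 𝒜
    swap-maximal {𝒜 = 𝒜} {ℬ} max 𝒜′ ℬ′ P = subst₂ _≤_ (ℕ.+-comm (size ℬ′) _) (ℕ.+-comm (size 𝒜) _)
      (max ℬ′ 𝒜′ (swap P))

    -- Otherwise C could be added to 𝒜 with ℬ unchanged, which gives a larger pair.
    maximal⇒closed : ∀ {ρ σ 𝒜 ℬ} → Pair ρ σ 𝒜 ℬ → Maximal ρ σ 𝒜 ℬ →
      ∀ C → ρ (dim C) ≡ true → (∀ {B} → ℬ B ≡ true → t ≤ dim (C ∩ B)) → 𝒜 C ≡ true
    maximal⇒closed {ρ} {𝒜 = 𝒜} {ℬ} P max C ρC meets with 𝒜 C in C∈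
    ... | true  = refl
    ... | false = contradiction (max 𝒜⁺ ℬ (record
      { dims-𝒜 = λ {A} h → [ dims-𝒜 P , (λ e → subst (λ D → ρ (dim D) ≡ true) (sym (does⇒ (A ≟ₛ C) e)) ρC) ]′ (∨-true h)
      ; dims-ℬ = dims-ℬ P
      ; cross  = λ {A} {B} h B∈ → [ (λ A∈ → cross P A∈ B∈) , (λ e → subst (λ D → t ≤ dim (D ∩ B)) (sym (does⇒ (A ≟ₛ C) e)) (meets B∈)) ]′ (∨-true h)
      ; some-𝒜 = proj₁ (some-𝒜 P) , ∨-trueˡ (proj₂ (some-𝒜 P))
      ; some-ℬ = some-ℬ P
      })) (ℕ.<⇒≱ (ℕ.+-monoˡ-< (size ℬ) (count-strict {P = 𝒜} {𝒜⁺} (allSub n) (λ _ → ∨-trueˡ) (∈allSub C) C∈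
        (∨-trueʳ {𝒜 C} (dec-true (C ≟ₛ C) refl)))))
      where
      𝒜⁺ : Sub n → Bool
      𝒜⁺ A = 𝒜 A ∨ does (A ≟ₛ C)

    infixr 7 _⊓ᶠ_
    infixr 6 _⊔ᶠ_
    _⊓ᶠ_ _⊔ᶠ_ : (𝒜 ℬ : Sub n → Bool) → Sub n → Bool
    (𝒜 ⊓ᶠ ℬ) A = 𝒜 A ∧ ℬ A
    (𝒜 ⊔ᶠ ℬ) A = 𝒜 A ∨ ℬ A

    module _ {ρ σ 𝒜 ℬ} (P : Pair ρ σ 𝒜 ℬ) (g : Iso n n) where

      cross-shift : ∀ {A B} → shift g 𝒜 A ≡ true → shift g ℬ B ≡ true → t ≤ dim (A ∩ B)
      cross-shift {A} {B} p r = subst (t ≤_) (dim-act-∩ (inv g) A B) (cross P p r)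

      dims-shift-ℬ : ∀ {B} → shift g ℬ B ≡ true → σ (dim B) ≡ true
      dims-shift-ℬ {B} p = trans (cong σ (sym (dim-act (inv g) B))) (dims-ℬ P p)

      meet : (∃ λ A → (𝒜 ⊓ᶠ shift g 𝒜) A ≡ true) → Pair ρ σ (𝒜 ⊓ᶠ shift g 𝒜) (ℬ ⊔ᶠ shift g ℬ)
      meet some = record
        { dims-𝒜 = λ p → dims-𝒜 P (proj₁ (∧-true p))
        ; dims-ℬ = λ r → [ dims-ℬ P , dims-shift-ℬ ]′ (∨-true r)
        ; cross  = λ p r → let p₁ , p₂ = ∧-true p in [ cross P p₁ , cross-shift p₂ ]′ (∨-true r)
        ; some-𝒜 = some
        ; some-ℬ = proj₁ (some-ℬ P) , ∨-trueˡ (proj₂ (some-ℬ P))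
        }

    join : ∀ {ρ σ 𝒜 ℬ} → Pair ρ σ 𝒜 ℬ → (g : Iso n n) → (∃ λ B → (ℬ ⊓ᶠ shift g ℬ) B ≡ true) →
           Pair ρ σ (𝒜 ⊔ᶠ shift g 𝒜) (ℬ ⊓ᶠ shift g ℬ)
    join P g some = swap (meet (swap P) g some)

    -- Submodularity: if a maximal pair and its image under g have a member of
    -- the smaller family in common, then their meet and join are maximal, too.
    module _ {ρ σ 𝒜 ℬ} (P : Pair ρ σ 𝒜 ℬ) (max : Maximal ρ σ 𝒜 ℬ) (𝒜≤ℬ : size 𝒜 ≤ size ℬ)
             (g : Iso n n) (some : ∃ λ A → (𝒜 ⊓ᶠ shift g 𝒜) A ≡ true) where

      private
        a b m j : ℕ
        a = size (𝒜 ⊓ᶠ shift g 𝒜)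
        b = size (ℬ ⊔ᶠ shift g ℬ)
        j = size (𝒜 ⊔ᶠ shift g 𝒜)
        m = size (ℬ ⊓ᶠ shift g ℬ)

        a+j : a ℕ.+ j ≡ size 𝒜 ℕ.+ size 𝒜
        a+j = trans (count-∧+∨ 𝒜 (shift g 𝒜) (allSub n)) (cong (size 𝒜 ℕ.+_) (size-shift g 𝒜))

        m+b : m ℕ.+ b ≡ size ℬ ℕ.+ size ℬ
        m+b = trans (count-∧+∨ ℬ (shift g ℬ) (allSub n)) (cong (size ℬ ℕ.+_) (size-shift g ℬ))

        a+b≤ : a ℕ.+ b ≤ size 𝒜 ℕ.+ size ℬ
        a+b≤ = max _ _ (meet P g some)

        0<a : 0 < a
        0<a = ∈⇒count>0 (allSub n) (∈allSub (proj₁ some)) (proj₂ some)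

        -- If ℬ and gℬ were disjoint, then b = 2 |ℬ| ≥ |𝒜| + |ℬ|, and a ≥ 1 would lift the meet
        -- above the maximum.
        0<m : 0 < m
        0<m = ℕ.≮⇒≥ λ { (s≤s m≤0) → ℕ.<⇒≱ (ℕ.+-monoʳ-< (size ℬ) (ℕ.≤-<-trans 𝒜≤ℬ
            (ℕ.m<n+m (size ℬ) 0<a)))
          (begin
            size ℬ ℕ.+ (a ℕ.+ size ℬ)   ≡⟨ ℕ.+-comm (size ℬ) _ ⟩
            a ℕ.+ size ℬ ℕ.+ size ℬ     ≡⟨ ℕ.+-assoc a _ _ ⟩
            a ℕ.+ (size ℬ ℕ.+ size ℬ)   ≡⟨ cong (a ℕ.+_) m+b ⟨
            a ℕ.+ (m ℕ.+ b)             ≤⟨ ℕ.+-monoʳ-≤ a (ℕ.+-monoˡ-≤ b m≤0) ⟩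
            a ℕ.+ b                     ≤⟨ a+b≤ ⟩
            size 𝒜 ℕ.+ size ℬ           ≡⟨ ℕ.+-comm (size 𝒜) _ ⟩
            size ℬ ℕ.+ size 𝒜           ∎) }
          where open ℕ.≤-Reasoning

      join-pair : Pair ρ σ (𝒜 ⊔ᶠ shift g 𝒜) (ℬ ⊓ᶠ shift g ℬ)
      join-pair = join P g (count>0⇒∃ (allSub n) 0<m)

      private
        j+m≤ : j ℕ.+ m ≤ size 𝒜 ℕ.+ size ℬ
        j+m≤ = max _ _ join-pair

        total : (a ℕ.+ b) ℕ.+ (j ℕ.+ m) ≡ (size 𝒜 ℕ.+ size ℬ) ℕ.+ (size 𝒜 ℕ.+ size ℬ)
        total = begin
          (a ℕ.+ b) ℕ.+ (j ℕ.+ m)  ≡⟨ solve′ 4 (λ a b j m → (a :+′ b) :+′ (j :+′ m) :=′ (a :+′ j) :+′ (m :+′ b)) refl a b j m ⟩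
          (a ℕ.+ j) ℕ.+ (m ℕ.+ b)  ≡⟨ cong₂ ℕ._+_ a+j m+b ⟩
          (size 𝒜 ℕ.+ size 𝒜) ℕ.+ (size ℬ ℕ.+ size ℬ) ≡⟨ solve′ 2 (λ x y → (x :+′ x) :+′ (y :+′ y) :=′ (x :+′ y) :+′ (x :+′ y)) refl (size 𝒜) (size ℬ) ⟩
          _ ∎
          where
          open ≡-Reasoning
          open import Data.Nat.Solver using (module +-*-Solver)
          open +-*-Solver using () renaming (solve to solve′; _:+_ to _:+′_; _:=_ to _:=′_)

      meet-maximal : Maximal ρ σ (𝒜 ⊓ᶠ shift g 𝒜) (ℬ ⊔ᶠ shift g ℬ)
      meet-maximal 𝒜′ ℬ′ P′ = ℕ.≤-trans (max 𝒜′ ℬ′ P′) (ℕ.+-cancelʳ-≤ (j ℕ.+ m) _ _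
        (ℕ.≤-trans (ℕ.+-monoʳ-≤ (size 𝒜 ℕ.+ size ℬ) j+m≤) (ℕ.≤-reflexive (sym total))))

      join-maximal : Maximal ρ σ (𝒜 ⊔ᶠ shift g 𝒜) (ℬ ⊓ᶠ shift g ℬ)
      join-maximal 𝒜′ ℬ′ P′ = ℕ.≤-trans (max 𝒜′ ℬ′ P′) (ℕ.+-cancelˡ-≤ (a ℕ.+ b) _ _
        (ℕ.≤-trans (ℕ.+-monoˡ-≤ (size 𝒜 ℕ.+ size ℬ) a+b≤) (ℕ.≤-reflexive (sym total))))

    module _ (0<t : 0 < t) {ρ σ : ℕ → Bool} (narrow : ∀ {k l} → ρ k ≡ true → σ l ≡ true → k ℕ.+ l < n ℕ.+ t) where

      -- If some transvection g moves 𝒜 to a different family that still meets it,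
      -- then 𝒜 ∩ g𝒜 is a singleton by minimality.  The pencil spanned by A₂ and
      -- gA₂ lies in 𝒜 ∪ g𝒜, and being fixed by g, it lies in 𝒜 ∩ g𝒜.
      maximal⇒singleton : ∀ k {𝒜 ℬ} → size 𝒜 < k → Pair ρ σ 𝒜 ℬ → Maximal ρ σ 𝒜 ℬ →
        size 𝒜 ≤ size ℬ → size 𝒜 ≤ 1
      maximal⇒singleton (suc k) {𝒜} {ℬ} (s≤s 𝒜≤k) P max 𝒜≤ℬ =
        subsingleton⇒count≤1 𝒜 (unique-allSub n)
          (transvectionClosed⇒unique {𝒜 = λ A → 𝒜 A ≡ true} closed B
            (λ A∈ → ℕ.≤-trans 0<t (cross P A∈ B∈))
            (λ A∈ → ℕ.<-≤-trans (narrow (dims-𝒜 P A∈) (dims-ℬ P B∈)) (ℕ.+-monoʳ-≤ n (cross P A∈ B∈))))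
        where
        B  = proj₁ (some-ℬ P)
        B∈ = proj₂ (some-ℬ P)
        closed : TransvectionClosed (λ A → 𝒜 A ≡ true)
        closed φ u φu≡0 {A₁} {A₂} A₁∈ A₂∈ gA₁ u∉A₂ x∈A₂ φx≡1 A₁≢pencil with 𝒜 (act (transvection φ u φu≡0) A₂) in gA₂∉
        ... | true  = refl
        ... | false = contradiction
          (count≤1⇒≡ _≟ₛ_ (𝒜 ⊓ᶠ shift g 𝒜) (allSub n) ∈allSub
            -- The induction hypothesis applies: 𝒜 ∩ g𝒜 is smaller than 𝒜 and ℬ ∪ gℬ contains ℬ, so
            -- the first family of the meet is still the smaller one.
            (maximal⇒singleton k (ℕ.<-≤-trans 𝒜∧<𝒜 𝒜≤k) (meet P g some) (meet-maximal P max 𝒜≤ℬ g some)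
              (ℕ.≤-trans (ℕ.<⇒≤ 𝒜∧<𝒜) (ℕ.≤-trans 𝒜≤ℬ (count-mono (allSub n) λ _ → ∨-trueˡ))))
            A₁∈∧ A₃∈∧) A₁≢pencil
          where
          g  = transvection φ u φu≡0
          A₃ = pencil φ u φu≡0 A₂
          A₁∈∧ : (𝒜 ⊓ᶠ shift g 𝒜) A₁ ≡ true
          A₁∈∧ = cong₂ _∧_ A₁∈ (trans (cong 𝒜 (trans (cong (act (inv g)) (sym gA₁)) (act-inv g A₁))) A₁∈)
          some : ∃ λ A → (𝒜 ⊓ᶠ shift g 𝒜) A ≡ true
          some = A₁ , A₁∈∧
          -- gA₂ lies in g𝒜 but not in 𝒜, so 𝒜 ∩ g𝒜 is properly contained in g𝒜, which is as large
          -- as 𝒜.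
          𝒜∧<𝒜 : size (𝒜 ⊓ᶠ shift g 𝒜) < size 𝒜
          𝒜∧<𝒜 = subst (size (𝒜 ⊓ᶠ shift g 𝒜) <_) (size-shift g 𝒜)
            (count-strict (allSub n) (λ _ h → proj₂ (∧-true h)) (∈allSub (act g A₂))
              (cong (_∧ shift g 𝒜 (act g A₂)) gA₂∉) (trans (cong 𝒜 (act-inv g A₂)) A₂∈))
          shift-A₃ : shift g 𝒜 A₃ ≡ 𝒜 A₃
          shift-A₃ = cong 𝒜 (trans (cong (act (inv g)) (sym (act-pencil φ u φu≡0 A₂))) (act-inv g A₃))
          A₃∈∨ : (𝒜 ⊔ᶠ shift g 𝒜) A₃ ≡ true
          A₃∈∨ = maximal⇒closed (join-pair P max 𝒜≤ℬ g some) (join-maximal P max 𝒜≤ℬ g some) A₃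
            (trans (cong ρ (dim-pencil φ u φu≡0 A₂ x∈A₂ φx≡1 u∉A₂)) (dims-𝒜 P A₂∈))
            λ {C} h → let C∈ , C∈g = ∧-true h in pencil-∩ φ u φu≡0 A₂ C u∉A₂ (cross P A₂∈ C∈)
              (cross-shift P g (trans (cong 𝒜 (act-inv g A₂)) A₂∈) C∈g)
          A₃∈ : 𝒜 A₃ ≡ true
          A₃∈ = [ id , trans (sym shift-A₃) ]′ (∨-true A₃∈∨)
          A₃∈∧ : (𝒜 ⊓ᶠ shift g 𝒜) A₃ ≡ true
          A₃∈∧ = cong₂ _∧_ A₃∈ (trans shift-A₃ A₃∈)

    star : (ℕ → Bool) → Sub n → Sub n → Bool
    star σ A B = σ (dim B) ∧ (t ≤ᵇ dim (A ∩ B))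

    -- The counterpart of `SingletonAndMeeting` for echelon forms.
    IsStar : ℕ → (ℕ → Bool) → (𝒜 ℬ : Sub n → Bool) → Set
    IsStar r σ 𝒜 ℬ = ∃ λ A → dim A ≡ r × (∀ C → 𝒜 C ≡ does (C ≟ₛ A)) × (∀ B → ℬ B ≡ star σ A B)

    size-singleton : ∀ {𝒜 A} → (∀ C → 𝒜 C ≡ does (C ≟ₛ A)) → size 𝒜 ≡ 1
    size-singleton {𝒜} {A} 𝒜≡ = ℕ.≤-antisym
      (subsingleton⇒count≤1 𝒜 (unique-allSub n) λ {x} {y} p r →
        trans (does⇒ (x ≟ₛ A) (trans (sym (𝒜≡ x)) p)) (sym (does⇒ (y ≟ₛ A) (trans (sym (𝒜≡ y)) r))))
      (∈⇒count>0 (allSub n) (∈allSub A) (trans (𝒜≡ A) (dec-true (A ≟ₛ A) refl)))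

    IsMaximum : (ℕ → Bool) → ℕ → Set
    IsMaximum ρ r = ρ r ≡ true × (∀ k → ρ k ≡ true → k ≤ r)

    -- A is a largest allowed subspace, because 𝒜 stays cross-intersecting with
    -- ℬ when a subspace containing A is added to it.
    maximal⇒star : ∀ {ρ σ r 𝒜 ℬ} → IsMaximum ρ r → r ≤ n → Pair ρ σ 𝒜 ℬ → Maximal ρ σ 𝒜 ℬ →
                   size 𝒜 ≤ 1 → IsStar r σ 𝒜 ℬ
    maximal⇒star {ρ} {σ} {r} {𝒜} {ℬ} (ρr , ≤r) r≤n P max 𝒜≤1 =
      A , dimA≡r , 𝒜≡ , λ B → iff⇒≡
        (λ B∈ → cong₂ _∧_ (dims-ℬ P B∈) (≤ᵇ-true (cross P A∈ B∈)))
        (λ h → let σB , t≤ = ∧-true h in maximal⇒closed (swap P) (swap-maximal max) B σB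
          λ {C} C∈ → subst (λ D → t ≤ dim D)
            (trans (cong (_∩ B) (unique A∈ C∈)) (∩-comm C B)) (true-≤ᵇ t≤))
      where
      A  = proj₁ (some-𝒜 P)
      A∈ = proj₂ (some-𝒜 P)
      unique : ∀ {C D} → 𝒜 C ≡ true → 𝒜 D ≡ true → C ≡ D
      unique = count≤1⇒≡ _≟ₛ_ 𝒜 (allSub n) ∈allSub 𝒜≤1
      𝒜≡ : ∀ C → 𝒜 C ≡ does (C ≟ₛ A)
      𝒜≡ C = iff⇒≡ (λ C∈ → dec-true (C ≟ₛ A) (unique C∈ A∈))
        (λ h → subst (λ D → 𝒜 D ≡ true) (sym (does⇒ (C ≟ₛ A) h)) A∈)
      larger = enlarge A (≤r (dim A) (dims-𝒜 P A∈)) r≤n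
      dimA≡r : dim A ≡ r
      dimA≡r with larger
      ... | A′ , A⊆A′ , dimA′≡r = trans (cong dim (unique A∈ (maximal⇒closed P max A′
          (trans (cong ρ dimA′≡r) ρr)
          λ {B} B∈ → ℕ.≤-trans (cross P A∈ B∈) (⊆⇒dim≤ {A = A ∩ B} {A′ ∩ B} λ x h →
            let x∈A , x∈B = ∈∩⁻ A B h in ∈∩⁺ A′ B (A⊆A′ x x∈A) x∈B))))
        dimA′≡r

    module _ (0<t : 0 < t) {ρ σ r s} (ρ-max : IsMaximum ρ r) (σ-max : IsMaximum σ s) (r≤n : r ≤ n) (s≤n : s ≤ n)
             (r+s<n+t : r ℕ.+ s < n ℕ.+ t) (f g : ℕ)
             (star-r : ∀ A → dim A ≡ r → size (star σ A) ≡ f) (star-s : ∀ B → dim B ≡ s → size (star ρ B) ≡ g) where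

      private
        narrow : ∀ {k l} → ρ k ≡ true → σ l ≡ true → k ℕ.+ l < n ℕ.+ t
        narrow ρk σl = ℕ.≤-<-trans (ℕ.+-mono-≤ (proj₂ ρ-max _ ρk) (proj₂ σ-max _ σl)) r+s<n+t

      maximal⇒star-or-star : ∀ {𝒜 ℬ} → Pair ρ σ 𝒜 ℬ → Maximal ρ σ 𝒜 ℬ → IsStar r σ 𝒜 ℬ ⊎ IsStar s ρ ℬ 𝒜
      maximal⇒star-or-star {𝒜} {ℬ} P max with ℕ.≤-total (size 𝒜) (size ℬ)
      ... | inj₁ 𝒜≤ℬ = inj₁ (maximal⇒star ρ-max r≤n P max
        (maximal⇒singleton 0<t narrow (suc (size 𝒜)) ℕ.≤-refl P max 𝒜≤ℬ))
      ... | inj₂ ℬ≤𝒜 = inj₂ (maximal⇒star σ-max s≤n (swap P) (swap-maximal max)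
        (maximal⇒singleton 0<t (λ {k} {l} σk ρl → subst (_< n ℕ.+ t) (ℕ.+-comm l k) (narrow ρl σk))
          (suc (size ℬ)) ℕ.≤-refl (swap P) (swap-maximal max) ℬ≤𝒜))

      star⇒size : ∀ {𝒜 ℬ} → IsStar r σ 𝒜 ℬ → size 𝒜 ℕ.+ size ℬ ≡ 1 ℕ.+ f
      star⇒size (A , dimA≡r , 𝒜≡ , ℬ≡) = cong₂ ℕ._+_ (size-singleton 𝒜≡)
        (trans (count-cong (allSub n) ℬ≡) (star-r A dimA≡r))

      star⇒size′ : ∀ {𝒜 ℬ} → IsStar s ρ ℬ 𝒜 → size 𝒜 ℕ.+ size ℬ ≡ 1 ℕ.+ g
      star⇒size′ {𝒜} {ℬ} (B , dimB≡s , ℬ≡ , 𝒜≡) = trans (ℕ.+-comm (size 𝒜) _) (cong₂ ℕ._+_ (size-singleton ℬ≡)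
        (trans (count-cong (allSub n) 𝒜≡) (star-s B dimB≡s)))

      -- Maximal pairs are stars, so a pair above the bound is not maximal and a still larger pair
      -- exists. Sizes never exceed 2 N for the number N of subspaces, and d bounds the room that is
      -- left.
      size≤bound : ∀ {𝒜 ℬ} → Pair ρ σ 𝒜 ℬ → size 𝒜 ℕ.+ size ℬ ≤ (1 ℕ.+ f) ℕ.⊔ (1 ℕ.+ g)
      size≤bound P = ℕ.≮⇒≥ λ large → go (suc (N ℕ.+ N)) P large
          (ℕ.<-≤-trans (ℕ.n<1+n _) (ℕ.m≤n+m _ _))
        where
        N = length (allSub n)
        go : ∀ d {𝒜 ℬ} → Pair ρ σ 𝒜 ℬ → (1 ℕ.+ f) ℕ.⊔ (1 ℕ.+ g) < size 𝒜 ℕ.+ size ℬ →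
             N ℕ.+ N < size 𝒜 ℕ.+ size ℬ ℕ.+ d → ⊥
        go zero    {𝒜} {ℬ} P large fuel = ℕ.<⇒≱ fuel (ℕ.≤-trans (ℕ.≤-reflexive (ℕ.+-identityʳ _))
          (ℕ.+-mono-≤ (count≤length 𝒜 (allSub n)) (count≤length ℬ (allSub n))))
        go (suc d) {𝒜} {ℬ} P large fuel = [ (λ h → ℕ.<⇒≱ large (ℕ.≤-trans (ℕ.≤-reflexive (star⇒size h)) (ℕ.m≤m⊔n (1 ℕ.+ f) (1 ℕ.+ g))))
                                          , (λ h → ℕ.<⇒≱ large (ℕ.≤-trans (ℕ.≤-reflexive (star⇒size′ h)) (ℕ.m≤n⊔m (1 ℕ.+ f) (1 ℕ.+ g)))) ]′
          (maximal⇒star-or-star P λ 𝒜′ ℬ′ P′ → ℕ.≮⇒≥ λ lt → go d P′ (ℕ.<-trans large lt)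
            (ℕ.<-≤-trans fuel (ℕ.≤-trans (ℕ.≤-reflexive (ℕ.+-suc _ d)) (ℕ.+-monoˡ-≤ d lt))))

      -- By `size≤bound`, a pair that attains the bound is maximal.
      size≡bound⇒star : ∀ {𝒜 ℬ} → Pair ρ σ 𝒜 ℬ → size 𝒜 ℕ.+ size ℬ ≡ (1 ℕ.+ f) ℕ.⊔ (1 ℕ.+ g) →
                        IsStar r σ 𝒜 ℬ ⊎ IsStar s ρ ℬ 𝒜
      size≡bound⇒star P eq = maximal⇒star-or-star P λ 𝒜′ ℬ′ P′ →
        ℕ.≤-trans (size≤bound P′) (ℕ.≤-reflexive (sym eq))

-- The q-Pascal recursion and the summands of the bound.

module GaussianProperties (q : ℕ) .{{_ : NonTrivial q}} where
  open import Data.Nat.Base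
  open import Data.Nat.Properties
  open Gaussian q

  private instance
    q-nonZero : NonZero q
    q-nonZero = nonTrivial⇒nonZero q

  fallingProduct-suc : ∀ m k → fallingProduct m (suc k) ≡ fallingProduct m k * (q ^ (m ∸ k) ∸ 1)
  fallingProduct-suc m       zero    = *-comm (q ^ m ∸ 1) 1
  fallingProduct-suc zero    (suc k) = refl
  fallingProduct-suc (suc m) (suc k) = trans
    (cong ((q ^ suc m ∸ 1) *_) (fallingProduct-suc m k))
    (sym (*-assoc (q ^ suc m ∸ 1) (fallingProduct m k) _))

  fallingProduct-zero : ∀ {m k} → m < k → fallingProduct m k ≡ 0
  fallingProduct-zero {zero}  {suc k} _         = refl
  fallingProduct-zero {suc m} {suc k} (s≤s m<k) = trans
    (cong ((q ^ suc m ∸ 1) *_) (fallingProduct-zero m<k)) (*-zeroʳ (q ^ suc m ∸ 1))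

  -- The denominator is nonzero and divides exactly, so values of Gaussian coefficients can be
  -- checked on products.
  gauss-unique : ∀ m k g → g * fallingProduct k k ≡ fallingProduct m k → gauss m k ≡ g
  gauss-unique m k g eq = *-cancelʳ-≡ _ _ (fallingProduct k k) {{fallingProduct-nonZero k}}
    (trans (gauss-exact m k) (sym eq))

  gauss-zeroʳ : ∀ m → gauss m 0 ≡ 1
  gauss-zeroʳ m = gauss-unique m 0 1 refl

  gauss-< : ∀ {m k} → m < k → gauss m k ≡ 0
  gauss-< {m} {k} m<k = gauss-unique m k 0 (sym (fallingProduct-zero m<k))

  private
    pred-^ : ∀ e → ∃ λ p → q ^ e ≡ suc p × q ^ e ∸ 1 ≡ p
    pred-^ e with q ^ e | m^n>0 q e
    ... | suc p | _ = p , refl , refl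

  -- q^(m+1) − 1 = (q^(m−k) − 1) + q^(m−k) (q^(k+1) − 1)
  gauss-pascal : ∀ m k → gauss (suc m) (suc k) ≡ gauss m (suc k) + q ^ (m ∸ k) * gauss m k
  gauss-pascal m k with k ≤? m
  ... | no  k≰m = trans (gauss-< (s≤s (≰⇒> k≰m))) (sym (cong₂ _+_
    (gauss-< (m<n⇒m<1+n (≰⇒> k≰m))) (trans (cong (q ^ (m ∸ k) *_) (gauss-< (≰⇒> k≰m))) (*-zeroʳ (q ^ (m ∸ k))))))
  ... | yes k≤m = gauss-unique (suc m) (suc k) _ (begin
    (gauss m (suc k) + x * gauss m k) * (y * D)
      ≡⟨ solve 5 (λ g x h y d → (g :+ x :* h) :* (y :* d) := g :* (y :* d) :+ x :* y :* (h :* d)) refl (gauss m (suc k)) x (gauss m k) y D ⟩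
    gauss m (suc k) * (y * D) + x * y * (gauss m k * D)
      ≡⟨ cong₂ (λ a b → a + x * y * b) (trans (gauss-exact m (suc k)) (fallingProduct-suc m k)) (gauss-exact m k) ⟩
    F * (x ∸ 1) + x * y * F
      ≡⟨ solve 3 (λ a f b → f :* a :+ b :* f := (a :+ b) :* f) refl (x ∸ 1) F (x * y) ⟩
    ((x ∸ 1) + x * y) * F
      ≡⟨ cong (_* F) (sym split) ⟩
    (q ^ suc m ∸ 1) * F ∎)
    where
    open ≡-Reasoning
    open +-*-Solver
    x = q ^ (m ∸ k)
    y = q ^ suc k ∸ 1
    D = fallingProduct k k
    F = fallingProduct m k
    split : q ^ suc m ∸ 1 ≡ (x ∸ 1) + x * y
    split with pred-^ (m ∸ k) | pred-^ (suc k)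
    ... | a , x≡ , x∸1≡ | b , y≡ , y∸1≡ = begin
      q ^ suc m ∸ 1                 ≡⟨ cong (λ e → q ^ e ∸ 1) (sym (trans (+-suc (m ∸ k) k) (cong suc (m∸n+n≡m k≤m)))) ⟩
      q ^ (m ∸ k + suc k) ∸ 1       ≡⟨ cong (_∸ 1) (^-distribˡ-+-* q (m ∸ k) (suc k)) ⟩
      x * q ^ suc k ∸ 1             ≡⟨ cong₂ (λ u v → u * v ∸ 1) x≡ y≡ ⟩
      suc a * suc b ∸ 1             ≡⟨ solve 2 (λ a b → b :+ a :* (con 1 :+ b) := a :+ (con 1 :+ a) :* b) refl a b ⟩
      a + suc a * b                 ≡⟨ cong₂ _+_ (sym x∸1≡) (cong₂ _*_ (sym x≡) (sym y∸1≡)) ⟩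
      (x ∸ 1) + x * y               ∎

  -- For j ≤ i, the number of i-dimensional subspaces of K^n that meet a fixed r-dimensional one in
  -- dimension exactly j; see `size-dims`.
  meetingTerm : ℕ → ℕ → ℕ → ℕ → ℕ
  meetingTerm n r i j = q ^ ((r ∸ j) * (i ∸ j)) * gauss r j * gauss (n ∸ r) (i ∸ j)

  -- The same with intersections of dimension at least t; see `size-meeting`.
  meeting : ℕ → ℕ → ℕ → ℕ → ℕ
  meeting n t r i = sumFromTo t i (meetingTerm n r i)

-- Counting subspaces by dimension and by intersection with a coordinate subspace.

module Enumeration {q : ℕ} .{{_ : NonTrivial q}} (𝔽 : FiniteField q) where
  open import Data.List.Base using (List; []; _∷_; concatMap; length; allFin)
  open import Data.Nat.Base using (zero; suc; _≤_; _<_; s≤s; z≤n; _≡ᵇ_; _∸_; _^_)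
  open import Data.Vec.Base using (Vec; []; _∷_; _++_)
  open Counting
  open Subspaces 𝔽 hiding (solve; _:+_; _:*_; _:=_; :-_; con)
  open Dimension 𝔽
  open Constructions 𝔽
  open Transvections 𝔽
  open Families 𝔽
  open Gaussian q
  open GaussianProperties q
  open Linear

  length-allVec : ∀ n → length (allVec n) ≡ q ^ n
  length-allVec zero    = refl
  length-allVec (suc n) = trans (go (allFin q)) (cong₂ ℕ._*_ (List.length-tabulate {n = q} id) (length-allVec n))
    where
    go : ∀ xs → length (concatMap (λ x → List.map (x ∷_) (allVec n)) xs) ≡ length xs ℕ.* length (allVec n)
    go []       = refl
    go (x ∷ xs) = trans (List.length-++ (List.map (x ∷_) (allVec n)))
      (cong₂ ℕ._+_ (List.length-map (x ∷_) (allVec n)) (go xs))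

  -- Each W extends to one `skip W` and to q^(codim W) forms `lead W w`. In the uses below `P₁`
  -- prescribes the dimension of W or is empty, hence the single exponent c.
  size-suc : ∀ {n} (P : Sub (suc n) → Bool) (P₀ P₁ : Sub n → Bool) c →
    (∀ W → P (skip W) ≡ P₀ W) → (∀ W w → P (lead W w) ≡ P₁ W) → (∀ W → P₁ W ≡ true → codim W ≡ c) →
    size P ≡ size P₀ ℕ.+ q ^ c ℕ.* size P₁
  size-suc {n} P P₀ P₁ c P≡₀ P≡₁ codim≡ = trans (count-++ P (List.map skip (allSub n)) _) (cong₂ ℕ._+_
    (trans (count-map P skip (allSub n)) (count-cong (allSub n) P≡₀)) (go (allSub n)))
    where
    leads-count : ∀ W b → P₁ W ≡ b → count P (leads W) ≡ q ^ c ℕ.* indicator b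
    leads-count W b eq = trans (count-map P (lead W) (allVec (codim W)))
      (trans (count-cong (allVec (codim W)) (λ w → trans (P≡₁ W w) eq)) (constant b eq))
      where
      constant : ∀ b → P₁ W ≡ b → count (const b) (allVec (codim W)) ≡ q ^ c ℕ.* indicator b
      constant true  eq = trans (count-true (allVec (codim W))) (trans (length-allVec (codim W))
        (trans (cong (q ^_) (codim≡ W eq)) (sym (ℕ.*-identityʳ _))))
      constant false eq = trans (count-false (allVec (codim W))) (sym (ℕ.*-zeroʳ (q ^ c)))
    go : ∀ Ws → count P (concatMap leads Ws) ≡ q ^ c ℕ.* count P₁ Ws
    go []       = sym (ℕ.*-zeroʳ (q ^ c))
    go (W ∷ Ws) = trans (count-++ P (leads W) (concatMap leads Ws))
      (trans (cong₂ ℕ._+_ (leads-count W _ refl) (go Ws)) (sym (ℕ.*-distribˡ-+ (q ^ c) (indicator (P₁ W)) _)))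

  codim≡ : ∀ {n i} (W : Sub n) → dim W ≡ i → codim W ≡ n ∸ i
  codim≡ {n} W refl = trans (sym (ℕ.m+n∸n≡m (codim W) (dim W))) (cong (_∸ dim W) (codim+dim W))

  size-empty : ∀ {n} (P : Sub n → Bool) → (∀ W → P W ≡ false) → size P ≡ 0
  size-empty {n} P P≡ = trans (count-cong (allSub n) P≡) (count-false (allSub n))

  -- Splitting off the first coordinate is the q-Pascal recursion, with n - i as the codimension of
  -- W in `lead W w`.
  size-dim : ∀ n i → size {n} (λ W → dim W ≡ᵇ i) ≡ gauss n i
  size-dim zero    zero    = sym (gauss-zeroʳ 0)
  size-dim zero    (suc i) = sym (gauss-< {0} {suc i} (s≤s z≤n))
  size-dim (suc n) zero    = trans
    (size-suc {n} (λ W → dim W ≡ᵇ 0) (λ W → dim W ≡ᵇ 0) (const false) 0 (λ _ → refl) (λ _ _ → refl) λ _ ())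
    (trans (cong₂ ℕ._+_ (size-dim n 0) (trans (ℕ.*-identityˡ (size {n} (const false))) (size-empty {n} _ λ _ → refl)))
      (trans (ℕ.+-identityʳ _) (trans (gauss-zeroʳ n) (sym (gauss-zeroʳ (suc n))))))
  size-dim (suc n) (suc i) = trans
    (size-suc (λ W → dim W ≡ᵇ suc i) (λ W → dim W ≡ᵇ suc i) (λ W → dim W ≡ᵇ i) (n ∸ i)
      (λ _ → refl) (λ _ _ → refl) λ W h → codim≡ W (does⇒ (dim W ℕ.≟ i) h))
    (trans (cong₂ (λ a b → a ℕ.+ q ^ (n ∸ i) ℕ.* b) (size-dim n (suc i)) (size-dim n i)) (sym (gauss-pascal n i)))

  full : ∀ k → Sub k
  full zero    = nil
  full (suc k) = lead (full k) 0ᵛ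

  ∈full : ∀ {k} (x : Vec K k) → x ∈ full k
  ∈full []       = refl
  ∈full (x ∷ xs) = trans (cong (_+ᵛ (- x) *ᵛ 0ᵛ) (∈full xs))
    (trans (+ᵛ-identityˡ _) (*ᵛ0ᵛ _ (- x)))

  dim-full : ∀ k → dim (full k) ≡ k
  dim-full zero    = refl
  dim-full (suc k) = cong suc (dim-full k)

  -- The span of the last k unit vectors. The zero coordinates come first, so induction on m removes
  -- one `skip` at a time.
  std : ∀ m k → Sub (m ℕ.+ k)
  std zero    k = full k
  std (suc m) k = skip (std m k)

  dim-std : ∀ m k → dim (std m k) ≡ k
  dim-std zero    k = dim-full k
  dim-std (suc m) k = dim-std m k

  ∈std : ∀ m {k} (x : Vec K k) → 0ᵛ {m} ++ x ∈ std m k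
  ∈std zero    x = ∈full x
  ∈std (suc m) x = cong (0# ∷_) (∈std m x)

  dim-skip-∩-skip : ∀ {n} (A B : Sub n) → dim (skip A ∩ skip B) ≡ dim (A ∩ B)
  dim-skip-∩-skip A B = cong dim (⊆-antisym {A = skip A ∩ skip B} {skip (A ∩ B)}
    (λ { (x ∷ xs) h → let p , r = ∈∩⁻ (skip A) (skip B) h in
      cong₂ _∷_ (Vec.∷-injectiveˡ p) (∈∩⁺ A B (Vec.∷-injectiveʳ p) (Vec.∷-injectiveʳ r)) })
    (λ { (x ∷ xs) h → let p , r = ∈∩⁻ A B (Vec.∷-injectiveʳ h); x≡0 = Vec.∷-injectiveˡ h in
      ∈∩⁺ (skip A) (skip B) (cong₂ _∷_ x≡0 p) (cong₂ _∷_ x≡0 r) }))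

  -- Vectors of `skip A` have head 0, and the vectors of `lead B w` with head 0 form 0 × B. So w has
  -- no influence on the intersection.
  dim-skip-∩-lead : ∀ {n} (A B : Sub n) w → dim (skip A ∩ lead B w) ≡ dim (A ∩ B)
  dim-skip-∩-lead A B w = cong dim (⊆-antisym {A = skip A ∩ lead B w} {skip (A ∩ B)}
    (λ { (x ∷ xs) h → let p , r = ∈∩⁻ (skip A) (lead B w) h; x≡0 = Vec.∷-injectiveˡ p in
      cong₂ _∷_ x≡0 (∈∩⁺ A B (Vec.∷-injectiveʳ p)
        (0∷∈lead B w xs (subst (λ z → (z ∷ xs) ∈ lead B w) x≡0 r))) })
    (λ { (x ∷ xs) h → let p , r = ∈∩⁻ A B (Vec.∷-injectiveʳ h); x≡0 = Vec.∷-injectiveˡ h in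
      ∈∩⁺ (skip A) (lead B w) (cong₂ _∷_ x≡0 p)
        (subst (λ z → (z ∷ xs) ∈ lead B w) (sym x≡0) (∈⇒0∷∈lead B w xs r)) }))

  dims : ∀ {n} → Sub n → ℕ → ℕ → Sub n → Bool
  dims A i j B = (dim B ≡ᵇ i) ∧ (dim (A ∩ B) ≡ᵇ j)

  dims-true : ∀ {n} {A : Sub n} {i j} B → dims A i j B ≡ true → dim B ≡ i × dim (A ∩ B) ≡ j
  dims-true {A = A} {i} {j} B h = let p , r = ∧-true h in does⇒ (dim B ℕ.≟ i) p , does⇒ (dim (A ∩ B) ℕ.≟ j) r

  ∩⊆ʳ : ∀ {n} (A B : Sub n) → dim (A ∩ B) ≤ dim B
  ∩⊆ʳ A B = ⊆⇒dim≤ {A = A ∩ B} {B} λ x h → proj₂ (∈∩⁻ A B h)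

  size-dims-> : ∀ {n} (A : Sub n) {i j} → i < j → size (dims A i j) ≡ 0
  size-dims-> A {i} {j} i<j = size-empty (dims A i j) λ B → false-of B (dims A i j B) refl
    where
    false-of : ∀ B b → dims A i j B ≡ b → b ≡ false
    false-of B false _ = refl
    false-of B true  h with dims-true {A = A} {i} {j} B h
    ... | refl , refl = contradiction (∩⊆ʳ A B) (ℕ.<⇒≱ i<j)

  size-dims-skip-zero : ∀ {n} (A : Sub n) j → size (dims (skip A) 0 j) ≡ size (dims A 0 j)
  size-dims-skip-zero {n} A j = trans
    (size-suc (dims (skip A) 0 j) (dims A 0 j) (const false) 0
      (λ W → cong (λ d → (dim W ≡ᵇ 0) ∧ (d ≡ᵇ j)) (dim-skip-∩-skip A W)) (λ _ _ → refl) λ _ ())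
    (trans (cong (size (dims A 0 j) ℕ.+_) (trans (ℕ.*-identityˡ (size {n} (const false))) (size-empty {n} _ λ _ → refl)))
      (ℕ.+-identityʳ _))

  size-dims-skip-suc : ∀ {n} (A : Sub n) i j →
    size (dims (skip A) (suc i) j) ≡ size (dims A (suc i) j) ℕ.+ q ^ (n ∸ i) ℕ.* size (dims A i j)
  size-dims-skip-suc {n} A i j = size-suc (dims (skip A) (suc i) j) (dims A (suc i) j) (dims A i j) (n ∸ i)
    (λ W → cong (λ d → (dim W ≡ᵇ suc i) ∧ (d ≡ᵇ j)) (dim-skip-∩-skip A W))
    (λ W w → cong (λ d → (dim W ≡ᵇ i) ∧ (d ≡ᵇ j)) (dim-skip-∩-lead A W w))
    λ W h → codim≡ W (proj₁ (dims-true {A = A} W h))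

  size-dims-full : ∀ k i j → size (dims (full k) i j) ≡ size {k} (λ B → (dim B ≡ᵇ i) ∧ (dim B ≡ᵇ j))
  size-dims-full k i j = count-cong (allSub k) λ B → cong (λ d → (dim B ≡ᵇ i) ∧ (d ≡ᵇ j))
    (ℕ.≤-antisym (∩⊆ʳ (full k) B) (⊆⇒dim≤ {A = B} {full k ∩ B} λ x x∈B → ∈∩⁺ (full k) B (∈full x) x∈B))

  -- The dimension is written l + j to avoid a subtraction. In the induction on m, the recursion for
  -- `skip` becomes the q-Pascal recursion of `gauss m l`: m + k - (l + j) = (k - j) + (m - l), and
  -- the part k - j turns the exponent (k - j) l into (k - j) (l + 1).
  size-dims-std : ∀ m k l j → size (dims (std m k) (l ℕ.+ j) j) ≡ q ^ ((k ∸ j) ℕ.* l) ℕ.* gauss k j ℕ.* gauss m l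
  size-dims-std zero k zero j = trans (size-dims-full k j j)
    (trans (count-cong (allSub k) (λ B → Bool.∧-idem (dim B ≡ᵇ j))) (trans (size-dim k j) (begin
      gauss k j                                            ≡⟨ ℕ.*-identityˡ _ ⟨
      1 ℕ.* gauss k j                                      ≡⟨ ℕ.*-identityʳ _ ⟨
      1 ℕ.* gauss k j ℕ.* 1                                ≡⟨ cong₂ (λ a b → q ^ a ℕ.* gauss k j ℕ.* b) (ℕ.*-zeroʳ (k ∸ j)) (gauss-zeroʳ 0) ⟨
      q ^ ((k ∸ j) ℕ.* 0) ℕ.* gauss k j ℕ.* gauss 0 0 ∎)))
    where open ≡-Reasoning
  size-dims-std zero k (suc l) j = trans (size-dims-full k (suc l ℕ.+ j) j)
    (trans (size-empty {k} _ λ B → false-of B _ refl) (sym (trans (cong (q ^ ((k ∸ j) ℕ.* suc l) ℕ.* gauss k j ℕ.*_) (gauss-< {0} {suc l} (s≤s z≤n))) (ℕ.*-zeroʳ (q ^ ((k ∸ j) ℕ.* suc l) ℕ.* gauss k j)))))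
    where
    false-of : ∀ (B : Sub k) b → (dim B ≡ᵇ suc l ℕ.+ j) ∧ (dim B ≡ᵇ j) ≡ b → b ≡ false
    false-of B false _ = refl
    false-of B true  h with ∧-true h
    ... | p , r = contradiction (trans (sym (does⇒ (dim B ℕ.≟ suc l ℕ.+ j) p)) (does⇒ (dim B ℕ.≟ j) r))
                                (ℕ.m+1+n≢n l ∘ trans (ℕ.+-suc l j))
  size-dims-std (suc m) k zero zero = trans (size-dims-skip-zero (std m k) 0)
    (trans (size-dims-std m k 0 0) (cong (q ^ (k ℕ.* 0) ℕ.* gauss k 0 ℕ.*_) (trans (gauss-zeroʳ m) (sym (gauss-zeroʳ (suc m))))))
  size-dims-std (suc m) k zero (suc j) = trans (size-dims-skip-suc (std m k) j (suc j))
    (trans (cong₂ (λ a b → a ℕ.+ q ^ (m ℕ.+ k ∸ j) ℕ.* b) (size-dims-std m k 0 (suc j)) (size-dims-> (std m k) ℕ.≤-refl))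
      (trans (trans (cong (q ^ ((k ∸ suc j) ℕ.* 0) ℕ.* gauss k (suc j) ℕ.* gauss m 0 ℕ.+_) (ℕ.*-zeroʳ (q ^ (m ℕ.+ k ∸ j)))) (ℕ.+-identityʳ _))
        (cong (q ^ ((k ∸ suc j) ℕ.* 0) ℕ.* gauss k (suc j) ℕ.*_) (trans (gauss-zeroʳ m) (sym (gauss-zeroʳ (suc m)))))))
  size-dims-std (suc m) k (suc l) j = trans (size-dims-skip-suc (std m k) (l ℕ.+ j) j)
    (trans (cong₂ (λ a b → a ℕ.+ q ^ (m ℕ.+ k ∸ (l ℕ.+ j)) ℕ.* b) (size-dims-std m k (suc l) j) (size-dims-std m k l j))
      (trans (exponents (k ℕ.<? j) (m ℕ.<? l)) (cong (q ^ (e ℕ.* suc l) ℕ.* G ℕ.*_) (sym (gauss-pascal m l)))))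
    where
    e = k ∸ j
    G = gauss k j
    H = gauss m l
    X = q ^ (e ℕ.* suc l) ℕ.* G ℕ.* gauss m (suc l)
    exponents : Dec (k < j) → Dec (m < l) →
      X ℕ.+ q ^ (m ℕ.+ k ∸ (l ℕ.+ j)) ℕ.* (q ^ (e ℕ.* l) ℕ.* G ℕ.* H) ≡
      q ^ (e ℕ.* suc l) ℕ.* G ℕ.* (gauss m (suc l) ℕ.+ q ^ (m ∸ l) ℕ.* H)
    -- For k < j or m < l truncated subtraction spoils the identity of exponents, but the products
    -- in question contain a Gaussian coefficient that is 0.
    exponents (yes k<j) _ rewrite gauss-< k<j = solve 6
      (λ a b c d f g → a :* con 0 :* b :+ c :* (d :* con 0 :* f) := a :* con 0 :* (b :+ g :* f)) refl
      (q ^ (e ℕ.* suc l)) (gauss m (suc l)) (q ^ (m ℕ.+ k ∸ (l ℕ.+ j))) (q ^ (e ℕ.* l)) H (q ^ (m ∸ l))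
      where open +-*-Solver
    exponents (no _) (yes m<l) rewrite gauss-< m<l = solve 6
      (λ a b c d f g → a :* b :* c :+ d :* (f :* b :* con 0) := a :* b :* (c :+ g :* con 0)) refl
      (q ^ (e ℕ.* suc l)) G (gauss m (suc l)) (q ^ (m ℕ.+ k ∸ (l ℕ.+ j))) (q ^ (e ℕ.* l)) (q ^ (m ∸ l))
      where open +-*-Solver
    exponents (no k≮j) (no m≮l) = begin
      X ℕ.+ q ^ (m ℕ.+ k ∸ (l ℕ.+ j)) ℕ.* (q ^ (e ℕ.* l) ℕ.* G ℕ.* H)
        ≡⟨ cong (λ d → X ℕ.+ q ^ d ℕ.* (q ^ (e ℕ.* l) ℕ.* G ℕ.* H)) exponent ⟩
      X ℕ.+ q ^ (e ℕ.+ (m ∸ l)) ℕ.* (q ^ (e ℕ.* l) ℕ.* G ℕ.* H)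
        ≡⟨ cong₂ (λ a b → a ℕ.* G ℕ.* gauss m (suc l) ℕ.+ b ℕ.* (q ^ (e ℕ.* l) ℕ.* G ℕ.* H)) qel (ℕ.^-distribˡ-+-* q e (m ∸ l)) ⟩
      q ^ e ℕ.* q ^ (e ℕ.* l) ℕ.* G ℕ.* gauss m (suc l) ℕ.+ q ^ e ℕ.* q ^ (m ∸ l) ℕ.* (q ^ (e ℕ.* l) ℕ.* G ℕ.* H)
        ≡⟨ solve 6 (λ a b g c d h → a :* b :* g :* c :+ a :* d :* (b :* g :* h) := a :* b :* g :* (c :+ d :* h)) refl
             (q ^ e) (q ^ (e ℕ.* l)) G (gauss m (suc l)) (q ^ (m ∸ l)) H ⟩
      q ^ e ℕ.* q ^ (e ℕ.* l) ℕ.* G ℕ.* (gauss m (suc l) ℕ.+ q ^ (m ∸ l) ℕ.* H)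
        ≡⟨ cong (λ a → a ℕ.* G ℕ.* (gauss m (suc l) ℕ.+ q ^ (m ∸ l) ℕ.* H)) (sym qel) ⟩
      q ^ (e ℕ.* suc l) ℕ.* G ℕ.* (gauss m (suc l) ℕ.+ q ^ (m ∸ l) ℕ.* H) ∎
      where
      open ≡-Reasoning
      open +-*-Solver
      qel : q ^ (e ℕ.* suc l) ≡ q ^ e ℕ.* q ^ (e ℕ.* l)
      qel = trans (cong (q ^_) (ℕ.*-suc e l)) (ℕ.^-distribˡ-+-* q e (e ℕ.* l))
      j≤k = ℕ.≮⇒≥ k≮j
      l≤m = ℕ.≮⇒≥ m≮l
      exponent : m ℕ.+ k ∸ (l ℕ.+ j) ≡ e ℕ.+ (m ∸ l)
      exponent = trans (cong (_∸ (l ℕ.+ j)) (begin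
        m ℕ.+ k                                    ≡⟨ cong₂ ℕ._+_ (sym (ℕ.m∸n+n≡m l≤m)) (sym (ℕ.m∸n+n≡m j≤k)) ⟩
        (m ∸ l ℕ.+ l) ℕ.+ (e ℕ.+ j)                ≡⟨ solve 4 (λ a l e j → (a :+ l) :+ (e :+ j) := (e :+ a) :+ (l :+ j)) refl (m ∸ l) l e j ⟩
        e ℕ.+ (m ∸ l) ℕ.+ (l ℕ.+ j)                ∎)) (ℕ.m+n∸n≡m _ (l ℕ.+ j))

  size-dims-act : ∀ {m n} (g : Iso m n) A i j → size (dims (act g A) i j) ≡ size (dims A i j)
  size-dims-act {m} {n} g A i j = ℕ.≤-antisym
    (count-injective _≟ₛ_ (act (inv g)) (dims (act g A) i j) (dims A i j) (allSub m) (unique-allSub n)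
      (λ B h → trans (cong₂ (λ c d → (c ≡ᵇ i) ∧ (d ≡ᵇ j)) (dim-act (inv g) B)
        (trans (cong (λ D → dim (D ∩ act (inv g) B)) (sym (act-inv g A))) (dim-act-∩ (inv g) (act g A) B))) h)
      ∈allSub λ _ _ → act-injective (inv g))
    (count-injective _≟ₛ_ (act g) (dims A i j) (dims (act g A) i j) (allSub n) (unique-allSub m)
      (λ B h → trans (cong₂ (λ c d → (c ≡ᵇ i) ∧ (d ≡ᵇ j)) (dim-act g B) (dim-act-∩ g A B)) h)
      ∈allSub λ _ _ → act-injective g)

-- Subsets of [n] as lists and as Boolean predicates.

module SubsetElements where
  open import Data.Fin.Subset.Properties using () renaming (_∈?_ to _∈ˢ?_)
  open import Data.List.Base using (List; _∷_; allFin; filter; applyUpTo)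
  open import Data.Nat.Base using (zero; suc; _<_; s≤s; z≤n)
  open import Data.Vec.Base using (_∷_)
  open Counting

  applyUpTo-cong : ∀ {A : Set} {f g : ℕ → A} n → (∀ i → i < n → f i ≡ g i) → applyUpTo f n ≡ applyUpTo g n
  applyUpTo-cong zero    h = refl
  applyUpTo-cong (suc n) h = cong₂ _∷_ (h 0 (s≤s z≤n)) (applyUpTo-cong n λ i i<n → h (suc i) (s≤s i<n))

  elements : ∀ {n} → Subset n → List ℕ
  elements {n} M = List.map value (filter (_∈ˢ? M) (allFin n))

  value-injective : ∀ {n} {i j : Fin n} → value i ≡ value j → i ≡ j
  value-injective eq = Fin.toℕ-injective (ℕ.suc-injective eq)

  unique-elements : ∀ {n} (M : Subset n) → Unique (elements M)
  unique-elements {n} M = Unique.map⁺ value-injective (Unique.filter⁺ (_∈ˢ? M) (Unique.allFin⁺ n))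

  infix 4 _∈ᵇ_
  _∈ᵇ_ : ∀ {n} → ℕ → Subset n → Bool
  k ∈ᵇ M = elem k (elements M)

  ∈ᵇ⇒∈ₙ : ∀ {n} {M : Subset n} {k} → (k ∈ᵇ M) ≡ true → k ∈ₙ M
  ∈ᵇ⇒∈ₙ {M = M} h with ∈-map⁻ value (elem⇒∈ (elements M) h)
  ... | i , i∈ , k≡ = i , proj₂ (∈-filter⁻ (_∈ˢ? M) {xs = allFin _} i∈) , sym k≡

  ∈ₙ⇒∈ᵇ : ∀ {n} {M : Subset n} {k} → k ∈ₙ M → (k ∈ᵇ M) ≡ true
  ∈ₙ⇒∈ᵇ {M = M} (i , i∈ , refl) = ∈⇒elem (∈-map⁺ value (∈-filter⁺ (_∈ˢ? M) (∈-allFin i) i∈))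

-- The size of a star.

module StarSize {q : ℕ} .{{_ : NonTrivial q}} (𝔽 : FiniteField q) where
  open import Data.Fin.Subset.Properties using () renaming (_∈?_ to _∈ˢ?_)
  open import Data.List.Base using (List; allFin; filter; applyUpTo)
  open import Data.Nat.Base using (suc; _≤_; _<_; s≤s; _≤ᵇ_; _≡ᵇ_; _∸_; _^_)
  open import Data.Nat.ListAction using (sum)
  open import Data.Vec.Base using (Vec; _++_; take; drop)
  open Counting
  open SubsetElements
  open Subspaces 𝔽
  open Dimension 𝔽
  open Constructions 𝔽
  open Transvections 𝔽
  open Families 𝔽
  open Enumeration 𝔽
  open Gaussian q
  open GaussianProperties q
  open Linear
  open Iso

  take-++ : ∀ {m n} (x : Vec K m) (y : Vec K n) → take m (x ++ y) ≡ x
  take-++ {m} x y = Vec.++-injectiveˡ (take m (x ++ y)) x (Vec.take++drop≡id m (x ++ y))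

  drop-++ : ∀ {m n} (x : Vec K m) (y : Vec K n) → drop m (x ++ y) ≡ y
  drop-++ {m} x y = Vec.++-injectiveʳ (take m (x ++ y)) x (Vec.take++drop≡id m (x ++ y))

  inverse-linear : ∀ {m n} {f : Vec K m → Vec K n} {g} → (∀ y → f (g y) ≡ y) → (∀ x → g (f x) ≡ x) → Linear f → Linear g
  inverse-linear {f = f} {g} fg gf f-linear = record
    { +-homo = λ x y → trans (cong g (trans (cong₂ _+ᵛ_ (sym (fg x)) (sym (fg y))) (sym (f-linear .+-homo (g x) (g y))))) (gf _)
    ; *-homo = λ c x → trans (cong g (trans (cong (c *ᵛ_) (sym (fg x))) (sym (f-linear .*-homo c (g x))))) (gf _)
    }

  module _ {n} (A : Sub n) where
    private
      c = codim A
      d = dim A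

      to′ : Vec K n → Vec K (c ℕ.+ d)
      to′ x = quo A x ++ free A x

      from′ : Vec K (c ℕ.+ d) → Vec K n
      from′ y = sec A (take c y) +ᵛ par A (drop c y)

      quo-from′ : ∀ y → quo A (from′ y) ≡ take c y
      quo-from′ y = trans (quo-linear A .+-homo _ _)
        (trans (cong₂ _+ᵛ_ (quo-sec A (take c y)) (quo-par A (drop c y))) (+ᵛ-identityʳ (take c y)))

      free-from′ : ∀ y → free A (from′ y) ≡ drop c y
      free-from′ y = trans (free-linear A .+-homo _ _)
        (trans (cong₂ _+ᵛ_ (free-sec A (take c y)) (free-par A (drop c y))) (+ᵛ-identityˡ (drop c y)))

      to-from′ : ∀ y → to′ (from′ y) ≡ y
      to-from′ y = trans (cong₂ _++_ (quo-from′ y) (free-from′ y)) (Vec.take++drop≡id c y)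

      from-to′ : ∀ x → from′ (to′ x) ≡ x
      from-to′ x = trans (cong₂ (λ u v → sec A u +ᵛ par A v) (take-++ (quo A x) (free A x)) (drop-++ (quo A x) (free A x)))
        (sec+par A x)

      to-linear′ : Linear to′
      to-linear′ = record
        { +-homo = λ x y → trans (cong₂ _++_ (quo-linear A .+-homo x y) (free-linear A .+-homo x y))
            (sym (Vec.zipWith-++ _+_ (quo A x) (free A x) (quo A y) (free A y)))
        ; *-homo = λ a x → trans (cong₂ _++_ (quo-linear A .*-homo a x) (free-linear A .*-homo a x))
            (sym (Vec.map-++ (a *_) (quo A x) (free A x)))
        }

    -- In the coordinates (residue modulo A, free coordinates), A is the set where the first block
    -- vanishes. This reduces the count for A to the one for `std`.
    standardise : Iso n (c ℕ.+ d)
    standardise = record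
      { to = to′; from = from′; to-from = to-from′; from-to = from-to′
      ; to-linear = to-linear′; from-linear = inverse-linear to-from′ from-to′ to-linear′ }

    act-standardise : act standardise A ≡ std c d
    act-standardise = ⊆-antisym {A = act standardise A} {std c d} ⊆std
      (⊆∧dim≤⇒⊇ {A = act standardise A} {std c d} ⊆std
        (ℕ.≤-reflexive (trans (dim-std c d) (sym (dim-act standardise A)))))
      where
      ⊆std : act standardise A ⊆ std c d
      ⊆std y h = subst (_∈ std c d) (trans (cong (_++ drop c y)
        (trans (sym (∈act⁻ standardise A h)) (quo-from′ y))) (Vec.take++drop≡id c y)) (∈std c (drop c y))

  size-dims : ∀ {n r} (A : Sub n) → dim A ≡ r → ∀ i j → j ≤ i →
    size (dims A i j) ≡ q ^ ((r ∸ j) ℕ.* (i ∸ j)) ℕ.* gauss r j ℕ.* gauss (n ∸ r) (i ∸ j)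
  size-dims {n} A refl i j j≤i = begin
    size (dims A i j)                                      ≡⟨ size-dims-act (standardise A) A i j ⟨
    size (dims (act (standardise A) A) i j)                ≡⟨ cong (λ B → size (dims B i j)) (act-standardise A) ⟩
    size (dims (std c d) i j)                              ≡⟨ cong (λ k → size (dims (std c d) k j)) (ℕ.m∸n+n≡m j≤i) ⟨
    size (dims (std c d) (i ∸ j ℕ.+ j) j)                  ≡⟨ size-dims-std c d (i ∸ j) j ⟩
    q ^ ((d ∸ j) ℕ.* (i ∸ j)) ℕ.* gauss d j ℕ.* gauss c (i ∸ j)
      ≡⟨ cong (λ k → q ^ ((d ∸ j) ℕ.* (i ∸ j)) ℕ.* gauss d j ℕ.* gauss k (i ∸ j)) (codim≡ A refl) ⟩
    q ^ ((d ∸ j) ℕ.* (i ∸ j)) ℕ.* gauss d j ℕ.* gauss (n ∸ d) (i ∸ j) ∎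
    where
    open ≡-Reasoning
    c = codim A
    d = dim A

  size-meeting : ∀ {n r} t (A : Sub n) → dim A ≡ r → ∀ i →
    size (λ B → (dim B ≡ᵇ i) ∧ (t ≤ᵇ dim (A ∩ B))) ≡ meeting n t r i
  size-meeting {n} {r} t A dimA≡r i = begin
    size (λ B → (dim B ≡ᵇ i) ∧ (t ≤ᵇ dim (A ∩ B)))
      ≡⟨ count-cong (allSub n) (λ B → by-dim B (dim B ℕ.≟ i)) ⟩
    size (λ B → elem (dim (A ∩ B)) js ∧ (dim B ≡ᵇ i))
      ≡⟨ count-fibres (λ B → dim (A ∩ B)) (λ B → dim B ≡ᵇ i) (allSub n)
           (Unique.applyUpTo⁺₁ (t ℕ.+_) (suc i ∸ t) λ k<l _ eq → ℕ.<⇒≢ k<l (ℕ.+-cancelˡ-≡ t _ _ eq)) ⟩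
    sum (List.map (λ j → size (λ B → (dim (A ∩ B) ≡ᵇ j) ∧ (dim B ≡ᵇ i))) js)
      ≡⟨ cong sum (List.map-applyUpTo (t ℕ.+_) _ (suc i ∸ t)) ⟩
    sum (applyUpTo (λ k → size (λ B → (dim (A ∩ B) ≡ᵇ (t ℕ.+ k)) ∧ (dim B ≡ᵇ i))) (suc i ∸ t))
      ≡⟨ cong sum (applyUpTo-cong (suc i ∸ t) λ k k< → trans
           (count-cong (allSub n) λ B → Bool.∧-comm _ (dim B ≡ᵇ i))
           (size-dims A dimA≡r i (t ℕ.+ k) (bounded k<))) ⟩
    meeting n t r i ∎
    where
    open ≡-Reasoning
    js = applyUpTo (t ℕ.+_) (suc i ∸ t)
    bounded : ∀ {k} → k < suc i ∸ t → t ℕ.+ k ≤ i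
    bounded {k} k< = ℕ.≤-pred (subst (_< suc i) (ℕ.+-comm k t) (ℕ.m≤o∸n⇒m+n≤o (suc k) {t} t≤1+i k<))
      where
      t≤1+i : t ≤ suc i
      t≤1+i = ℕ.<⇒≤ (ℕ.m∸n≢0⇒n<m λ eq → ℕ.n≮0 (subst (k <_) eq k<))
    -- If dim B = i, the intersection has dimension at most i, so being at least t means being one
    -- of t, ..., i. Otherwise both conjunctions are false.
    by-dim : ∀ B → Dec (dim B ≡ i) → (dim B ≡ᵇ i) ∧ (t ≤ᵇ dim (A ∩ B)) ≡ elem (dim (A ∩ B)) js ∧ (dim B ≡ᵇ i)
    by-dim B (no dimB≢i) rewrite dec-false (dim B ℕ.≟ i) dimB≢i = sym (Bool.∧-zeroʳ _)
    by-dim B (yes dimB≡i) rewrite dec-true (dim B ℕ.≟ i) dimB≡i = trans (iff⇒≡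
      (λ h → let t≤d = true-≤ᵇ {t} h in ∈⇒elem (subst (λ d → d ∈ₗ js) (ℕ.m+[n∸m]≡n t≤d)
        (∈-applyUpTo⁺ (t ℕ.+_) (ℕ.∸-monoˡ-< (s≤s (ℕ.≤-trans (∩⊆ʳ A B) (ℕ.≤-reflexive dimB≡i))) t≤d))))
      (λ h → let k , _ , eq = ∈-applyUpTo⁻ (t ℕ.+_) (elem⇒∈ js h) in
        ≤ᵇ-true (ℕ.≤-trans (ℕ.m≤m+n t k) (ℕ.≤-reflexive (sym eq))))) (sym (Bool.∧-identityʳ _))
      where open import Data.List.Membership.Propositional using () renaming (_∈_ to _∈ₗ_)

  size-star : ∀ {n r} t (M : Subset n) (A : Sub n) → dim A ≡ r → size (star t (_∈ᵇ M) A) ≡ sumOver M (meeting n t r)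
  size-star {n} {r} t M A dimA≡r = begin
    size (star t (_∈ᵇ M) A)
      ≡⟨ count-fibres dim (λ B → t ≤ᵇ dim (A ∩ B)) (allSub n) (unique-elements M) ⟩
    sum (List.map (λ i → size (λ B → (dim B ≡ᵇ i) ∧ (t ≤ᵇ dim (A ∩ B)))) (elements M))
      ≡⟨ cong sum (List.map-cong (size-meeting t A dimA≡r) (elements M)) ⟩
    sum (List.map (meeting n t r) (elements M))
      ≡⟨ cong sum (sym (List.map-∘ (filter (_∈ˢ? M) (allFin n)))) ⟩
    sumOver M (meeting n t r) ∎
    where open ≡-Reasoning

-- Weighted sums over sets of dimensions.

module WeightedSums where
  open import Data.List.Base using (List; []; _∷_; map; applyUpTo; filter; allFin)
  open import Data.List.Relation.Unary.All using ([]; _∷_)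
  open import Data.List.Relation.Unary.AllPairs using ([]; _∷_)
  open import Data.Nat.Base
  open import Data.Nat.ListAction using (sum)
  open import Data.Nat.Properties
  open Counting
  open SubsetElements

  sum-applyUpTo-mono : ∀ {f g : ℕ → ℕ} m n → m ≤ n → (∀ k → k < m → f k ≤ g k) →
                       sum (applyUpTo f m) ≤ sum (applyUpTo g n)
  sum-applyUpTo-mono zero    n       _         h = z≤n
  sum-applyUpTo-mono (suc m) (suc n) (s≤s m≤n) h =
    +-mono-≤ (h 0 (s≤s z≤n)) (sum-applyUpTo-mono m n m≤n λ k k<m → h (suc k) (s≤s k<m))

  sum-applyUpTo-* : ∀ c (f : ℕ → ℕ) n → c * sum (applyUpTo f n) ≡ sum (applyUpTo (λ k → c * f k) n)
  sum-applyUpTo-* c f zero    = *-zeroʳ c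
  sum-applyUpTo-* c f (suc n) = trans (*-distribˡ-+ c (f 0) _) (cong (c * f 0 +_) (sum-applyUpTo-* c (f ∘ suc) n))

  sumFromTo-mono : ∀ t {i i′} {f g : ℕ → ℕ} → i ≤ i′ → (∀ j → t ≤ j → j ≤ i → f j ≤ g j) →
                   sumFromTo t i f ≤ sumFromTo t i′ g
  sumFromTo-mono t {i} {i′} i≤i′ h = sum-applyUpTo-mono (suc i ∸ t) (suc i′ ∸ t) (∸-monoˡ-≤ t (s≤s i≤i′))
    λ k k< → h (t + k) (m≤m+n t k) (≤-pred (≤-trans (+-monoʳ-< t k<)
      (≤-reflexive (m+[n∸m]≡n (<⇒≤ (m∸n≢0⇒n<m {suc i} {t} λ eq → n≮0 (subst (k <_) eq k<)))))))

  sumFromTo-* : ∀ c t i (f : ℕ → ℕ) → c * sumFromTo t i f ≡ sumFromTo t i (λ j → c * f j)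
  sumFromTo-* c t i f = sum-applyUpTo-* c (λ k → f (t + k)) (suc i ∸ t)

  sumFromTo-empty : ∀ {t i} (f : ℕ → ℕ) → i < t → sumFromTo t i f ≡ 0
  sumFromTo-empty {t} {i} f i<t rewrite m≤n⇒m∸n≡0 i<t = refl

  sumFromTo-head : ∀ t {i} (f : ℕ → ℕ) → t ≤ i → f t ≤ sumFromTo t i f
  sumFromTo-head t {i} f t≤i rewrite +-∸-assoc 1 t≤i = ≤-trans (≤-reflexive (cong f (sym (+-identityʳ t)))) (m≤m+n _ _)

  -- A sum over a set of dimensions whose last summand belongs to the top index, so that two sets
  -- can be compared from the top down.
  weight : (ℕ → Bool) → (ℕ → ℕ) → ℕ → ℕ
  weight P w zero    = 0
  weight P w (suc N) = weight P w N + indicator (P N) * w N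

  weight-false : ∀ w N → weight (const false) w N ≡ 0
  weight-false w zero    = refl
  weight-false w (suc N) = trans (+-identityʳ _) (weight-false w N)

  weight-mono : ∀ {P Q} w N → (∀ k → k < N → P k ≡ true → Q k ≡ true) → weight P w N ≤ weight Q w N
  weight-mono w zero    h = z≤n
  weight-mono w (suc N) h = +-mono-≤ (weight-mono w N λ k k<N → h k (m<n⇒m<1+n k<N))
    (*-monoˡ-≤ (w N) (indicator-mono {ℕ} (h N ≤-refl)))

  weight-≡ : ∀ w N {k} → k < N → weight (_≡ᵇ k) w N ≡ w k
  weight-≡ w (suc N) {k} (s≤s k≤N) with N ≟ k
  ... | yes refl = trans (cong₂ (λ a b → a + indicator b * w N)
          (trans (below N ≤-refl) (weight-false w N)) (dec-true (N ≟ N) refl)) (*-identityˡ (w N))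
    where
    below : ∀ M → M ≤ N → weight (_≡ᵇ N) w M ≡ weight (const false) w M
    below zero    _   = refl
    below (suc M) M<N = cong₂ (λ a b → a + indicator b * w M) (below M (<⇒≤ M<N)) (dec-false (M ≟ N) (<⇒≢ M<N))
  ... | no N≢k = trans (cong₂ (λ a b → a + indicator b * w N)
    (weight-≡ w N (≤∧≢⇒< k≤N (N≢k ∘ sym))) (dec-false (N ≟ k) N≢k)) (+-identityʳ (w k))

  weight-∨ : ∀ P Q w N → (∀ k → P k ≡ true → Q k ≡ false) →
             weight (λ k → P k ∨ Q k) w N ≡ weight P w N + weight Q w N
  weight-∨ P Q w zero    _ = refl
  weight-∨ P Q w (suc N) h = trans (cong₂ _+_ (weight-∨ P Q w N h) (indicator-∨ (P N) (Q N) (h N)))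
    (solve 4 (λ a b c d → (a :+ b) :+ (c :+ d) := (a :+ c) :+ (b :+ d)) refl (weight P w N) _ (indicator (P N) * w N) _)
    where
    open +-*-Solver
    indicator-∨ : ∀ a b → (a ≡ true → b ≡ false) → indicator (a ∨ b) * w N ≡ indicator a * w N + indicator b * w N
    indicator-∨ true  b h rewrite h refl = sym (+-identityʳ _)
    indicator-∨ false b h = refl

  weight-list : ∀ w N {ks} → Unique ks → (∀ k → k ∈ₗ ks → k < N) → weight (λ k → elem k ks) w N ≡ sum (map w ks)
  weight-list w N {[]}     []       _  = weight-false w N
  weight-list w N {k ∷ ks} (k∉ ∷ u) <N = trans (weight-∨ (_≡ᵇ k) (λ l → elem l ks) w N disjoint)
    (cong₂ _+_ (weight-≡ w N (<N k (here refl))) (weight-list w N u λ l l∈ → <N l (there l∈)))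
    where
    disjoint : ∀ l → (l ≡ᵇ k) ≡ true → elem l ks ≡ false
    disjoint l h with elem l ks in eq
    ... | false = refl
    ... | true  = contradiction (sym (does⇒ (l ≟ k) h)) (All.lookup k∉ (elem⇒∈ ks eq))

  value≤ : ∀ {n} {M : Subset n} {k} → k ∈ₙ M → k ≤ n
  value≤ (i , _ , refl) = Fin.toℕ<n i

  -- The range is n + 1 because the dimension n itself may belong to M.
  sumOver≡weight : ∀ {n} (M : Subset n) w → sumOver M w ≡ weight (_∈ᵇ M) w (suc n)
  sumOver≡weight {n} M w = trans (cong sum (List.map-∘ (filter _ (allFin n))))
    (sym (weight-list w (suc n) (unique-elements M) λ k k∈ → s≤s (value≤ (∈ᵇ⇒∈ₙ {M = M} (∈⇒elem k∈)))))

  weight-bounded : ∀ {P} w {M} N → (∀ k → P k ≡ true → k < M) → weight P w N ≤ weight (const true) w M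
  weight-bounded {P} w {M} zero    h = z≤n
  weight-bounded {P} w {M} (suc N) h with P N in PN
  ... | false = ≤-trans (≤-reflexive (+-identityʳ _)) (weight-bounded w N h)
  ... | true  = ≤-trans (+-monoˡ-≤ (1 * w N) (weight-mono w N λ _ _ _ → refl)) (increasing (h N PN))
    where
    increasing : ∀ {M N} → N ≤ M → weight (const true) w N ≤ weight (const true) w M
    increasing {zero}  z≤n = ≤-refl
    increasing {suc M} {N} N≤M with N ≟ suc M
    ... | yes refl = ≤-refl
    ... | no  N≢M  = ≤-trans (increasing (≤-pred (≤∧≢⇒< N≤M N≢M))) (m≤m+n _ _)

  -- As with binary expansions, the largest index d at which P and Q differ decides, because w d
  -- exceeds the sum of all earlier weights.
  weight-dominates : ∀ {P Q} w {d} N → d < N → P d ≡ false → Q d ≡ true → (∀ k → d < k → P k ≡ Q k) →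
                     weight (const true) w d < w d → weight P w N < weight Q w N
  weight-dominates {P} {Q} w {d} (suc N) (s≤s d≤N) Pd Qd agree W<w with N ≟ d
  ... | yes refl rewrite Pd | Qd = begin-strict
    weight P w N + 0             ≡⟨ +-identityʳ _ ⟩
    weight P w N                 ≤⟨ weight-mono w N (λ _ _ _ → refl) ⟩
    weight (const true) w N      <⟨ W<w ⟩
    w N                          ≡⟨ *-identityˡ (w N) ⟨
    1 * w N                      ≤⟨ m≤n+m _ (weight Q w N) ⟩
    weight Q w N + 1 * w N       ∎
    where open ≤-Reasoning
  ... | no N≢d = +-mono-<-≤ (weight-dominates w N d<N Pd Qd agree W<w)
    (≤-reflexive (cong (λ b → indicator b * w N) (agree N d<N)))
    where d<N = ≤∧≢⇒< d≤N (N≢d ∘ sym)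

  -- If the weights before e sum to less than w e, then those before e + 1 sum to less than 2 w e ≤
  -- w (e + 1). The induction starts at t, below which all weights vanish.
  doubling⇒dominates : ∀ w {t} e → t ≤ e → (∀ i → i < t → w i ≡ 0) → 0 < w t →
    (∀ i → i < e → 2 * w i ≤ w (suc i)) → weight (const true) w e < w e
  doubling⇒dominates w {t} e t≤e below pos double with t ≟ e
  ... | yes refl = subst (_< w e) (sym (zero-weight e ≤-refl)) pos
    where
    zero-weight : ∀ i → i ≤ e → weight (const true) w i ≡ 0
    zero-weight zero    _   = refl
    zero-weight (suc i) i<e = cong₂ _+_ (zero-weight i (<⇒≤ i<e)) (trans (*-identityˡ (w i)) (below i i<e))
  doubling⇒dominates w {t} zero    t≤e below pos double | no t≢e = contradiction (n≤0⇒n≡0 t≤e) t≢e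
  doubling⇒dominates w {t} (suc e) t≤e below pos double | no t≢e = begin-strict
    weight (const true) w e + 1 * w e  ≡⟨ cong (weight (const true) w e +_) (*-identityˡ (w e)) ⟩
    weight (const true) w e + w e      <⟨ +-monoˡ-< (w e) (doubling⇒dominates w e (≤-pred (≤∧≢⇒< t≤e t≢e)) below pos
                                            λ i i<e → double i (m<n⇒m<1+n i<e)) ⟩
    w e + w e                          ≡⟨ cong (w e +_) (+-identityʳ (w e)) ⟨
    2 * w e                            ≤⟨ double e ≤-refl ⟩
    w (suc e)                          ∎
    where open ≤-Reasoning

-- Growth of Gaussian coefficients, and the comparison of the two stars.

module GaussianGrowth (q : ℕ) .{{_ : NonTrivial q}} where
  open import Data.Nat.Base
  open import Data.Nat.Properties
  open Counting
  open SubsetElements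
  open WeightedSums
  open Gaussian q
  open GaussianProperties q

  private instance
    q-nonZero : NonZero q
    q-nonZero = nonTrivial⇒nonZero q

  0<q^∸1 : ∀ {e} → 0 < e → 0 < q ^ e ∸ 1
  0<q^∸1 {e} 0<e = m<n⇒0<n∸m (<-≤-trans (nonTrivial⇒n>1 q)
    (≤-trans (≤-reflexive (sym (^-identityʳ q))) (^-monoʳ-≤ q 0<e)))

  gauss-step : ∀ m l → gauss m (suc l) * (q ^ suc l ∸ 1) ≡ gauss m l * (q ^ (m ∸ l) ∸ 1)
  gauss-step m l = *-cancelʳ-≡ _ _ F {{fallingProduct-nonZero l}} (begin
    gauss m (suc l) * y * F   ≡⟨ *-assoc (gauss m (suc l)) y F ⟩
    gauss m (suc l) * (y * F) ≡⟨ gauss-exact m (suc l) ⟩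
    fallingProduct m (suc l)  ≡⟨ fallingProduct-suc m l ⟩
    fallingProduct m l * x    ≡⟨ cong (_* x) (sym (gauss-exact m l)) ⟩
    gauss m l * F * x         ≡⟨ solve 3 (λ a b c → a :* b :* c := a :* c :* b) refl (gauss m l) F x ⟩
    gauss m l * x * F         ∎)
    where
    open ≡-Reasoning
    open +-*-Solver
    F = fallingProduct l l
    x = q ^ (m ∸ l) ∸ 1
    y = q ^ suc l ∸ 1

  -- The quotient of consecutive coefficients is (q^(m-l) - 1) / (q^(l+1) - 1), which is at least 2
  -- since m - l ≥ l + 2.
  gauss-doubles : ∀ {m l} → 2 * suc l ≤ m → 2 * gauss m l ≤ gauss m (suc l)
  gauss-doubles {m} {l} 2l+2≤m = *-cancelʳ-≤ _ _ y {{>-nonZero (0<q^∸1 {suc l} (s≤s z≤n))}} (begin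
    2 * gauss m l * y         ≡⟨ solve 2 (λ a b → con 2 :* a :* b := a :* (con 2 :* b)) refl (gauss m l) y ⟩
    gauss m l * (2 * y)       ≤⟨ *-monoʳ-≤ (gauss m l) 2y≤x ⟩
    gauss m l * (q ^ (m ∸ l) ∸ 1) ≡⟨ sym (gauss-step m l) ⟩
    gauss m (suc l) * y       ∎)
    where
    open ≤-Reasoning
    open +-*-Solver
    y = q ^ suc l ∸ 1
    l+2≤m∸l : suc (suc l) ≤ m ∸ l
    l+2≤m∸l = ≤-trans (≤-reflexive (sym (trans (cong (_∸ l) (solve 1 (λ l → con 2 :* (con 1 :+ l) := (con 2 :+ l) :+ l) refl l)) (m+n∸n≡m (suc (suc l)) l)))) (∸-monoˡ-≤ l 2l+2≤m)
    2y≤x : 2 * y ≤ q ^ (m ∸ l) ∸ 1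
    2y≤x = begin
      2 * (q ^ suc l ∸ 1)     ≡⟨ *-distribˡ-∸ 2 (q ^ suc l) 1 ⟩
      2 * q ^ suc l ∸ 2       ≤⟨ ∸-monoʳ-≤ (2 * q ^ suc l) (s≤s z≤n) ⟩
      2 * q ^ suc l ∸ 1       ≤⟨ ∸-monoˡ-≤ 1 (*-monoˡ-≤ (q ^ suc l) (nonTrivial⇒n>1 q)) ⟩
      q ^ suc (suc l) ∸ 1     ≤⟨ ∸-monoˡ-≤ 1 (^-monoʳ-≤ q l+2≤m∸l) ⟩
      q ^ (m ∸ l) ∸ 1         ∎

  fallingProduct-+ : ∀ m k l → k ≤ m → fallingProduct m (k + l) ≡ fallingProduct m k * fallingProduct (m ∸ k) l
  fallingProduct-+ m       zero    l _         = sym (+-identityʳ _)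
  fallingProduct-+ (suc m) (suc k) l (s≤s k≤m) = trans
    (cong ((q ^ suc m ∸ 1) *_) (fallingProduct-+ m k l k≤m)) (sym (*-assoc (q ^ suc m ∸ 1) _ _))

  -- The product of q^i - 1 over 1 ≤ i ≤ m: the q-factorial up to a power of q - 1.
  factorial : ℕ → ℕ
  factorial m = fallingProduct m m

  gauss-factorial : ∀ k l → gauss (k + l) k * factorial k * factorial l ≡ factorial (k + l)
  gauss-factorial k l = trans (cong₂ _*_ (gauss-exact (k + l) k) (cong (λ m → fallingProduct m l) (sym (m+n∸m≡n k l))))
    (sym (fallingProduct-+ (k + l) k l (m≤m+n k l)))

  gauss>0 : ∀ {m k} → k ≤ m → 0 < gauss m k
  gauss>0 {m} {k} k≤m = n≢0⇒n>0 λ eq → ≢-nonZero⁻¹ (factorial m) {{fallingProduct-nonZero m}} (begin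
    factorial m                                           ≡⟨ cong factorial (sym (m+[n∸m]≡n k≤m)) ⟩
    factorial (k + (m ∸ k))                               ≡⟨ gauss-factorial k (m ∸ k) ⟨
    gauss (k + (m ∸ k)) k * factorial k * factorial (m ∸ k) ≡⟨ cong (λ n → gauss n k * factorial k * factorial (m ∸ k)) (m+[n∸m]≡n k≤m) ⟩
    gauss m k * factorial k * factorial (m ∸ k)           ≡⟨ cong (λ g → g * factorial k * factorial (m ∸ k)) eq ⟩
    0                                                     ∎)
    where open ≡-Reasoning

  -- The q-multinomial coefficient with cleared denominators: choose a + j, then j inside it, then b
  -- in what is left. The right side is symmetric in a and b, which `gauss-swap` exploits.
  gauss-multinomial : ∀ a b c j →
    gauss (a + b + c + j) (a + j) * gauss (a + j) j * gauss (b + c) b * (factorial a * factorial b * factorial c * factorial j)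
    ≡ factorial (a + b + c + j)
  gauss-multinomial a b c j = begin
    G₁ * G₂ * G₃ * (fa * fb * fc * fj)
      ≡⟨ solve 7 (λ x y z a b c j → x :* y :* z :* (a :* b :* c :* j) := x :* (y :* j :* a) :* (z :* b :* c)) refl G₁ G₂ G₃ fa fb fc fj ⟩
    G₁ * (G₂ * fj * fa) * (G₃ * fb * fc)
      ≡⟨ cong₂ (λ x y → G₁ * x * y)
           (trans (cong (λ m → gauss m j * fj * fa) (+-comm a j)) (trans (gauss-factorial j a) (cong factorial (+-comm j a))))
           (gauss-factorial b c) ⟩
    G₁ * factorial (a + j) * factorial (b + c)
      ≡⟨ cong (λ m → gauss m (a + j) * factorial (a + j) * factorial (b + c)) regroup ⟩
    gauss (a + j + (b + c)) (a + j) * factorial (a + j) * factorial (b + c)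
      ≡⟨ gauss-factorial (a + j) (b + c) ⟩
    factorial (a + j + (b + c))
      ≡⟨ cong factorial (sym regroup) ⟩
    factorial (a + b + c + j) ∎
    where
    open ≡-Reasoning
    open +-*-Solver
    G₁ = gauss (a + b + c + j) (a + j)
    G₂ = gauss (a + j) j
    G₃ = gauss (b + c) b
    fa = factorial a
    fb = factorial b
    fc = factorial c
    fj = factorial j
    regroup : a + b + c + j ≡ a + j + (b + c)
    regroup = solve 4 (λ a b c j → a :+ b :+ c :+ j := a :+ j :+ (b :+ c)) refl a b c j

  -- Both sides are the q-multinomial coefficient with parts j, r − j, s − j and n − r − s + j.
  gauss-swap : ∀ {n r s j} → j ≤ r → j ≤ s → r + s ≤ n →
    gauss n r * gauss r j * gauss (n ∸ r) (s ∸ j) ≡ gauss n s * gauss s j * gauss (n ∸ s) (r ∸ j)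
  gauss-swap {n} {r} {s} {j} j≤r j≤s r+s≤n = begin
    gauss n r * gauss r j * gauss (n ∸ r) b
      ≡⟨ cong₂ (λ x y → gauss x y * gauss y j * gauss (n ∸ r) b) n≡ r≡ ⟩
    gauss m (a + j) * gauss (a + j) j * gauss (n ∸ r) b
      ≡⟨ cong (λ x → gauss m (a + j) * gauss (a + j) j * gauss x b) n∸r ⟩
    gauss m (a + j) * gauss (a + j) j * gauss (b + c) b
      ≡⟨ *-cancelʳ-≡ _ _ f {{f-nonZero}} (trans (gauss-multinomial a b c j) (sym (begin
           gauss m (b + j) * gauss (b + j) j * gauss (a + c) a * f
             ≡⟨ cong₂ (λ x y → gauss x (b + j) * gauss (b + j) j * gauss (a + c) a * y)
                  (cong (λ z → z + c + j) (+-comm a b))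
                  (cong (λ z → z * factorial c * factorial j) (*-comm (factorial a) (factorial b))) ⟩
           _ ≡⟨ gauss-multinomial b a c j ⟩
           factorial (b + a + c + j)
             ≡⟨ cong (λ z → factorial (z + c + j)) (+-comm b a) ⟩
           factorial m ∎))) ⟩
    gauss m (b + j) * gauss (b + j) j * gauss (a + c) a
      ≡⟨ cong (λ x → gauss m (b + j) * gauss (b + j) j * gauss x a) (sym n∸s) ⟩
    gauss m (b + j) * gauss (b + j) j * gauss (n ∸ s) a
      ≡⟨ cong₂ (λ x y → gauss x y * gauss y j * gauss (n ∸ s) a) (sym n≡) (sym s≡) ⟩
    gauss n s * gauss s j * gauss (n ∸ s) a ∎
    where
    open ≡-Reasoning
    open +-*-Solver
    a = r ∸ j
    b = s ∸ j
    c = n ∸ (a + b + j)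
    m = a + b + c + j
    r≡ : r ≡ a + j
    r≡ = sym (m∸n+n≡m j≤r)
    s≡ : s ≡ b + j
    s≡ = sym (m∸n+n≡m j≤s)
    a+b+j≤n : a + b + j ≤ n
    a+b+j≤n = ≤-trans (≤-trans (m≤m+n (a + b + j) j) (≤-reflexive (trans
      (solve 3 (λ a b j → a :+ b :+ j :+ j := (a :+ j) :+ (b :+ j)) refl a b j) (cong₂ _+_ (sym r≡) (sym s≡))))) r+s≤n
    n≡ : n ≡ m
    n≡ = trans (sym (m+[n∸m]≡n a+b+j≤n)) (solve 4 (λ a b j c → a :+ b :+ j :+ c := a :+ b :+ c :+ j) refl a b j c)
    n∸r : n ∸ r ≡ b + c
    n∸r = trans (cong₂ _∸_ (trans n≡ (solve 4 (λ a b c j → a :+ b :+ c :+ j := (a :+ j) :+ (b :+ c)) refl a b c j)) r≡) (m+n∸m≡n (a + j) (b + c))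
    n∸s : n ∸ s ≡ a + c
    n∸s = trans (cong₂ _∸_ (trans n≡ (solve 4 (λ a b c j → a :+ b :+ c :+ j := (b :+ j) :+ (a :+ c)) refl a b c j)) s≡) (m+n∸m≡n (b + j) (a + c))
    f = factorial a * factorial b * factorial c * factorial j
    f-nonZero : NonZero f
    f-nonZero = m*n≢0 _ _ {{m*n≢0 _ _ {{m*n≢0 _ _ {{fallingProduct-nonZero a}} {{fallingProduct-nonZero b}}}} {{fallingProduct-nonZero c}}}} {{fallingProduct-nonZero j}}

  module _ (n t : ℕ) where

    -- Termwise: for each j the power of q does not decrease, and the last Gaussian coefficient at
    -- least doubles because 2 (i - j + 1) ≤ n - r.
    meeting-doubles : ∀ r i → r + 2 * suc i ≤ n → 2 * meeting n t r i ≤ meeting n t r (suc i)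
    meeting-doubles r i h = ≤-trans (≤-reflexive (sumFromTo-* 2 t i (meetingTerm n r i))) (sumFromTo-mono t (n≤1+n i) λ j t≤j j≤i → begin
      2 * (q ^ ((r ∸ j) * (i ∸ j)) * gauss r j * gauss (n ∸ r) (i ∸ j))
        ≡⟨ solve 2 (λ a b → con 2 :* (a :* b) := a :* (con 2 :* b)) refl (q ^ ((r ∸ j) * (i ∸ j)) * gauss r j) _ ⟩
      q ^ ((r ∸ j) * (i ∸ j)) * gauss r j * (2 * gauss (n ∸ r) (i ∸ j))
        ≤⟨ *-mono-≤ (*-monoˡ-≤ (gauss r j) (^-monoʳ-≤ q (*-monoʳ-≤ (r ∸ j) (∸-monoˡ-≤ j (n≤1+n i)))))
             (≤-trans (gauss-doubles {n ∸ r} {i ∸ j} (≤-trans (*-monoʳ-≤ 2 (s≤s (m∸n≤m i j)))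
               (≤-trans (≤-reflexive (sym (m+n∸m≡n r _))) (∸-monoˡ-≤ r h))))
               (≤-reflexive (cong (gauss (n ∸ r)) (sym (+-∸-assoc 1 j≤i))))) ⟩
      q ^ ((r ∸ j) * (suc i ∸ j)) * gauss r j * gauss (n ∸ r) (suc i ∸ j) ∎)
      where
      open ≤-Reasoning
      open +-*-Solver

    meeting-empty : ∀ r {i} → i < t → meeting n t r i ≡ 0
    meeting-empty r {i} = sumFromTo-empty (meetingTerm n r i)

    meeting>0 : ∀ {r} → t ≤ r → 0 < meeting n t r t
    meeting>0 {r} t≤r = <-≤-trans
      (subst (0 <_) (sym (cong₂ (λ a b → q ^ ((r ∸ t) * a) * gauss r t * gauss (n ∸ r) b) (n∸n≡0 t) (n∸n≡0 t)))
        (*-mono-< (*-mono-< (m^n>0 q ((r ∸ t) * 0)) (gauss>0 t≤r)) (gauss>0 {n ∸ r} {0} z≤n)))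
      (sumFromTo-head t (meetingTerm n r t) ≤-refl)

    -- A double count of the pairs of an r- and an s-dimensional subspace that meet in dimension at
    -- least t. The terms with j ≤ r agree by `gauss-swap`; the right sum runs on to s, and an
    -- inequality is enough.
    meeting-swap : ∀ {r s} → r ≤ s → r + s ≤ n → gauss n s * meeting n t s r ≤ gauss n r * meeting n t r s
    meeting-swap {r} {s} r≤s r+s≤n = begin
      gauss n s * meeting n t s r
        ≡⟨ sumFromTo-* (gauss n s) t r (meetingTerm n s r) ⟩
      sumFromTo t r (λ j → gauss n s * meetingTerm n s r j)
        ≤⟨ sumFromTo-mono t r≤s (λ j _ j≤r → ≤-reflexive (trans (regroup (gauss n s) (q ^ ((s ∸ j) * (r ∸ j))) (gauss s j) (gauss (n ∸ s) (r ∸ j)))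
             (trans (cong₂ _*_ (cong (q ^_) (*-comm (s ∸ j) (r ∸ j))) (sym (gauss-swap j≤r (≤-trans j≤r r≤s) r+s≤n)))
               (sym (regroup (gauss n r) (q ^ ((r ∸ j) * (s ∸ j))) (gauss r j) (gauss (n ∸ r) (s ∸ j))))))) ⟩
      sumFromTo t s (λ j → gauss n r * meetingTerm n r s j)
        ≡⟨ sumFromTo-* (gauss n r) t s (meetingTerm n r s) ⟨
      gauss n r * meeting n t r s ∎
      where
      open ≤-Reasoning
      open +-*-Solver
      regroup : ∀ a b c d → a * (b * c * d) ≡ b * (a * c * d)
      regroup = solve 4 (λ a b c d → a :* (b :* c :* d) := b :* (a :* c :* d)) refl

    gauss-<-doubles : ∀ {r s} → r < s → 2 * s ≤ n → 2 * gauss n r ≤ gauss n s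
    gauss-<-doubles {r} {suc s} (s≤s r≤s) 2s≤n with r ≟ s
    ... | yes refl = gauss-doubles 2s≤n
    ... | no  r≢s  = ≤-trans (gauss-<-doubles (≤∧≢⇒< r≤s r≢s) (≤-trans (*-monoʳ-≤ 2 (n≤1+n s)) 2s≤n))
      (≤-trans (m≤m+n _ _) (gauss-doubles 2s≤n))

    -- By `meeting-swap` the two numbers differ at least by the factor `gauss n s` / `gauss n r`,
    -- which is at least 2.
    meeting-<-doubles : ∀ {r s} → r < s → 2 * s ≤ n → 2 * meeting n t s r ≤ meeting n t r s
    meeting-<-doubles {r} {s} r<s 2s≤n = *-cancelˡ-≤ (gauss n r) {{>-nonZero (gauss>0 (≤-trans (<⇒≤ r<s) s≤n))}} (begin
      gauss n r * (2 * meeting n t s r)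
        ≡⟨ solve 2 (λ a b → a :* (con 2 :* b) := con 2 :* a :* b) refl (gauss n r) (meeting n t s r) ⟩
      2 * gauss n r * meeting n t s r
        ≤⟨ *-monoˡ-≤ (meeting n t s r) (gauss-<-doubles r<s 2s≤n) ⟩
      gauss n s * meeting n t s r
        ≤⟨ meeting-swap (<⇒≤ r<s) (≤-trans (≤-trans (+-monoˡ-≤ s (<⇒≤ r<s)) (≤-reflexive (cong (s +_) (sym (+-identityʳ s))))) 2s≤n) ⟩
      gauss n r * meeting n t r s ∎)
      where
      open ≤-Reasoning
      open +-*-Solver
      s≤n = ≤-trans (m≤m+n s (s + 0)) 2s≤n

    -- If r = s, both sums have the same weights and dimension d decides. If r < s, dimension s
    -- alone decides. And s < r is impossible: r would lie above d, where R and S agree, and hence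
    -- in S.
    sumOver-meeting-< : ∀ {r s d} {R S : Subset n} → 0 < r → 0 < s → s ^ 2 + r ^ 2 + s * r ≤ n →
      IsMax R r → IsMax S s → (∀ k → k ∈ₙ R → t ≤ k) → (∀ k → k ∈ₙ S → t ≤ k) →
      d ∈ₙ S → ¬ d ∈ₙ R → (∀ k → d < k → (k ∈ₙ R → k ∈ₙ S) × (k ∈ₙ S → k ∈ₙ R)) →
      sumOver R (meeting n t s) < sumOver S (meeting n t r)
    sumOver-meeting-< {r} {s} {d} {R} {S} 0<r 0<s large (r∈R , R≤r) (s∈S , S≤s) t≤R t≤S d∈S d∉R agree
      rewrite sumOver≡weight R (meeting n t s) | sumOver≡weight S (meeting n t r) = by-cases (<-cmp r s)
      where
      open import Relation.Binary.Definitions using (tri<; tri≈; tri>; Tri)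
      square : ∀ {k l} → l ≤ k → l * k ≤ k ^ 2
      square {k} {l} l≤k = ≤-trans (*-monoˡ-≤ k l≤k) (≤-reflexive (cong (k *_) (sym (*-identityʳ k))))
      P = _∈ᵇ R
      Q = _∈ᵇ S
      not-in : P d ≡ false
      not-in with P d in eq
      ... | false = refl
      ... | true  = contradiction (∈ᵇ⇒∈ₙ {M = R} eq) d∉R
      by-cases : Tri (r < s) (r ≡ s) (s < r) → weight P (meeting n t s) (suc n) < weight Q (meeting n t r) (suc n)
      by-cases (tri≈ _ refl _) = weight-dominates (meeting n t r) (suc n) (s≤s (value≤ {M = S} d∈S)) not-in
        (∈ₙ⇒∈ᵇ {M = S} d∈S)
        (λ k d<k → iff⇒≡ (∈ₙ⇒∈ᵇ {M = S} ∘ proj₁ (agree k d<k) ∘ ∈ᵇ⇒∈ₙ {M = R})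
                         (∈ₙ⇒∈ᵇ {M = R} ∘ proj₂ (agree k d<k) ∘ ∈ᵇ⇒∈ₙ {M = S}))
        (doubling⇒dominates (meeting n t r) d (t≤S d d∈S) (λ i → meeting-empty r) (meeting>0 (t≤R r r∈R))
          -- Doubling up to d ≤ r asks for 3 r ≤ n, and 3 r ≤ 3 r², which is the hypothesis on n for
          -- r = s.
          λ i i<d → meeting-doubles r i (≤-trans (+-monoʳ-≤ r (*-monoʳ-≤ 2 (≤-trans i<d (S≤s d d∈S)))) (begin
            r + 2 * r              ≡⟨ solve 1 (λ r → r :+ con 2 :* r := con 1 :* r :+ con 1 :* r :+ con 1 :* r) refl r ⟩
            1 * r + 1 * r + 1 * r  ≤⟨ +-mono-≤ (+-mono-≤ (square 0<r) (square 0<r)) (*-monoˡ-≤ r 0<r) ⟩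
            r ^ 2 + r ^ 2 + r * r  ≤⟨ large ⟩
            n ∎)))
        where
        open ≤-Reasoning
        open +-*-Solver
      by-cases (tri> _ _ s<r) = contradiction (S≤s r (proj₁ (agree r (≤-<-trans (S≤s d d∈S) s<r)) r∈R)) (<⇒≱ s<r)
      -- R lies in dimensions up to r, so by doubling its sum is less than twice the weight at r.
      -- The single summand of S at s is already as large as that.
      by-cases (tri< r<s _ _) = begin-strict
        weight P w (suc n)                        ≤⟨ weight-bounded w (suc n) (λ k Pk → s≤s (R≤r k (∈ᵇ⇒∈ₙ {M = R} Pk))) ⟩
        weight (const true) w r + 1 * w r         <⟨ +-monoˡ-< (1 * w r) (doubling⇒dominates w r (t≤R r r∈R)
                                                       (λ i → meeting-empty s) (meeting>0 (t≤S s s∈S)) doubles) ⟩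
        w r + 1 * w r                             ≤⟨ meeting-<-doubles r<s (≤-trans (square 2≤s) (≤-trans (m≤m+n _ _) (≤-trans (m≤m+n _ _) large))) ⟩
        meeting n t r s                           ≡⟨ weight-≡ (meeting n t r) (suc n) (s≤s (value≤ {M = S} s∈S)) ⟨
        weight (_≡ᵇ s) (meeting n t r) (suc n)    ≤⟨ weight-mono (meeting n t r) (suc n) (λ k _ h →
                                                       ∈ₙ⇒∈ᵇ {M = S} (subst (_∈ₙ S) (sym (does⇒ (k ≟ s) h)) s∈S)) ⟩
        weight Q (meeting n t r) (suc n)          ∎
        where
        open ≤-Reasoning
        w = meeting n t s
        -- From 0 < r < s. It yields 2 s ≤ s² and 2 (i + 1) ≤ s r, the two ways in which the
        -- quadratic bound on n is used here.
        2≤s : 2 ≤ s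
        2≤s = ≤-<-trans 0<r r<s
        doubles : ∀ i → i < r → 2 * w i ≤ w (suc i)
        doubles i i<r = meeting-doubles s i (begin
          s + 2 * suc i            ≤⟨ +-monoʳ-≤ s (*-mono-≤ 2≤s i<r) ⟩
          s + s * r                ≤⟨ +-monoˡ-≤ (s * r) (≤-trans (≤-reflexive (sym (*-identityˡ s))) (square 0<s)) ⟩
          s ^ 2 + s * r            ≤⟨ +-monoˡ-≤ (s * r) (m≤m+n (s ^ 2) (r ^ 2)) ⟩
          s ^ 2 + r ^ 2 + s * r    ≤⟨ large ⟩
          n ∎)

-- Carrying the field structure over to `Fin q`.

module FieldTransport where
  open import Algebra.Bundles using (RawRing)
  open import Algebra.Morphism.Structures using (IsRingMonomorphism)
  open import Data.Nat.Base using (nonTrivial⇒n>1)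

  module _ {c ℓ₁ ℓ₂} {q : ℕ} .{{_ : NonTrivial q}} (F : HeytingField c ℓ₁ ℓ₂)
           (card : CommutativeRing.setoid (fieldRing F) HasCardinality q) where

    private
      module F = HeytingField F
      open Inverse card

      rawRing : RawRing _ _
      rawRing = record
        { Carrier = Fin q
        ; _≈_     = _≡_
        ; _+_     = λ x y → to (from x F.+ from y)
        ; _*_     = λ x y → to (from x F.* from y)
        ; -_      = λ x → to (F.- from x)
        ; 0#      = to F.0#
        ; 1#      = to F.1#
        }
      module K = RawRing rawRing

      abstract
        -- Ring laws pull back along an injective homomorphism, and on `Fin q` they become
        -- propositional equations.
        isRingMonomorphism : IsRingMonomorphism rawRing (CommutativeRing.rawRing (fieldRing F)) from
        isRingMonomorphism = record
          { isRingHomomorphism = record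
            { isSemiringHomomorphism = record
              { isNearSemiringHomomorphism = record
                { +-isMonoidHomomorphism = record
                  { isMagmaHomomorphism = record
                    { isRelHomomorphism = record { cong = from-cong }
                    ; homo = λ x y → strictlyInverseʳ _ }
                  ; ε-homo = strictlyInverseʳ _ }
                ; *-homo = λ x y → strictlyInverseʳ _ }
              ; 1#-homo = strictlyInverseʳ _ }
            ; -‿homo = λ x → strictlyInverseʳ _ }
          ; injective = λ {x} {y} eq → trans (sym (strictlyInverseˡ x)) (trans (to-cong eq) (strictlyInverseˡ y))
          }

        -- x ≢ 0 refutes ¬ (x # 0), so x is not not invertible, and invertibility
        -- in a finite ring is decidable.
        invert : ∀ x → x ≢ K.0# → ∃ λ y → y K.* x ≡ K.1#
        invert x x≢0 = decidable-stable (Fin.any? λ y → y K.* x Fin.≟ K.1#) λ none →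
          x≢0 (trans (sym (strictlyInverseˡ x)) (to-cong (proj₁ (F.tight (from x) F.0#) λ x#0 →
            let y , yx≈1 , _ = F.#⇒invertible x#0 in
            none (to y , to-cong (F.trans (F.*-cong (strictlyInverseʳ y) (F.sym (x-0≈x (from x)))) yx≈1)))))
          where
          x-0≈x : ∀ x → x F.- F.0# F.≈ x
          x-0≈x x = F.trans (F.+-congˡ (F.trans (F.sym (F.+-identityˡ (F.- F.0#))) (F.-‿inverseʳ F.0#))) (F.+-identityʳ x)

        isCommutativeRing : IsCommutativeRing _≡_ K._+_ K._*_ K.-_ K.0# K.1#
        isCommutativeRing = RingMonomorphism.isCommutativeRing isRingMonomorphism
          (CommutativeRing.isCommutativeRing (fieldRing F))

    finiteField : FiniteField q
    finiteField = record
      { isCommutativeRing = isCommutativeRing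
      ; inverse           = invert
      ; 1<q               = nonTrivial⇒n>1 q
      }

-- Coordinates of the abstract space V.

module Coordinates {c ℓ₁ ℓ₂ v ℓv : Level} {q : ℕ} .{{_ : NonTrivial q}} (F : HeytingField c ℓ₁ ℓ₂)
         (card : CommutativeRing.setoid (fieldRing F) HasCardinality q)
         (V : Module (fieldRing F) v ℓv) {n : ℕ} (dimV : VectorSpace.HasDim F V U n) where
  open import Data.Nat.Base using (zero; suc)
  open import Data.Vec.Base using (Vec; []; _∷_; lookup; tabulate)
  open import Level using (_⊔_)
  open FieldTransport

  𝔽 : FiniteField q
  𝔽 = finiteField F card

  open Subspaces 𝔽
  open Dimension 𝔽
  open Constructions 𝔽
  open Linear
  open VectorSpace F V
  private
    module F = HeytingField F
    module K = Inverse card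
  open Module V
  open CommutativeMonoidSum +ᴹ-commutativeMonoid using (sum-cong-≋; ∑-distrib-+)
  open SetoidReasoning ≈ᴹ-setoid

  ι : K → F.Carrier
  ι = K.from

  comb : ∀ {k} → Vec K k → (Fin k → Carrierᴹ) → Carrierᴹ
  comb a b = lincomb (ι ∘ lookup a) b

  lincomb-cong : ∀ {k} {a a′ : Fin k → F.Carrier} b → (∀ i → a i F.≈ a′ i) → lincomb a b ≈ᴹ lincomb a′ b
  lincomb-cong b eq = sum-cong-≋ λ i → *ₗ-cong (eq i) ≈ᴹ-refl

  approx : ∀ {k} → (Fin k → F.Carrier) → Vec K k
  approx a = tabulate (K.to ∘ a)

  ι-approx : ∀ {k} (a : Fin k → F.Carrier) i → ι (lookup (approx a) i) F.≈ a i
  ι-approx a i = F.trans (K.from-cong (Vec.lookup∘tabulate (K.to ∘ a) i)) (K.strictlyInverseʳ (a i))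

  comb-approx : ∀ {k} (a : Fin k → F.Carrier) b → comb (approx a) b ≈ᴹ lincomb a b
  comb-approx a b = lincomb-cong b (ι-approx a)

  abstract
    comb-+ : ∀ {k} (x y : Vec K k) b → comb (x +ᵛ y) b ≈ᴹ comb x b +ᴹ comb y b
    comb-+ x y b = ≈ᴹ-trans
      (sum-cong-≋ λ i → ≈ᴹ-trans (*ₗ-cong (F.trans (K.from-cong (Vec.lookup-zipWith _+_ i x y)) (K.strictlyInverseʳ _)) ≈ᴹ-refl)
                                 (*ₗ-distribʳ (b i) _ _))
      (∑-distrib-+ (λ i → ι (lookup x i) *ₗ b i) _)

    comb-* : ∀ {k} c (x : Vec K k) b → comb (c *ᵛ x) b ≈ᴹ ι c *ₗ comb x b
    comb-* c []       b = ≈ᴹ-sym (*ₗ-zeroʳ (ι c))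
    comb-* c (x ∷ xs) b = ≈ᴹ-trans
      (+ᴹ-cong (≈ᴹ-trans (*ₗ-cong (K.strictlyInverseʳ _) ≈ᴹ-refl) (*ₗ-assoc _ _ _)) (comb-* c xs (b ∘ Fin.suc)))
      (≈ᴹ-sym (*ₗ-distribˡ (ι c) _ _))

  ι-0 : ι 0# F.≈ F.0#
  ι-0 = K.strictlyInverseʳ F.0#

  abstract
    comb-0 : ∀ {k} b → comb (0ᵛ {k}) b ≈ᴹ 0ᴹ
    comb-0 {k} b = begin
      comb 0ᵛ b             ≡⟨ cong (λ x → comb x b) (sym (0*ᵛ 0ᵛ)) ⟩
      comb (0# *ᵛ 0ᵛ {k}) b ≈⟨ comb-* 0# (0ᵛ {k}) b ⟩
      ι 0# *ₗ comb (0ᵛ {k}) b ≈⟨ *ₗ-cong ι-0 ≈ᴹ-refl ⟩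
      F.0# *ₗ comb (0ᵛ {k}) b ≈⟨ *ₗ-zeroˡ _ ⟩
      0ᴹ                    ∎

    lookup-0 : ∀ {k} (x : Vec K k) → (∀ i → lookup x i ≡ 0#) → x ≡ 0ᵛ
    lookup-0 []       _ = refl
    lookup-0 (x ∷ xs) h = cong₂ _∷_ (h Fin.zero) (lookup-0 xs (h ∘ Fin.suc))

    ι-injective : ∀ {x y} → ι x F.≈ ι y → x ≡ y
    ι-injective {x} {y} eq = trans (sym (K.strictlyInverseˡ x)) (trans (K.to-cong eq) (K.strictlyInverseˡ y))

    comb-injective : ∀ {k} {b : Fin k → Carrierᴹ} → LinearlyIndependent b → ∀ {x y} → comb x b ≈ᴹ comb y b → x ≡ y
    comb-injective {b = b} independent {x} {y} eq = -1*ᵛ-cancel (lookup-0 _ λ i →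
      ι-injective (F.trans (independent _ difference i) (F.sym ι-0)))
      where
      difference : comb (x +ᵛ (- 1#) *ᵛ y) b ≈ᴹ 0ᴹ
      difference = begin
        comb (x +ᵛ (- 1#) *ᵛ y) b          ≈⟨ comb-+ x ((- 1#) *ᵛ y) b ⟩
        comb x b +ᴹ comb ((- 1#) *ᵛ y) b   ≈⟨ +ᴹ-cong eq ≈ᴹ-refl ⟩
        comb y b +ᴹ comb ((- 1#) *ᵛ y) b   ≈⟨ comb-+ y ((- 1#) *ᵛ y) b ⟨
        comb (y +ᵛ (- 1#) *ᵛ y) b          ≡⟨ cong (λ z → comb z b) (negate {x = y}) ⟩
        comb 0ᵛ b                          ≈⟨ comb-0 b ⟩
        0ᴹ                                 ∎

  private module E = HasDim dimV

  ψ : Vec K n → Carrierᴹ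
  ψ x = comb x E.basis

  φ : Carrierᴹ → Vec K n
  φ x = approx (proj₁ (E.spanning x tt))

  abstract
    ψ-φ : ∀ x → ψ (φ x) ≈ᴹ x
    ψ-φ x = ≈ᴹ-trans (comb-approx _ E.basis) (≈ᴹ-sym (proj₂ (E.spanning x tt)))

    φ-unique : ∀ {x y} → ψ x ≈ᴹ y → φ y ≡ x
    φ-unique {y = y} eq = comb-injective E.independent (≈ᴹ-trans (ψ-φ y) (≈ᴹ-sym eq))

    φ-ψ : ∀ x → φ (ψ x) ≡ x
    φ-ψ x = φ-unique ≈ᴹ-refl

    φ-cong : ∀ {x y} → x ≈ᴹ y → φ x ≡ φ y
    φ-cong {y = y} eq = φ-unique (≈ᴹ-trans (ψ-φ y) (≈ᴹ-sym eq))

    φ-injective : ∀ {x y} → φ x ≡ φ y → x ≈ᴹ y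
    φ-injective {x} {y} eq = ≈ᴹ-trans (≈ᴹ-sym (ψ-φ x)) (≈ᴹ-trans (≈ᴹ-reflexive (cong ψ eq)) (ψ-φ y))

    φ-+ : ∀ x y → φ (x +ᴹ y) ≡ φ x +ᵛ φ y
    φ-+ x y = φ-unique (≈ᴹ-trans (comb-+ (φ x) (φ y) E.basis) (+ᴹ-cong (ψ-φ x) (ψ-φ y)))

    φ-* : ∀ c x → φ (ι c *ₗ x) ≡ c *ᵛ φ x
    φ-* c x = φ-unique (≈ᴹ-trans (comb-* c (φ x) E.basis) (*ₗ-cong F.refl (ψ-φ x)))

  -- C is the echelon form of the coordinate vectors of Q. It is a decidable substitute for Q, which
  -- is an arbitrary predicate.
  record Represents {p} (C : Sub n) (Q : Pred Carrierᴹ p) : Set (v ⊔ p) where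
    field
      ⇒∈ : ∀ x → Q x → φ x ∈ C
      ∈⇒ : ∀ x → φ x ∈ C → Q x
  open Represents public

  unit : ∀ {k} → Fin k → Vec K k
  unit Fin.zero    = 1# ∷ 0ᵛ
  unit (Fin.suc i) = 0# ∷ unit i

  abstract
    -- A linear map is determined by its values at the unit vectors. For ψ composed with `par C`
    -- these values form a basis of the represented subspace.
    comb-unit : ∀ {k} (h : Vec K k → Carrierᴹ) → (∀ x y → h (x +ᵛ y) ≈ᴹ h x +ᴹ h y) →
                (∀ c x → h (c *ᵛ x) ≈ᴹ ι c *ₗ h x) → ∀ x → comb x (h ∘ unit) ≈ᴹ h x
    comb-unit h h-+ h-* [] = ≈ᴹ-sym (begin
      h []             ≈⟨ h-* 0# [] ⟩
      ι 0# *ₗ h []     ≈⟨ *ₗ-cong ι-0 ≈ᴹ-refl ⟩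
      F.0# *ₗ h []     ≈⟨ *ₗ-zeroˡ _ ⟩
      0ᴹ               ∎)
    comb-unit h h-+ h-* (x ∷ xs) = begin
      ι x *ₗ h (1# ∷ 0ᵛ) +ᴹ comb xs (h ∘ unit ∘ Fin.suc)
        ≈⟨ +ᴹ-cong (≈ᴹ-sym (h-* x _)) (comb-unit (h ∘ (0# ∷_))
             (λ y z → ≈ᴹ-trans (≈ᴹ-reflexive (cong (λ a → h (a ∷ (y +ᵛ z))) (sym (+-identityˡ 0#)))) (h-+ (0# ∷ y) (0# ∷ z)))
             (λ c y → ≈ᴹ-trans (≈ᴹ-reflexive (cong (λ a → h (a ∷ (c *ᵛ y))) (sym (zeroʳ c)))) (h-* c (0# ∷ y))) xs) ⟩
      h (x *ᵛ (1# ∷ 0ᵛ)) +ᴹ h (0# ∷ xs)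
        ≈⟨ h-+ _ _ ⟨
      h (x *ᵛ (1# ∷ 0ᵛ) +ᵛ (0# ∷ xs))
        ≡⟨ cong h (cong₂ _∷_ (trans (+-identityʳ _) (*-identityʳ x))
             (trans (cong (_+ᵛ xs) (*ᵛ0ᵛ _ x)) (+ᵛ-identityˡ xs))) ⟩
      h (x ∷ xs) ∎

    represents⇒hasDim : ∀ {p} {C : Sub n} {Q : Pred Carrierᴹ p} → Represents C Q → HasDim Q (dim C)
    represents⇒hasDim {C = C} {Q} rep = record
      { basis       = ψ ∘ par C ∘ unit
      ; basis∈W     = λ i → ∈⇒ rep _ (subst (_∈ C) (sym (φ-ψ _)) (par∈ C (unit i)))
      ; independent = λ a a≈0 i → F.trans (F.sym (ι-approx a i)) (F.trans
          (K.from-cong (trans (cong (λ x → lookup x i) (zero-coefficients a a≈0)) (Vec.lookup-replicate i 0#))) ι-0)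
      ; spanning    = λ x x∈Q → ι ∘ lookup (free C (φ x)) , (begin
          x                                   ≈⟨ ψ-φ x ⟨
          ψ (φ x)                             ≡⟨ cong ψ (∈⇒par {W = C} (⇒∈ rep x x∈Q)) ⟨
          ψ (par C (free C (φ x)))            ≈⟨ comb-basis (free C (φ x)) ⟨
          comb (free C (φ x)) (ψ ∘ par C ∘ unit) ∎)
      }
      where
      comb-basis : ∀ a → comb a (ψ ∘ par C ∘ unit) ≈ᴹ ψ (par C a)
      comb-basis = comb-unit (ψ ∘ par C)
        (λ x y → ≈ᴹ-trans (≈ᴹ-reflexive (cong ψ (par-linear C .+-homo x y))) (comb-+ (par C x) (par C y) E.basis))
        (λ a x → ≈ᴹ-trans (≈ᴹ-reflexive (cong ψ (par-linear C .*-homo a x))) (comb-* a (par C x) E.basis))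
      zero-coefficients : ∀ a → lincomb a (ψ ∘ par C ∘ unit) ≈ᴹ 0ᴹ → approx a ≡ 0ᵛ
      zero-coefficients a a≈0 = par-injective C (trans (comb-injective E.independent (begin
        ψ (par C (approx a))                ≈⟨ comb-basis (approx a) ⟨
        comb (approx a) (ψ ∘ par C ∘ unit)  ≈⟨ comb-approx a _ ⟩
        lincomb a (ψ ∘ par C ∘ unit)        ≈⟨ a≈0 ⟩
        0ᴹ                                  ≈⟨ comb-0 E.basis ⟨
        ψ 0ᵛ                                ∎)) (sym (0-homo (par-linear C))))

  -- Covers the vectors of a `Subspace` as well as the intersection of two subspaces, which occurs
  -- only as a predicate.
  record IsLinearSubset {p} (Q : Pred Carrierᴹ p) : Set (c ⊔ v ⊔ ℓv ⊔ p) where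
    field
      respects : Q Respects _≈ᴹ_
      0-closed : Q 0ᴹ
      +-closed : ∀ {x y} → Q x → Q y → Q (x +ᴹ y)
      *-closed : ∀ a {x} → Q x → Q (a *ₗ x)

    lincomb-closed : ∀ {k} (a : Fin k → F.Carrier) b → (∀ i → Q (b i)) → Q (lincomb a b)
    lincomb-closed {zero}  a b b∈ = 0-closed
    lincomb-closed {suc k} a b b∈ = +-closed (*-closed _ (b∈ Fin.zero)) (lincomb-closed (a ∘ Fin.suc) (b ∘ Fin.suc) (b∈ ∘ Fin.suc))

  abstract
    -- A basis makes membership decidable by a search through the q^k coefficient vectors. `canon`
    -- brings the image of `Φ` into echelon form, and `Φ` is a bijection onto it, which gives the
    -- dimension.
    represent : ∀ {p} {Q : Pred Carrierᴹ p} {k} → IsLinearSubset Q → HasDim Q k → ∃ λ C → Represents C Q × dim C ≡ k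
    represent {Q = Q} {k} Q-linear dimQ = sub code , record
      { ⇒∈ = λ x x∈Q → let a , x≈ = spanning x x∈Q in
          complete code (φ x) (approx a , φ-cong (≈ᴹ-trans (comb-approx a basis) (≈ᴹ-sym x≈)))
      ; ∈⇒ = λ x φx∈ → let a , eq = sound code (φ x) φx∈ in
          respects (φ-injective eq) (lincomb-closed _ basis basis∈W)
      } , ℕ.≤-antisym
        (dim≤ (sub code) (λ x x∈ → proj₁ (sound code x x∈)) λ {x} {y} x∈ y∈ eq →
          trans (sym (proj₂ (sound code x x∈))) (trans (cong Φ eq) (proj₂ (sound code y y∈))))
        (≤dim (sub code) Φ (λ a → complete code (Φ a) (a , refl)) λ eq → comb-injective independent (φ-injective eq))
      where
      open IsLinearSubset Q-linear
      open HasDim dimQ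
      open Code
      Φ : Vec K k → Vec K n
      Φ a = φ (comb a basis)
      code : Code (λ x → ∃ λ a → Φ a ≡ x)
      code = canon record
        { dec      = λ x → search k λ a → Φ a ≟ᵛ x
        ; 0-closed = 0ᵛ , φ-unique (≈ᴹ-trans (comb-0 E.basis) (≈ᴹ-sym (comb-0 basis)))
        ; +-closed = λ { (a , refl) (b , refl) → a +ᵛ b , trans (φ-cong (comb-+ a b basis)) (φ-+ _ _) }
        ; *-closed = λ { d (a , refl) → d *ᵛ a , trans (φ-cong (comb-* d a basis)) (φ-* d _) }
        }

    represents-unique : ∀ {p} {C D : Sub n} {Q : Pred Carrierᴹ p} → Represents C Q → Represents D Q → C ≡ D
    represents-unique {C = C} {D} {Q} r s = ⊆-antisym {A = C} {D} (included r s) (included s r)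
      where
      included : ∀ {C D} → Represents C Q → Represents D Q → C ⊆ D
      included {C} {D} r s x x∈C = subst (_∈ D) (φ-ψ x) (⇒∈ s (ψ x) (∈⇒ r (ψ x) (subst (_∈ C) (sym (φ-ψ x)) x∈C)))

    represents-∩ : ∀ {p p′} {C D : Sub n} {Q : Pred Carrierᴹ p} {Q′ : Pred Carrierᴹ p′} →
      Represents C Q → Represents D Q′ → Represents (C ∩ D) (λ x → Q x × Q′ x)
    represents-∩ {C = C} {D} r s = record
      { ⇒∈ = λ { x (p , p′) → ∈∩⁺ C D (⇒∈ r x p) (⇒∈ s x p′) }
      ; ∈⇒ = λ x x∈ → let p , p′ = ∈∩⁻ C D x∈ in ∈⇒ r x p , ∈⇒ s x p′
      }

-- Maxima, minima and symmetric differences of subsets of [n].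

module SubsetOrder where
  open import Data.Fin.Subset using (inside; outside; _∪_; _─_)
  open import Data.Nat.Base
  open import Data.Nat.Properties
  open import Data.Vec.Base using (_∷_; there)
  open SubsetElements

  infix 4 _∈ₙ?_
  _∈ₙ?_ : ∀ {n} k (M : Subset n) → Dec (k ∈ₙ M)
  k ∈ₙ? M = map′ ∈ᵇ⇒∈ₙ ∈ₙ⇒∈ᵇ ((k ∈ᵇ M) Bool.≟ true)

  ∈ₙ-∪ : ∀ {n k} {M N : Subset n} → k ∈ₙ M ⊎ k ∈ₙ N → k ∈ₙ M ∪ N
  ∈ₙ-∪ (inj₁ (i , i∈ , eq)) = i , Subset.x∈p∪q⁺ (inj₁ i∈) , eq
  ∈ₙ-∪ (inj₂ (i , i∈ , eq)) = i , Subset.x∈p∪q⁺ (inj₂ i∈) , eq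

  ∉-─ : ∀ {n} (p q : Subset n) {i} → i ∈ˢ p ─ q → i ∉ˢ q
  ∉-─ (_ ∷ p) (inside  ∷ q) (there i∈) (there i∈q) = ∉-─ p q i∈ i∈q
  ∉-─ (_ ∷ p) (outside ∷ q) (there i∈) (there i∈q) = ∉-─ p q i∈ i∈q

  ∈ₙ-index : ∀ {n} {M : Subset n} {i : Fin n} → value i ∈ₙ M → i ∈ˢ M
  ∈ₙ-index (j , j∈ , eq) = subst (_∈ˢ _) (value-injective eq) j∈

  ∈ₙ-△⁻ : ∀ {n k} {M N : Subset n} → k ∈ₙ M △ N → (k ∈ₙ M × ¬ k ∈ₙ N) ⊎ (k ∈ₙ N × ¬ k ∈ₙ M)
  ∈ₙ-△⁻ {M = M} {N} (i , i∈ , refl) with Subset.x∈p∪q⁻ (M ─ N) (N ─ M) i∈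
  ... | inj₁ i∈M─N = inj₁ ((i , Subset.p─q⊆p M N i∈M─N , refl) , ∉-─ M N i∈M─N ∘ ∈ₙ-index)
  ... | inj₂ i∈N─M = inj₂ ((i , Subset.p─q⊆p N M i∈N─M , refl) , ∉-─ N M i∈N─M ∘ ∈ₙ-index)

  ∈ₙ-△⁺ : ∀ {n k} {M N : Subset n} → (k ∈ₙ M × ¬ k ∈ₙ N) ⊎ (k ∈ₙ N × ¬ k ∈ₙ M) → k ∈ₙ M △ N
  ∈ₙ-△⁺ (inj₁ ((i , i∈ , refl) , ∉N)) = i , Subset.x∈p∪q⁺ (inj₁ (Subset.x∈p∧x∉q⇒x∈p─q i∈ λ i∈N → ∉N (i , i∈N , refl))) , refl
  ∈ₙ-△⁺ (inj₂ ((i , i∈ , refl) , ∉M)) = i , Subset.x∈p∪q⁺ (inj₂ (Subset.x∈p∧x∉q⇒x∈p─q i∈ λ i∈M → ∉M (i , i∈M , refl))) , refl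

  maximum : ∀ {n k} {M : Subset n} → k ∈ₙ M → ∃ λ m → IsMax M m
  maximum {n} {_} {M} k∈M = go n λ l (i , _ , eq) → subst (_≤ n) eq (Fin.toℕ<n i)
    where
    go : ∀ b → (∀ l → l ∈ₙ M → l ≤ b) → ∃ λ m → IsMax M m
    go b ≤b with b ∈ₙ? M
    ... | yes b∈M = b , b∈M , ≤b
    go zero    ≤b | no b∉M = contradiction (subst (_∈ₙ M) (n≤0⇒n≡0 (≤b _ k∈M)) k∈M) b∉M
    go (suc b) ≤b | no b∉M = go b λ l l∈M → ≤-pred (≤∧≢⇒< (≤b l l∈M) λ { refl → b∉M l∈M })

  minimum : ∀ {n k} {M : Subset n} → k ∈ₙ M → ∃ λ m → IsMin M m
  minimum {n} {k} {M} k∈M = go k 0 (+-identityʳ k) (λ _ _ → z≤n)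
    where
    go : ∀ d b → d + b ≡ k → (∀ l → l ∈ₙ M → b ≤ l) → ∃ λ m → IsMin M m
    go d b eq b≤ with b ∈ₙ? M
    ... | yes b∈M = b , b∈M , b≤
    go zero    b refl b≤ | no b∉M = contradiction k∈M b∉M
    go (suc d) b eq   b≤ | no b∉M = go d (suc b) (trans (+-suc d b) eq)
      λ l l∈M → ≤∧≢⇒< (b≤ l l∈M) λ { refl → b∉M l∈M }

  IsMax-unique : ∀ {n k l} {M : Subset n} → IsMax M k → IsMax M l → k ≡ l
  IsMax-unique (k∈ , ≤k) (l∈ , ≤l) = ≤-antisym (≤l _ k∈) (≤k _ l∈)

  △-agree : ∀ {n d} {M N : Subset n} → IsMax (M △ N) d → ∀ k → d < k → (k ∈ₙ M → k ∈ₙ N) × (k ∈ₙ N → k ∈ₙ M)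
  △-agree {d = d} {M} {N} (_ , ≤d) k d<k =
    (λ k∈M → decidable-stable (k ∈ₙ? N) λ k∉N → <⇒≱ d<k (≤d k (∈ₙ-△⁺ (inj₁ (k∈M , k∉N))))) ,
    (λ k∈N → decidable-stable (k ∈ₙ? M) λ k∉M → <⇒≱ d<k (≤d k (∈ₙ-△⁺ (inj₂ (k∈N , k∉M)))))

  ≢⇒△-maximum : ∀ {n} {M N : Subset n} → M ≢ N → ∃ λ d → IsMax (M △ N) d
  ≢⇒△-maximum {M = M} {N} M≢N with Subset.nonempty? (M △ N)
  ... | yes (i , i∈) = maximum (i , i∈ , refl)
  ... | no  empty    = contradiction (Subset.⊆-antisym
    (λ {i} i∈M → decidable-stable (i Subset.∈? N) λ i∉N →
      empty (i , Subset.x∈p∪q⁺ (inj₁ (Subset.x∈p∧x∉q⇒x∈p─q i∈M i∉N))))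
    (λ {i} i∈N → decidable-stable (i Subset.∈? M) λ i∉M →
      empty (i , Subset.x∈p∪q⁺ (inj₂ (Subset.x∈p∧x∉q⇒x∈p─q i∈N i∉M))))) M≢N

-- From families of subspaces of V to Boolean families of echelon forms.

module Transfer {c ℓ₁ ℓ₂ v ℓv : Level} {q : ℕ} .{{_ : NonTrivial q}} (F : HeytingField c ℓ₁ ℓ₂)
         (card : CommutativeRing.setoid (fieldRing F) HasCardinality q)
         (V : Module (fieldRing F) v ℓv) {n : ℕ} (dimV : VectorSpace.HasDim F V U n) where
  open import Data.List.Base using (List; allFin)
  open import Data.Nat.Base using (_≤_)
  open import Level using (Lift; lift)
  open import Relation.Unary using (_⊆_; Satisfiable)
  open Counting
  open SubsetElements using (_∈ᵇ_; ∈ᵇ⇒∈ₙ; ∈ₙ⇒∈ᵇ)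
  open FieldTransport
  open SubsetOrder

  open Coordinates F card V dimV
  open Subspaces 𝔽 using (Sub; dim; +∈; *∈; 0∈) renaming (_∈_ to _∈ᶜ_)
  open Dimension 𝔽 using (_≟ₛ_)
  open Constructions 𝔽 using (_∩_)
  open Families 𝔽
  open VectorSpace F V
  open Module V
  private
    module F = HeytingField F
    module K = Inverse card

  abstract
    subspace-linear : ∀ {p} (W : Subspace p) → IsLinearSubset ⟦ W ⟧
    subspace-linear W = record
      { respects = resp-≈ᴹ ; 0-closed = 0ᴹ-closed ; +-closed = +ᴹ-closed ; *-closed = *ₗ-closed }
      where open Subspace W

    ∩-linear : ∀ {p} (W W′ : Subspace p) → IsLinearSubset (λ x → ⟦ W ⟧ x × ⟦ W′ ⟧ x)
    ∩-linear W W′ = record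
      { respects = λ eq (p , p′) → W.resp-≈ᴹ eq p , W′.resp-≈ᴹ eq p′
      ; 0-closed = W.0ᴹ-closed , W′.0ᴹ-closed
      ; +-closed = λ (p , p′) (r , r′) → W.+ᴹ-closed p r , W′.+ᴹ-closed p′ r′
      ; *-closed = λ a (p , p′) → W.*ₗ-closed a p , W′.*ₗ-closed a p′
      }
      where
      module W = Subspace W
      module W′ = Subspace W′

  -- `Lift` raises membership, which lives at the lowest level, to the level p of the subspaces in
  -- the families.
  realise : ∀ p → Sub n → Subspace p
  realise p C = record
    { ⟦_⟧       = λ x → Lift p (φ x ∈ᶜ C)
    ; resp-≈ᴹ   = λ eq (lift h) → lift (subst (_∈ᶜ C) (φ-cong eq) h)
    ; 0ᴹ-closed = lift (subst (_∈ᶜ C) (sym (φ-unique (comb-0 (HasDim.basis dimV)))) (0∈ C))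
    ; +ᴹ-closed = λ {x} {y} (lift h) (lift h′) → lift (subst (_∈ᶜ C) (sym (φ-+ x y)) (+∈ {W = C} h h′))
    ; *ₗ-closed = λ a {x} (lift h) → lift (subst (_∈ᶜ C)
        (trans (sym (φ-* (K.to a) x)) (φ-cong (*ₗ-cong (K.strictlyInverseʳ a) ≈ᴹ-refl))) (*∈ {W = C} (K.to a) h))
    }

  realise-represents : ∀ p C → Represents C ⟦ realise p C ⟧
  realise-represents p C = record { ⇒∈ = λ x (lift h) → h ; ∈⇒ = λ x h → lift h }

  abstract
    hasDim⇒dim≡ : ∀ {p} (W : Subspace p) {C k} → Represents C ⟦ W ⟧ → HasDim ⟦ W ⟧ k → dim C ≡ k
    hasDim⇒dim≡ W rep dimW with represent (subspace-linear W) dimW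
    ... | D , rep′ , refl = cong dim (represents-unique rep rep′)

    meets⇒≤ : ∀ {p t} {W W′ : Subspace p} {C D} → Represents C ⟦ W ⟧ → Represents D ⟦ W′ ⟧ →
              dim[ W ∩ W′ ]≥ t → t ≤ dim (C ∩ D)
    meets⇒≤ {W = W} {W′} {C} {D} r s (d , dim∩ , t≤d) with represent (∩-linear W W′) dim∩
    ... | E , rep , refl = subst (λ X → _ ≤ dim X) (represents-unique rep (represents-∩ r s)) t≤d

    ≤⇒meets : ∀ {p t} {W W′ : Subspace p} {C D} → Represents C ⟦ W ⟧ → Represents D ⟦ W′ ⟧ →
              t ≤ dim (C ∩ D) → dim[ W ∩ W′ ]≥ t
    ≤⇒meets r s t≤ = _ , represents⇒hasDim (represents-∩ r s) , t≤

    represents-≐ : ∀ {p} {W W′ : Subspace p} {C} → W ≈ₛ W′ → Represents C ⟦ W ⟧ → Represents C ⟦ W′ ⟧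
    represents-≐ (W⊆W′ , W′⊆W) r = record
      { ⇒∈ = λ x p → ⇒∈ r x (W′⊆W p) ; ∈⇒ = λ x h → W⊆W′ (∈⇒ r x h) }

    represents⇒≈ₛ : ∀ {p} {W W′ : Subspace p} {C} → Represents C ⟦ W ⟧ → Represents C ⟦ W′ ⟧ → W ≈ₛ W′
    represents⇒≈ₛ r s = (λ {x} p → ∈⇒ s x (⇒∈ r x p)) , (λ {x} p → ∈⇒ r x (⇒∈ s x p))

  meets-sym : ∀ {p t} {W W′ : Subspace p} → dim[ W ∩ W′ ]≥ t → dim[ W′ ∩ W ]≥ t
  meets-sym (d , dim∩ , t≤d) = d , record
    { basis       = D.basis
    ; basis∈W     = λ i → proj₂ (D.basis∈W i) , proj₁ (D.basis∈W i)
    ; independent = D.independent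
    ; spanning    = λ { x (y , z) → D.spanning x (z , y) }
    } , t≤d
    where module D = HasDim dim∩

  module FamilyCode {p f} (𝓐 : Family p f) (M : Subset n) (𝒜⊆ : Family.members 𝓐 ⊆ GrassOf M)
                    (some : Satisfiable (Family.members 𝓐)) (k : ℕ) (card𝒜 : Family.setoid 𝓐 HasCardinality k) where
    private
      module I = Inverse card𝒜
      𝒜 = Family.members 𝓐

    code : ∀ {W} → 𝒜 W → ∃ λ C → Represents C ⟦ W ⟧ × dim C ∈ₙ M
    code {W} W∈ with 𝒜⊆ W∈
    ... | l , l∈M , dimW with represent (subspace-linear W) dimW
    ... | C , rep , refl = C , rep , l∈M

    codeᵢ : Fin k → Sub n
    codeᵢ i = proj₁ (code (proj₂ (I.from i)))

    represents-codeᵢ : ∀ i → Represents (codeᵢ i) ⟦ proj₁ (I.from i) ⟧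
    represents-codeᵢ i = proj₁ (proj₂ (code (proj₂ (I.from i))))

    -- 𝒜 comes without a decision procedure, but its bijection with `Fin k` lists the members, and
    -- this list can be searched.
    codes : Sub n → Bool
    codes C = does (Fin.any? λ i → codeᵢ i ≟ₛ C)

    codes⇒index : ∀ {C} → codes C ≡ true → ∃ λ i → codeᵢ i ≡ C
    codes⇒index {C} = does⇒ (Fin.any? λ i → codeᵢ i ≟ₛ C)

    codes⇒ : ∀ {C} → codes C ≡ true → ∃ λ W → 𝒜 W × Represents C ⟦ W ⟧
    codes⇒ h with codes⇒index h
    ... | i , refl = proj₁ (I.from i) , proj₂ (I.from i) , represents-codeᵢ i

    codes⇒∈ : ∀ {C} W → Represents C ⟦ W ⟧ → codes C ≡ true → 𝒜 W
    codes⇒∈ W rep h with codes⇒ h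
    ... | W′ , W′∈ , rep′ = Family.resp-≈ₛ 𝓐 (represents⇒≈ₛ {W = W′} {W} rep′ rep) W′∈

    ∈⇒codes : ∀ {W C} → 𝒜 W → Represents C ⟦ W ⟧ → codes C ≡ true
    ∈⇒codes {W} {C} W∈ rep = dec-true (Fin.any? λ i → codeᵢ i ≟ₛ C)
      (i , represents-unique (represents-≐ {W = proj₁ (I.from i)} {W} (I.strictlyInverseʳ (W , W∈)) (represents-codeᵢ i)) rep)
      where i = I.to (W , W∈)

    codes⇒dim∈ : ∀ {C} → codes C ≡ true → dim C ∈ₙ M
    codes⇒dim∈ h with codes⇒index h
    ... | i , refl = proj₂ (proj₂ (code (proj₂ (I.from i))))

    some-code : ∃ λ C → codes C ≡ true
    some-code = let W , W∈ = some ; C , rep , _ = code W∈ in C , ∈⇒codes W∈ rep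

    codeᵢ-injective : ∀ {i j} → codeᵢ i ≡ codeᵢ j → i ≡ j
    codeᵢ-injective {i} {j} eq = trans (sym (I.strictlyInverseˡ i)) (trans
      (I.to-cong (represents⇒≈ₛ {W = proj₁ (I.from i)} {proj₁ (I.from j)} (represents-codeᵢ i)
        (subst (λ C → Represents C ⟦ proj₁ (I.from j) ⟧) (sym eq) (represents-codeᵢ j))))
      (I.strictlyInverseˡ j))

    index : Sub n → Fin k
    index C with Fin.any? (λ i → codeᵢ i ≟ₛ C)
    ... | yes (i , _) = i
    -- A default value; the index matters only at echelon forms of members.
    ... | no  _       = I.to some

    codeᵢ-index : ∀ C → codes C ≡ true → codeᵢ (index C) ≡ C
    codeᵢ-index C h with Fin.any? (λ i → codeᵢ i ≟ₛ C)
    ... | yes (i , eq) = eq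

    size-codes : size codes ≡ k
    size-codes = trans (ℕ.≤-antisym
      (count-injective Fin._≟_ index codes (const true) (allFin k) (unique-allSub n) (λ _ _ → refl) ∈-allFin
        λ {C} {D} p r eq → trans (sym (codeᵢ-index C p)) (trans (cong codeᵢ eq) (codeᵢ-index D r)))
      (count-injective _≟ₛ_ codeᵢ (const true) codes (allSub n) (Unique.allFin⁺ k)
        (λ i _ → dec-true (Fin.any? λ j → codeᵢ j ≟ₛ codeᵢ i) (i , refl)) ∈allSub λ _ _ → codeᵢ-injective))
      (trans (count-true (allFin k)) (List.length-tabulate {n = k} id))

  module _ {p f g} (t : ℕ) (𝓐 : Family p f) (𝓑 : Family p g) (R S : Subset n)
           (𝒜⊆ : Family.members 𝓐 ⊆ GrassOf R) (ℬ⊆ : Family.members 𝓑 ⊆ GrassOf S)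
           (some𝒜 : Satisfiable (Family.members 𝓐)) (someℬ : Satisfiable (Family.members 𝓑))
           (k l : ℕ) (card𝒜 : Family.setoid 𝓐 HasCardinality k) (cardℬ : Family.setoid 𝓑 HasCardinality l) where

    private
      𝒜 = Family.members 𝓐
      ℬ = Family.members 𝓑
      module A = FamilyCode 𝓐 R 𝒜⊆ some𝒜 k card𝒜
      module B = FamilyCode 𝓑 S ℬ⊆ someℬ l cardℬ

    pair : CrossIntersecting t 𝒜 ℬ → Pair t (_∈ᵇ R) (_∈ᵇ S) A.codes B.codes
    pair crossing = record
      { dims-𝒜 = ∈ₙ⇒∈ᵇ ∘ A.codes⇒dim∈
      ; dims-ℬ = ∈ₙ⇒∈ᵇ ∘ B.codes⇒dim∈
      ; cross  = λ C∈ D∈ → let W , W∈ , r = A.codes⇒ C∈ ; W′ , W′∈ , s = B.codes⇒ D∈ in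
          meets⇒≤ {W = W} {W′} r s (crossing W W′ W∈ W′∈)
      ; some-𝒜 = A.some-code
      ; some-ℬ = B.some-code
      }

    star⇒singletonAndMeeting : ∀ {r} → CrossIntersecting t 𝒜 ℬ → IsStar t r (_∈ᵇ S) A.codes B.codes →
                               SingletonAndMeeting t r S 𝒜 ℬ
    star⇒singletonAndMeeting {r} crossing (C , dimC≡r , 𝒜≡ , ℬ≡) with A.codes⇒ (trans (𝒜≡ C) (dec-true (C ≟ₛ C) refl))
    ... | X , X∈ , rep = X , subst (HasDim ⟦ X ⟧) dimC≡r (represents⇒hasDim rep) ,
      ( (λ {Y} Y∈ → let D , rep′ , _ = A.code Y∈
                        D≡C = does⇒ (D ≟ₛ C) (trans (sym (𝒜≡ D)) (A.∈⇒codes Y∈ rep′)) in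
          represents⇒≈ₛ {W = Y} {X} (subst (λ E → Represents E ⟦ Y ⟧) D≡C rep′) rep)
      , (λ {Y} Y≈X → Family.resp-≈ₛ 𝓐 (proj₂ Y≈X , proj₁ Y≈X) X∈)) ,
      ( (λ {Y} Y∈ → ℬ⊆ Y∈ , let D , rep′ , _ = B.code Y∈ in
          ≤⇒meets {W = Y} {X} rep′ rep (subst (λ E → t ≤ dim E) (∩-comm C D)
            (meets⇒≤ {W = X} {Y} rep rep′ (crossing X Y X∈ Y∈))))
      , (λ {Y} (Y∈S , meets) → member Y Y∈S meets))
      where
      member : ∀ Y → GrassOf S Y → dim[ Y ∩ X ]≥ t → ℬ Y
      member Y (d , d∈S , dimY) meets with represent (subspace-linear Y) dimY
      ... | D , rep′ , refl = B.codes⇒∈ Y rep′ (trans (ℬ≡ D) (cong₂ _∧_ (∈ₙ⇒∈ᵇ d∈S)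
        (≤ᵇ-true (subst (λ E → t ≤ dim E) (∩-comm D C) (meets⇒≤ {W = Y} {X} rep′ rep meets)))))

    singletonAndMeeting⇒star : ∀ {r} → SingletonAndMeeting t r S 𝒜 ℬ → IsStar t r (_∈ᵇ S) A.codes B.codes
    singletonAndMeeting⇒star {r} (X , dimX , 𝒜≐ , ℬ≐) with A.code (proj₂ 𝒜≐ {X} (id , id))
    ... | C , rep , _ = C , hasDim⇒dim≡ X rep dimX ,
      (λ D → iff⇒≡
        (λ D∈ → let W , W∈ , rep′ = A.codes⇒ D∈ in
          dec-true (D ≟ₛ C) (represents-unique (represents-≐ {W = W} {X} (proj₁ 𝒜≐ W∈) rep′) rep))
        (λ h → subst (λ E → A.codes E ≡ true) (sym (does⇒ (D ≟ₛ C) h)) (A.∈⇒codes (proj₂ 𝒜≐ {X} (id , id)) rep))) ,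
      λ D → iff⇒≡
        (λ D∈ → let W , W∈ , rep′ = B.codes⇒ D∈ in cong₂ _∧_ (∈ₙ⇒∈ᵇ (B.codes⇒dim∈ D∈))
          (≤ᵇ-true (subst (λ E → t ≤ dim E) (∩-comm D C) (meets⇒≤ {W = W} {X} rep′ rep (proj₂ (proj₁ ℬ≐ W∈))))))
        -- D is an arbitrary echelon form, so a subspace of V with this form is produced before the
        -- description of ℬ can be applied.
        (λ h → let D∈S , t≤ = ∧-true h ; W = realise p D ; rep′ = realise-represents p D in
          B.∈⇒codes {W} (proj₂ ℬ≐ ((dim D , ∈ᵇ⇒∈ₙ D∈S , represents⇒hasDim rep′) ,
            ≤⇒meets {W = W} {X} rep′ rep (subst (λ E → t ≤ dim E) (∩-comm C D) (true-≤ᵇ t≤)))) rep′)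

-- The bound and its equality cases.

open import Data.Fin.Subset using (_∪_)
open import Data.Nat.Base using (s≤s; _+_; _*_; _∸_; _^_; _≤_; _<_)
open import Relation.Unary using (_⊆_; Satisfiable)
open WeightedSums using (value≤)
open SubsetOrder
open SubsetElements using (∈ᵇ⇒∈ₙ; ∈ₙ⇒∈ᵇ; _∈ᵇ_)

IsMax⇒IsMaximum : ∀ {n} {M : Subset n} {m} → IsMax M m → (m ∈ᵇ M) ≡ true × (∀ k → (k ∈ᵇ M) ≡ true → k ≤ m)
IsMax⇒IsMaximum (m∈ , ≤m) = ∈ₙ⇒∈ᵇ m∈ , λ k k∈ → ≤m k (∈ᵇ⇒∈ₙ k∈)

theorem1p2 : ∀ {c ℓ₁ ℓ₂ v ℓv p f g : Level}
    (q : ℕ) (q-primePower : PrimePower q)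
    (F : HeytingField c ℓ₁ ℓ₂) →
    CommutativeRing.setoid (fieldRing F) HasCardinality q →
    (V : Module (fieldRing F) v ℓv) →
    let open VectorSpace F V
        open Bound q {{primePower⇒nonTrivial q-primePower}}
    in
    (n r s t : ℕ) → 0 < n → 0 < r → 0 < s → 0 < t →
    HasDim U n →
    (R S : Subset n) →
    (∀ μ → IsMin (R ∪ S) μ → t ≤ μ) →
    IsMax R r → IsMax S s →
    r + s ∸ t < n →
    (𝓐 : Family p f) (𝓑 : Family p g) →
    let 𝒜 = Family.members 𝓐
        ℬ = Family.members 𝓑
    in
    𝒜 ⊆ GrassOf R → ℬ ⊆ GrassOf S →
    Satisfiable 𝒜 → Satisfiable ℬ →
    CrossIntersecting t 𝒜 ℬ →
    (∣𝒜∣ ∣ℬ∣ : ℕ) →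
    Family.setoid 𝓐 HasCardinality ∣𝒜∣ →
    Family.setoid 𝓑 HasCardinality ∣ℬ∣ →
    (∣𝒜∣ + ∣ℬ∣ ≤ bound t r s R S)
    × (R ≡ S →
        (∣𝒜∣ + ∣ℬ∣ ≡ bound t r s R S) ⇔
        ( SingletonAndMeeting t r S 𝒜 ℬ
        ⊎ SingletonAndMeeting t s R ℬ 𝒜 ))
    × (R ≢ S → s ^ 2 + r ^ 2 + s * r ≤ n →
        (∣𝒜∣ + ∣ℬ∣ ≡ bound t r s R S) ⇔
        ( (∃ λ d → IsMax (R △ S) d × d ∈ₙ S × SingletonAndMeeting t r S 𝒜 ℬ)
        ⊎ (∃ λ d → IsMax (R △ S) d × d ∈ₙ R × SingletonAndMeeting t s R ℬ 𝒜) ))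
theorem1p2 {p = p} q q-primePower F card V n r s t 0<n 0<r 0<s 0<t dimV R S t≤min R-max S-max r+s∸t<n 𝓐 𝓑
  𝒜⊆ ℬ⊆ some𝒜 someℬ crossing k l card𝒜 cardℬ =
  subst (_≤ bound t r s R S) sizes (size≤bound t 0<t ρ-max σ-max r≤n s≤n r+s<n+t f g star-r star-s P) ,
  (λ R≡S → mk⇔ extremal [ (λ h → trans (size-left h) (bound≡left (ℕ.≤-reflexive (sym (f≡g R≡S)))))
                        , (λ h → trans (size-right h) (bound≡right (ℕ.≤-reflexive (f≡g R≡S)))) ]′) ,
  λ R≢S large → mk⇔ (λ eq → by-maximum large eq (≢⇒△-maximum R≢S) (extremal eq))
    [ (λ (d , d-max , d∈S , h) → trans (size-left h) (bound≡left (ℕ.<⇒≤ (left-wins large d-max d∈S))))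
    , (λ (d , d-max , d∈R , h) → trans (size-right h) (bound≡right (ℕ.<⇒≤ (right-wins large d-max d∈R)))) ]′
  where
  instance
    q-nonTrivial : NonTrivial q
    q-nonTrivial = primePower⇒nonTrivial q-primePower
  open VectorSpace F V
  open Bound q
  open Coordinates F card V dimV using (𝔽)
  open Families 𝔽
  open GaussianProperties q
  open GaussianGrowth q
  module T = Transfer F card V dimV
  module A = T.FamilyCode 𝓐 R 𝒜⊆ some𝒜 k card𝒜
  module B = T.FamilyCode 𝓑 S ℬ⊆ someℬ l cardℬ
  𝒜 = Family.members 𝓐
  ℬ = Family.members 𝓑
  f = sumOver S (meeting n t r)
  g = sumOver R (meeting n t s)
  ρ-max = IsMax⇒IsMaximum R-max
  σ-max = IsMax⇒IsMaximum S-max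
  r≤n = value≤ (proj₁ R-max)
  s≤n = value≤ (proj₁ S-max)
  -- r + s ≤ t + (r + s ∸ t) holds even where the subtraction is truncated.
  r+s<n+t : r + s < n + t
  r+s<n+t = ℕ.≤-<-trans (ℕ.m≤n+m∸n (r + s) t) (ℕ.<-≤-trans (ℕ.+-monoʳ-< t r+s∸t<n) (ℕ.≤-reflexive (ℕ.+-comm t n)))
  star-r = λ A → StarSize.size-star 𝔽 t S A
  star-s = λ B → StarSize.size-star 𝔽 t R B
  P = T.pair t 𝓐 𝓑 R S 𝒜⊆ ℬ⊆ some𝒜 someℬ k l card𝒜 cardℬ crossing
  sizes : size A.codes + size B.codes ≡ k + l
  sizes = cong₂ _+_ A.size-codes B.size-codes
  crossing′ : CrossIntersecting t ℬ 𝒜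
  crossing′ Y X Y∈ X∈ = T.meets-sym {W = X} {Y} (crossing X Y X∈ Y∈)
  t≤R : ∀ j → j ∈ₙ R → t ≤ j
  -- The hypothesis speaks of the minimum of R ∪ S, so this minimum has to be found first.
  t≤R j j∈ = let μ , μ-min = minimum (∈ₙ-∪ {M = R} {S} (inj₁ j∈)) in
    ℕ.≤-trans (t≤min μ μ-min) (proj₂ μ-min j (∈ₙ-∪ {M = R} {S} (inj₁ j∈)))
  t≤S : ∀ j → j ∈ₙ S → t ≤ j
  t≤S j j∈ = let μ , μ-min = minimum (∈ₙ-∪ {M = R} {S} (inj₂ j∈)) in
    ℕ.≤-trans (t≤min μ μ-min) (proj₂ μ-min j (∈ₙ-∪ {M = R} {S} (inj₂ j∈)))

  Left = SingletonAndMeeting t r S 𝒜 ℬ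
  Right = SingletonAndMeeting t s R ℬ 𝒜

  extremal : k + l ≡ bound t r s R S → Left ⊎ Right
  extremal eq = [ inj₁ ∘ T.star⇒singletonAndMeeting t 𝓐 𝓑 R S 𝒜⊆ ℬ⊆ some𝒜 someℬ k l card𝒜 cardℬ crossing
                , inj₂ ∘ T.star⇒singletonAndMeeting t 𝓑 𝓐 S R ℬ⊆ 𝒜⊆ someℬ some𝒜 l k cardℬ card𝒜 crossing′ ]′
    (size≡bound⇒star t 0<t ρ-max σ-max r≤n s≤n r+s<n+t f g star-r star-s P (trans sizes eq))

  size-left : Left → k + l ≡ 1 + f
  size-left h = trans (sym sizes) (star⇒size t 0<t ρ-max σ-max r≤n s≤n r+s<n+t f g star-r star-s
    (T.singletonAndMeeting⇒star t 𝓐 𝓑 R S 𝒜⊆ ℬ⊆ some𝒜 someℬ k l card𝒜 cardℬ h))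

  size-right : Right → k + l ≡ 1 + g
  size-right h = trans (sym sizes) (star⇒size′ t 0<t ρ-max σ-max r≤n s≤n r+s<n+t f g star-r star-s
    (T.singletonAndMeeting⇒star t 𝓑 𝓐 S R ℬ⊆ 𝒜⊆ someℬ some𝒜 l k cardℬ card𝒜 h))

  bound≡left : g ≤ f → 1 + f ≡ bound t r s R S
  bound≡left g≤f = sym (ℕ.m≥n⇒m⊔n≡m (s≤s g≤f))

  bound≡right : f ≤ g → 1 + g ≡ bound t r s R S
  bound≡right f≤g = sym (ℕ.m≤n⇒m⊔n≡n (s≤s f≤g))

  f≡g : R ≡ S → f ≡ g
  f≡g R≡S = cong₂ (λ M m → sumOver M (meeting n t m)) (sym R≡S)
    (IsMax-unique R-max (subst (λ M → IsMax M s) (sym R≡S) S-max))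

  left-wins : ∀ {d} → s ^ 2 + r ^ 2 + s * r ≤ n → IsMax (R △ S) d → d ∈ₙ S → g < f
  left-wins large d-max d∈S = sumOver-meeting-< n t 0<r 0<s large R-max S-max t≤R t≤S d∈S
    ([ (λ (_ , d∉S) → contradiction d∈S d∉S) , proj₂ ]′ (∈ₙ-△⁻ (proj₁ d-max))) (△-agree d-max)

  right-wins : ∀ {d} → s ^ 2 + r ^ 2 + s * r ≤ n → IsMax (R △ S) d → d ∈ₙ R → f < g
  right-wins large d-max d∈R = sumOver-meeting-< n t 0<s 0<r
    (subst (_≤ n) (cong₂ _+_ (ℕ.+-comm (s ^ 2) (r ^ 2)) (ℕ.*-comm s r)) large) S-max R-max t≤S t≤R d∈R
    ([ proj₂ , (λ (_ , d∉R) → contradiction d∈R d∉R) ]′ (∈ₙ-△⁻ (proj₁ d-max)))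
    λ j d<j → let R⇒S , S⇒R = △-agree d-max j d<j in S⇒R , R⇒S

  by-maximum : s ^ 2 + r ^ 2 + s * r ≤ n → k + l ≡ bound t r s R S → (∃ λ d → IsMax (R △ S) d) → Left ⊎ Right →
    (∃ λ d → IsMax (R △ S) d × d ∈ₙ S × Left) ⊎ (∃ λ d → IsMax (R △ S) d × d ∈ₙ R × Right)
  by-maximum large eq (d , d-max) h with ∈ₙ-△⁻ (proj₁ d-max) | h
  ... | inj₂ (d∈S , _) | inj₁ left  = inj₁ (d , d-max , d∈S , left)
  ... | inj₁ (d∈R , _) | inj₂ right = inj₂ (d , d-max , d∈R , right)
  -- The wrong star: its size would equal the bound, but the other star is strictly larger.
  ... | inj₂ (d∈S , _) | inj₂ right = contradiction
    (ℕ.≤-reflexive (ℕ.suc-injective (trans (bound≡left (ℕ.<⇒≤ g<f)) (trans (sym eq) (size-right right))))) (ℕ.<⇒≱ g<f)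
    where g<f = left-wins large d-max d∈S
  ... | inj₁ (d∈R , _) | inj₁ left = contradiction
    (ℕ.≤-reflexive (ℕ.suc-injective (trans (bound≡right (ℕ.<⇒≤ f<g)) (trans (sym eq) (size-left left))))) (ℕ.<⇒≱ f<g)
    where f<g = right-wins large d-max d∈R
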